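{- For any 2-party binary protocol $\pi$ and any constant $\epsilon>0$ there exists a protocol $\Pi$, using potent tree codes, that simulates $\pi$ over a noisy channel in which up to a $\tfrac14-\epsilon$ fraction of the transmitted symbols may be corrupted adversarially, imposes a constant slowdown (the length of $\Pi$ is at most a constant, depending on $\epsilon$ only, times the length of $\pi$, with symbols from a constant-size alphabet), and succeeds except with probability negligible in the length of $\pi$.
   Context: A 2-party binary protocol $\pi$ of length $T$ is an interactive protocol in which two users with private inputs $x_A,x_B$ exchange bits over a noiseless channel, each bit being a function of the sender's input and the bits received so far. A protocol $\Pi$ simulates $\pi$ successfully over a noisy channel if at its end both users know the transcript that $\pi$ would produce on $(x_A,x_B)$ over a noiseless channel. No computational efficiency of $\Pi$ is claimed. A function $f(n)$ is negligible if for every polynomial $P$ and all sufficiently large $n$, $f(n)<1/P(n)$. The probability is over the random choice of the (shared) tree code. A tree code of depth $N$ over a finite alphabet $S$ is a complete rooted $d$-ary tree of depth $N$ whose arcs carry labels in $S$. $W(s)$ is the concatenation of the labels from the root to node $s$, and $\Delta$ is Hamming distance. Two nodes $u,v$ at the same depth $h$ with least common ancestor $w$ at depth $h-\ell$ are $\alpha$-bad if $\Delta(W(u),W(v))<\alpha\ell$; then the paths from $w$ to $u$ and from $w$ to $v$ are $\alpha$-bad paths of length $\ell$. The tree code is $(\varepsilon,\alpha)$-potent if for every root-to-leaf path $Q$ the union of all $\alpha$-bad subpaths of $Q$ has length less than $\varepsilon N$. "Using potent tree codes" means that each user encodes its successive messages online by walking down a (potent) tree code from the root, transmitting the labels of the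 traversed arcs, and the other user decodes the received label string to a node of the tree. -}

module Defs where

open import Data.Bool.Base using (Bool)
import Data.Bool.Properties as Bool
open import Data.Fin.Base using (Fin; zero; suc; toℕ)
import Data.Fin.Properties as Fin
open import Data.Integer.Base using (+_)
open import Data.List.Base as List using (List; []; _∷_)
open import Data.List.Properties using (length-map)
open import Data.Nat.Base as ℕ using (ℕ; zero; suc; z≤n; s≤s; NonZero)
import Data.Nat.Properties as ℕ
open import Data.Product.Base using (_×_; _,_; ∃; ∃-syntax; Σ-syntax)
open import Data.Rational.Base as ℚ using (ℚ; 0ℚ; 1ℚ; _/_)
import Data.Rational.Properties as ℚ
open import Data.Vec.Base as Vec using (Vec; []; _∷_)
import Data.Vec.Properties as Vec
open import Function.Base using (_∘_)
open import Relation.Binary.PropositionalEquality.Core using (_≡_; sym; subst)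
open import Level using (0ℓ)
open import Relation.Nullary using (¬_; Dec; yes; no; ¬?; map′; _×-dec_; _→-dec_)
open import Relation.Unary using (Pred; Decidable)

fromℕ : ℕ → ℚ
fromℕ n = + n / 1

-- A binary protocol of length T as its tree: the node reached records the
-- bits exchanged so far, and the user who owns it sends a bit determined by
-- that node and her own input only.  (The bits she sent herself are
-- functions of her input and of the bits she received, so this is the same
-- as depending on the input and the received bits.)  Who speaks next may
-- depend on the transcript; fixed and alternating orders are special cases.

data Protocol (XA XB : Set) : ℕ → Set where
  end   : Protocol XA XB 0
  alice : ∀ {T} → (XA → Bool) → (Bool → Protocol XA XB T) → Protocol XA XB (suc T)
  bob   : ∀ {T} → (XB → Bool) → (Bool → Protocol XA XB T) → Protocol XA XB (suc T)

transcript : ∀ {XA XB T} → Protocol XA XB T → XA → XB → Vec Bool T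
transcript end         xA xB = []
transcript (alice b π) xA xB = b xA ∷ transcript (π (b xA)) xA xB
transcript (bob   b π) xA xB = b xB ∷ transcript (π (b xB)) xA xB

-- The complete d-ary tree of depth N, with an element of Fin s on each arc.

data TreeCode (d s : ℕ) : ℕ → Set where
  leaf : TreeCode d s 0
  node : ∀ {N} → Vec (Fin s × TreeCode d s N) d → TreeCode d s (suc N)

-- A node of depth k, given by the branches taken from the root.

Node : ℕ → ℕ → Set
Node d k = Vec (Fin d) k

W : ∀ {d s k N} → k ℕ.≤ N → TreeCode d s N → Node d k → Vec (Fin s) k
W z≤n       C         []      = []
W (s≤s k≤N) (node cs) (a ∷ u) =
  let (label , C) = Vec.lookup cs a in label ∷ W k≤N C u

Δ : ∀ {s k} → Vec (Fin s) k → Vec (Fin s) k → ℕ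
Δ x y = Vec.count (λ (a , b) → ¬? (a Fin.≟ b)) (Vec.zip x y)

lcaDepth : ∀ {d k} → Node d k → Node d k → ℕ
lcaDepth []      []      = 0
lcaDepth (a ∷ u) (b ∷ v) with a Fin.≟ b
... | yes _ = suc (lcaDepth u v)
... | no  _ = 0

Bad : ∀ {d s h N} → ℚ → TreeCode d s N → h ℕ.≤ N → Node d h → Node d h → Set
Bad {h = h} α C h≤N u v =
  fromℕ (Δ (W h≤N C u) (W h≤N C v)) ℚ.< α ℚ.* fromℕ (h ℕ.∸ lcaDepth u v)

-- Arc i of a root-to-leaf path Q joins its nodes of depths i and i + 1.  It
-- lies on an α-bad subpath of Q if some node u of Q, of depth h > i, is α-bad
-- with a node v such that the least common ancestor of u and v has depth ≤ i.

OnBadPath : ∀ {d s N} → ℚ → TreeCode d s N → Node d N → Fin N → Set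
OnBadPath {d} {N = N} α C Q i =
  Σ[ h ∈ Fin (suc N) ] Σ[ v ∈ Node d (toℕ h) ]
    let h≤N = Fin.toℕ≤pred[n] h
        u   = Vec.truncate h≤N Q
    in lcaDepth u v ℕ.≤ toℕ i × toℕ i ℕ.< toℕ h × Bad α C h≤N u v

anyNode? : ∀ {d} k {P : Pred (Node d k) 0ℓ} → Decidable P → Dec (∃ P)
anyNode? zero    P? = map′ ([] ,_) (λ { ([] , p) → p }) (P? [])
anyNode? (suc k) P? =
  map′ (λ (a , u , p) → a ∷ u , p) (λ { (a ∷ u , p) → a , u , p })
       (Fin.any? λ a → anyNode? k (P? ∘ (a ∷_)))

allNodes? : ∀ {d} k {P : Pred (Node d k) 0ℓ} → Decidable P → Dec (∀ u → P u)
allNodes? zero    P? = map′ (λ { p [] → p }) (λ p → p []) (P? [])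
allNodes? (suc k) P? =
  map′ (λ { p (a ∷ u) → p a u }) (λ p a u → p (a ∷ u))
       (Fin.all? λ a → allNodes? k (P? ∘ (a ∷_)))

onBadPath? : ∀ {d s N} (α : ℚ) (C : TreeCode d s N) (Q : Node d N) →
             Decidable (OnBadPath α C Q)
onBadPath? α C Q i = Fin.any? λ h → anyNode? (toℕ h) λ v →
  (_ ℕ.≤? _) ×-dec (_ ℕ.<? _) ×-dec (_ ℚ.<? _)

badLength : ∀ {d s N} → ℚ → TreeCode d s N → Node d N → ℕ
badLength {N = N} α C Q = Vec.count (onBadPath? α C Q) (Vec.allFin N)

Potent : ∀ {d s N} → ℚ → ℚ → TreeCode d s N → Set
Potent {d} {N = N} ε α C =
  (Q : Node d N) → fromℕ (badLength α C Q) ℚ.< ε ℚ.* fromℕ N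

potent? : ∀ {d s N} (ε α : ℚ) → Decidable (Potent {d} {s} {N} ε α)
potent? {N = N} ε α C = allNodes? N λ Q → _ ℚ.<? _

allVecs : ∀ {A : Set} → List A → ∀ n → List (Vec A n)
allVecs xs zero    = [] ∷ []
allVecs xs (suc n) = List.cartesianProductWith _∷_ xs (allVecs xs n)

allCodes : ∀ d s N → List (TreeCode d s N)
allCodes d s zero    = leaf ∷ []
allCodes d s (suc N) = List.map node
  (allVecs (List.cartesianProduct (List.allFin s) (allCodes d s N)) d)

private
  NonEmpty : ∀ {A : Set} → List A → Set
  NonEmpty xs = NonZero (List.length xs)

  cpw-nonEmpty : ∀ {A B C : Set} (f : A → B → C) xs ys →
                 NonEmpty xs → NonEmpty ys →
                 NonEmpty (List.cartesianProductWith f xs ys)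
  cpw-nonEmpty f (x ∷ xs) (y ∷ ys) _ _ = _

  allVecs-nonEmpty : ∀ {A : Set} (xs : List A) n → NonEmpty xs → NonEmpty (allVecs xs n)
  allVecs-nonEmpty xs zero    _ = _
  allVecs-nonEmpty xs (suc n) p = cpw-nonEmpty _∷_ xs _ p (allVecs-nonEmpty xs n p)

allCodes-nonEmpty : ∀ d s N → NonZero s → NonZero (List.length (allCodes d s N))
allCodes-nonEmpty d s       zero    _ = _
allCodes-nonEmpty d (suc s) (suc N) _ =
  subst NonZero (sym (length-map node vs))
    (allVecs-nonEmpty _ d (cpw-nonEmpty _,_ (List.allFin (suc s)) (allCodes d (suc s) N)
      _ (allCodes-nonEmpty d (suc s) N _)))
  where
  vs = allVecs (List.cartesianProduct (List.allFin (suc s)) (allCodes d (suc s) N)) d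

-- Probability under the uniform distribution on tree codes, that is, with
-- independent uniform arc labels.

Pr : ∀ {d s N} {{_ : NonZero s}} {P : Pred (TreeCode d s N) 0ℓ} → Decidable P → ℚ
Pr {d} {s} {N} {{s≢0}} P? =
  _/_ (+ List.length (List.filter P? (allCodes d s N)))
      (List.length (allCodes d s N)) {{allCodes-nonEmpty d s N s≢0}}

-- What a user has decoded by the time k symbols have arrived: for each
-- j ≤ k, the node decoded from the first j of them.

View : ℕ → ℕ → Set
View d k = (j : Fin (suc k)) → Node d (toℕ j)

-- In each of N rounds both users send one symbol: each takes one more step
-- down the shared tree code, in a direction determined by the user's own input
-- and the nodes decoded so far, and transmits the label of the arc traversed.
-- Received strings are decoded to a node at minimum Hamming distance.  After
-- the last round each user outputs a transcript.

record TreeCodeProtocol (XA XB : Set) (d s N T : ℕ) : Set where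
  field
    decode  : ∀ {k} → k ℕ.≤ N → TreeCode d s N → Vec (Fin s) k → Node d k
    nearest : ∀ {k} (k≤N : k ℕ.≤ N) C (r : Vec (Fin s) k) (v : Node d k) →
              Δ (W k≤N C (decode k≤N C r)) r ℕ.≤ Δ (W k≤N C v) r
    stepA   : XA → ∀ k → View d k → Fin d
    stepB   : XB → ∀ k → View d k → Fin d
    outA    : XA → View d N → Vec Bool T
    outB    : XB → View d N → Vec Bool T

  view : ∀ {k} → k ℕ.≤ N → TreeCode d s N → Vec (Fin s) N → View d k
  view k≤N C r j = decode j≤N C (Vec.truncate j≤N r)
    where j≤N = ℕ.≤-trans (Fin.toℕ≤pred[n] j) k≤N

  -- The leaf reached by a user to whom the channel delivers the string r.
  -- Step i depends only on the first i symbols of r.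

  walk : ∀ {X : Set} → (X → ∀ k → View d k → Fin d) →
         TreeCode d s N → X → Vec (Fin s) N → Node d N
  walk step C x r = Vec.tabulate λ i → step x (toℕ i) (view (Fin.toℕ≤n i) C r)

  sentA : TreeCode d s N → XA → Vec (Fin s) N → Vec (Fin s) N
  sentA C xA rA = W ℕ.≤-refl C (walk stepA C xA rA)

  sentB : TreeCode d s N → XB → Vec (Fin s) N → Vec (Fin s) N
  sentB C xB rB = W ℕ.≤-refl C (walk stepB C xB rB)

-- The strings delivered to Alice and to Bob.  For fixed inputs and tree code
-- the users are deterministic, so the strategies of an adaptive adversary
-- who knows everything amount to arbitrary choices of these strings.

Delivered : ℕ → ℕ → Set
Delivered s N = Vec (Fin s) N × Vec (Fin s) N

module _ {XA XB : Set} {d s N T : ℕ} (Π : TreeCodeProtocol XA XB d s N T) where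
  open TreeCodeProtocol Π

  corruptions : TreeCode d s N → XA → XB → Delivered s N → ℕ
  corruptions C xA xB (rA , rB) = Δ (sentA C xA rA) rB ℕ.+ Δ (sentB C xB rB) rA

  -- If at most a ¼ - ε fraction of the 2N transmitted symbols is corrupted,
  -- both users output the transcript of π.

  Simulates : Protocol XA XB T → ℚ → TreeCode d s N → XA → XB → Delivered s N → Set
  Simulates π ε C xA xB r@(rA , rB) =
    fromℕ (corruptions C xA xB r) ℚ.≤ (+ 1 / 4 ℚ.- ε) ℚ.* fromℕ (2 ℕ.* N) →
    outA xA (view ℕ.≤-refl C rA) ≡ transcript π xA xB ×
    outB xB (view ℕ.≤-refl C rB) ≡ transcript π xA xB

  simulates? : ∀ π ε C xA xB r → Dec (Simulates π ε C xA xB r)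
  simulates? π ε C xA xB r =
    (_ ℚ.≤? _) →-dec (Vec.≡-dec Bool._≟_ _ _ ×-dec Vec.≡-dec Bool._≟_ _ _)

  -- The tree code drawn fails to be potent, or the run with it is incorrect.
  -- The adversary sees the tree code before choosing the delivered strings.

  Failure : Protocol XA XB T → (ε ε′ α : ℚ) → XA → XB →
            (TreeCode d s N → Delivered s N) → TreeCode d s N → Set
  Failure π ε ε′ α xA xB adv C =
    ¬ (Potent ε′ α C × Simulates π ε C xA xB (adv C))

  failure? : ∀ π ε ε′ α xA xB adv → Decidable (Failure π ε ε′ α xA xB adv)
  failure? π ε ε′ α xA xB adv C =
    ¬? (potent? ε′ α C ×-dec simulates? π ε C xA xB (adv C))

-- A polynomial by its coefficients, constant term first.

eval : List ℚ → ℚ → ℚ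
eval P x = List.foldr (λ c y → c ℚ.+ x ℚ.* y) 0ℚ P

-- f n < 1 / P n, multiplied out; only n with P n > 0 matter.

Negligible : (ℕ → ℚ) → Set
Negligible f = (P : List ℚ) → ∃[ n₀ ] ∀ n → n₀ ℕ.≤ n →
  0ℚ ℚ.< eval P (fromℕ n) → f n ℚ.* eval P (fromℕ n) ℚ.< 1ℚ

{-# OPTIONS --safe #-}

-- The simulation follows Braverman and Rao.  Each player announces nodes of the
-- protocol tree π, together with her own bit there, always going on along the
-- longest path that she can infer from her input and the announcements decoded
-- so far.  Announcements are never withdrawn, so a decoding error costs nothing
-- beyond its own duration.
--
-- To announce an arbitrary node with a constant alphabet, the nodes that may be
-- announced next carry weights.  The total weight is cut into D slots of equal
-- size; a node that straddles a slot boundary is announced by naming the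
-- boundary, and otherwise the weights of all nodes inside the slot of the wanted
-- node are doubled.  A round thus doubles the weight of the wanted node or
-- announces it, at the price of a factor 1 + 4/D for all others.  So there are
-- at most O(T log D) + O(N/D) rounds in which a player aims at the next node of
-- the true transcript.
--
-- If the last round that both players decode correctly precedes the last step of
-- progress, then the rounds since then form a window of length ℓ in which
-- either αℓ/2 symbols are corrupted or a path of the code is bad throughout.
-- In every other round one of the players aims at the next node of the true
-- transcript.  Hence a failure needs about N/2 of the 2N symbols corrupted.
--
-- A random code fails to be potent with exponentially small probability: a
-- failure yields two families of disjoint bad intervals on one path, of which
-- one witnesses many agreements of labels on distinct arcs, and the expectation
-- of s to the number of such agreements is at most exponential in N.

module Submission where

open import Data.Bool.Base using (Bool; true; false; if_then_else_)
import Data.Bool.Properties as Bool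
open import Data.Empty using (⊥-elim)
open import Data.Fin.Base as Fin
  using (Fin; zero; suc; toℕ; fromℕ<; inject₁; combine; remQuot)
import Data.Fin.Properties as Fin
open import Data.Integer.Base as ℤ using (+≤+; +<+)
import Data.Integer.Properties as ℤ
open import Data.List.Base as List
  using (List; []; _∷_; length; map; allFin; cartesianProduct; cartesianProductWith; _++_)
import Data.List.Properties as List
open import Data.Maybe.Base using (Maybe; just; nothing)
open import Data.Nat.Base as ℕ
open import Data.Nat.DivMod using (m<n*o⇒m/o<n; m/n*n≤m; m≡m%n+[m/n]*n; m%n<n)
open import Data.Nat.Induction using (<-rec)
open import Data.Nat.Properties
open import Data.Nat.Tactic.RingSolver using (solve-∀)
open import Data.Product.Base using (Σ; _×_; _,_; proj₁; proj₂; ∃-syntax; Σ-syntax)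
open import Data.Rational.Base as ℚ using (ℚ; 0ℚ; 1ℚ; mkℚ; toℚᵘ; ↧ₙ_)
import Data.Rational.Properties as ℚ
open import Data.Rational.Unnormalised.Base as ℚᵘ using (mkℚᵘ)
import Data.Rational.Unnormalised.Properties as ℚᵘ
open import Data.Sum.Base using (_⊎_; inj₁; inj₂; [_,_]′)
open import Data.Unit.Base using (⊤; tt)
open import Data.Vec.Base as Vec using (Vec; []; _∷_; toList; lookup; truncate; tabulate)
import Data.Vec.Properties as Vec
open import Function.Base using (_∘_; id)
open import Relation.Binary.PropositionalEquality
open import Relation.Nullary using (¬_; Dec; yes; no; contradiction; does; ¬?; _×-dec_)
open import Relation.Nullary.Decidable as Dec using (decidable-stable)
open import Relation.Unary using (Decidable)
open import Defs

-- Weighted trees of announcements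

-- The announcements of one player. `pending w` is a node that may be announced next and has weight
-- `w`; `announced z l r` keeps the announced bit and the trees below the `false` and the `true`
-- child.
data Tree : Set where
  pending   : ℕ → Tree
  announced : Bool → Tree → Tree → Tree

child : Bool → Tree → Tree
child b     (pending w)       = pending w
child false (announced z l r) = l
child true  (announced z l r) = r

total : Tree → ℕ
total (pending w)       = w
total (announced z l r) = total l + total r

-- The number of announced nodes on the path p, including the root; a transcript
-- of length T is completely announced at depth 1 + T, and then has weight W.

depth : Tree → List Bool → ℕ
depth (pending w)       p           = 0
depth (announced z l r) []          = 1
depth (announced z l r) (false ∷ p) = suc (depth l p)
depth (announced z l r) (true  ∷ p) = suc (depth r p)

-- The pending nodes are laid out from left to right as consecutive intervals whose lengths are
-- their weights. As long as `p` is not completely announced, this is where the interval of its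
-- pending node begins.
offset : Tree → List Bool → ℕ
offset (pending w)       p           = 0
offset (announced z l r) []          = 0
offset (announced z l r) (false ∷ p) = offset l p
offset (announced z l r) (true  ∷ p) = total l + offset r p

weight : ℕ → Tree → List Bool → ℕ
weight W (pending w)       p           = w
weight W (announced z l r) []          = W
weight W (announced z l r) (false ∷ p) = weight W l p
weight W (announced z l r) (true  ∷ p) = weight W r p

commonPrefix : List Bool → List Bool → ℕ
commonPrefix []      p       = 0
commonPrefix (a ∷ q) []      = 0
commonPrefix (a ∷ q) (b ∷ p) = if does (a Bool.≟ b) then suc (commonPrefix q p) else 0

-- `c` is the position in the layout at which the subtree begins, `lo` and `hi` are the ends of the
-- slot.
double : (lo hi c : ℕ) → Tree → Tree
double lo hi c (pending w) with lo ≤? c | c + w ≤? hi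
... | yes _ | yes _ = pending (w + w)
... | yes _ | no  _ = pending w
... | no  _ | _     = pending w
double lo hi c (announced z l r) =
  announced z (double lo hi c l) (double lo hi (c + total l) r)

-- The node is named by a position `x` in the layout, and its children start with weight `u`. A
-- position beyond the last interval selects the rightmost pending node.
announce : (u x : ℕ) → Bool → Tree → Tree
announce u x z (pending w) = announced z (pending u) (pending u)
announce u x z (announced y l r) with x <? total l
... | yes _ = announced y (announce u x z l) r
... | no  _ = announced y l (announce u (x ∸ total l) z r)

-- The rest of `q` from its pending node on; its head is the bit to be announced there. `just []`
-- differs from `nothing`: the node at the end of `q` is then still pending.
residue : Tree → List Bool → Maybe (List Bool)
residue (pending w)       q           = just q
residue (announced z l r) []          = nothing
residue (announced z l r) (false ∷ q) = residue l q
residue (announced z l r) (true  ∷ q) = residue r q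

-- The effect of one action on total weight, depth and goal

window-mono : ∀ lo u {c c′} → c ≤ c′ → (c ∸ lo) ⊓ u ≤ (c′ ∸ lo) ⊓ u
window-mono lo u c≤c′ = ⊓-monoˡ-≤ u (∸-monoˡ-≤ lo c≤c′)

-- `f x` is the length of the part of the slot to the left of `x`. A doubled node gains exactly the
-- length that it occupies in the slot, so the bound telescopes along the layout, and the whole gain
-- is at most `u`.
total-double : ∀ lo u c t → let f = λ x → (x ∸ lo) ⊓ u in
               total (double lo (lo + u) c t) + f c ≤ total t + f (c + total t)
total-double lo u c (pending w) with lo ≤? c | c + w ≤? lo + u
... | yes lo≤c | yes c+w≤hi = begin
  w + w + (c ∸ lo) ⊓ u        ≡⟨ +-assoc w w _ ⟩
  w + (w + (c ∸ lo) ⊓ u)      ≤⟨ +-monoʳ-≤ w (⊓-glb le₁ le₂) ⟩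
  w + (c + w ∸ lo) ⊓ u        ∎
  where
  open ≤-Reasoning
  eq : c + w ∸ lo ≡ w + (c ∸ lo)
  eq = trans (cong (_∸ lo) (+-comm c w)) (+-∸-assoc w lo≤c)
  le₁ : w + (c ∸ lo) ⊓ u ≤ c + w ∸ lo
  le₁ = ≤-trans (+-monoʳ-≤ w (m⊓n≤m _ u)) (≤-reflexive (sym eq))
  le₂ : w + (c ∸ lo) ⊓ u ≤ u
  le₂ = ≤-trans (+-monoʳ-≤ w (m⊓n≤m _ u)) (≤-trans (≤-reflexive (sym eq))
          (m≤n+o⇒m∸n≤o (c + w) lo c+w≤hi))
... | yes _ | no  _ = +-monoʳ-≤ w (window-mono lo u (m≤m+n c w))
... | no  _ | _     = +-monoʳ-≤ w (window-mono lo u (m≤m+n c w))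
total-double lo u c (announced z l r) = +-cancelʳ-≤ (f (c + total l)) _ _ (begin
  total l′ + total r′ + f c + f (c + total l)       ≡⟨ shuffle (total l′) (total r′) (f c) _ ⟩
  (total l′ + f c) + (total r′ + f (c + total l))
    ≤⟨ +-mono-≤ (total-double lo u c l) (total-double lo u (c + total l) r) ⟩
  (total l + f (c + total l)) + (total r + f (c + total l + total r))
    ≡⟨ shuffle′ (total l) (f (c + total l)) (total r) _ ⟩
  total l + total r + f (c + total l + total r) + f (c + total l)
    ≡⟨ cong (λ x → total l + total r + f x + f (c + total l)) (+-assoc c (total l) (total r)) ⟩
  total l + total r + f (c + (total l + total r)) + f (c + total l) ∎)
  where
  open ≤-Reasoning
  f = λ x → (x ∸ lo) ⊓ u
  l′ = double lo (lo + u) c l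
  r′ = double lo (lo + u) (c + total l) r
  shuffle : ∀ a b x y → a + b + x + y ≡ (a + x) + (b + y)
  shuffle = solve-∀
  shuffle′ : ∀ a y b x → (a + y) + (b + x) ≡ a + b + x + y
  shuffle′ = solve-∀

total-announce : ∀ u x z t → total (announce u x z t) ≤ total t + (u + u)
total-announce u x z (pending w) = m≤n+m (u + u) w
total-announce u x z (announced y l r) with x <? total l
... | yes _ = ≤-trans (+-monoˡ-≤ (total r) (total-announce u x z l))
                (≤-reflexive (shuffle (total l) (u + u) (total r)))
  where
  shuffle : ∀ a b c → a + b + c ≡ a + c + b
  shuffle = solve-∀
... | no  _ = ≤-trans (+-monoʳ-≤ (total l) (total-announce u (x ∸ total l) z r))
                (≤-reflexive (sym (+-assoc (total l) (total r) (u + u))))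

weight-incomplete : ∀ {W W′} t p → depth t p ≤ length p → weight W t p ≡ weight W′ t p
weight-incomplete (pending w)       p           _       = refl
weight-incomplete (announced z l r) (false ∷ p) (s≤s h) = weight-incomplete l p h
weight-incomplete (announced z l r) (true  ∷ p) (s≤s h) = weight-incomplete r p h

weight-complete : ∀ {W} t p → length p < depth t p → weight W t p ≡ W
weight-complete (announced z l r) []          _       = refl
weight-complete (announced z l r) (false ∷ p) (s≤s h) = weight-complete l p h
weight-complete (announced z l r) (true  ∷ p) (s≤s h) = weight-complete r p h

depth≤1+length : ∀ t p → depth t p ≤ suc (length p)
depth≤1+length (pending w)       p           = z≤n
depth≤1+length (announced z l r) []          = ≤-refl
depth≤1+length (announced z l r) (false ∷ p) = s≤s (depth≤1+length l p)
depth≤1+length (announced z l r) (true  ∷ p) = s≤s (depth≤1+length r p)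

weight≤total : ∀ W t p → depth t p ≤ length p → offset t p + weight W t p ≤ total t
weight≤total W (pending w)       p           _       = ≤-refl
weight≤total W (announced z l r) (false ∷ p) (s≤s h) =
  ≤-trans (weight≤total W l p h) (m≤m+n (total l) (total r))
weight≤total W (announced z l r) (true  ∷ p) (s≤s h) =
  ≤-trans (≤-reflexive (+-assoc (total l) (offset r p) _)) (+-monoʳ-≤ (total l) (weight≤total W r p h))

offset≤total : ∀ t p → offset t p ≤ total t
offset≤total (pending w)       p           = z≤n
offset≤total (announced z l r) []          = z≤n
offset≤total (announced z l r) (false ∷ p) = ≤-trans (offset≤total l p) (m≤m+n (total l) (total r))
offset≤total (announced z l r) (true  ∷ p) = +-monoʳ-≤ (total l) (offset≤total r p)

depth-double : ∀ lo hi c t p → depth (double lo hi c t) p ≡ depth t p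
depth-double lo hi c (pending w) p with lo ≤? c | c + w ≤? hi
... | yes _ | yes _ = refl
... | yes _ | no  _ = refl
... | no  _ | _     = refl
depth-double lo hi c (announced z l r) []          = refl
depth-double lo hi c (announced z l r) (false ∷ p) = cong suc (depth-double lo hi c l p)
depth-double lo hi c (announced z l r) (true  ∷ p) = cong suc (depth-double lo hi _ r p)

weight-double : ∀ W lo hi c t p → weight W t p ≤ weight W (double lo hi c t) p
weight-double W lo hi c (pending w) p with lo ≤? c | c + w ≤? hi
... | yes _ | yes _ = m≤m+n w w
... | yes _ | no  _ = ≤-refl
... | no  _ | _     = ≤-refl
weight-double W lo hi c (announced z l r) []          = ≤-refl
weight-double W lo hi c (announced z l r) (false ∷ p) = weight-double W lo hi c l p
weight-double W lo hi c (announced z l r) (true  ∷ p) = weight-double W lo hi _ r p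

weight-double-hit : ∀ W lo hi c t p → depth t p ≤ length p →
                    lo ≤ c + offset t p → c + offset t p + weight W t p ≤ hi →
                    weight W (double lo hi c t) p ≡ weight W t p + weight W t p
weight-double-hit W lo hi c (pending w) p _ lo≤ ≤hi
  rewrite +-identityʳ c with lo ≤? c | c + w ≤? hi
... | yes _    | yes _  = refl
... | yes _    | no ≰hi = contradiction ≤hi ≰hi
... | no lo≰   | _      = contradiction lo≤ lo≰
weight-double-hit W lo hi c (announced z l r) (false ∷ p) (s≤s h) lo≤ ≤hi =
  weight-double-hit W lo hi c l p h lo≤ ≤hi
weight-double-hit W lo hi c (announced z l r) (true ∷ p) (s≤s h) lo≤ ≤hi =
  weight-double-hit W lo hi (c + total l) r p h
    (subst (lo ≤_) (sym assoc) lo≤)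
    (subst (λ x → x + weight W r p ≤ hi) (sym assoc) ≤hi)
  where assoc = +-assoc c (total l) (offset r p)

-- The minimum covers both ways of growing: the path may now be complete, with weight `W`, or its
-- next node is a new child, with weight `u`.
announce-cases : ∀ W u x z t p → let t′ = announce u x z t in
  depth t′ p ≡ depth t p × weight W t′ p ≡ weight W t p ⊎
  depth t′ p ≡ suc (depth t p) × u ⊓ W ≤ weight W t′ p
announce-cases W u x z (pending w) []          = inj₂ (refl , m⊓n≤n u W)
announce-cases W u x z (pending w) (false ∷ p) = inj₂ (refl , m⊓n≤m u W)
announce-cases W u x z (pending w) (true  ∷ p) = inj₂ (refl , m⊓n≤m u W)
announce-cases W u x z (announced y l r) p with x <? total l
announce-cases W u x z (announced y l r) []          | yes _ = inj₁ (refl , refl)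
announce-cases W u x z (announced y l r) (false ∷ p) | yes _ with announce-cases W u x z l p
... | inj₁ (d , w) = inj₁ (cong suc d , w)
... | inj₂ (d , w) = inj₂ (cong suc d , w)
announce-cases W u x z (announced y l r) (true  ∷ p) | yes _ = inj₁ (refl , refl)
announce-cases W u x z (announced y l r) []          | no  _ = inj₁ (refl , refl)
announce-cases W u x z (announced y l r) (false ∷ p) | no  _ = inj₁ (refl , refl)
announce-cases W u x z (announced y l r) (true  ∷ p) | no  _ with announce-cases W u (x ∸ total l) z r p
... | inj₁ (d , w) = inj₁ (cong suc d , w)
... | inj₂ (d , w) = inj₂ (cong suc d , w)

-- The counterpart of `announce` that names the node by a path, which suits induction along the
-- protocol.
plant : ℕ → Bool → Tree → List Bool → Tree
plant u z (pending w)       q           = announced z (pending u) (pending u)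
plant u z (announced y l r) []          = announced y l r
plant u z (announced y l r) (b ∷ q)     =
  announced y (if b then l else plant u z l q) (if b then plant u z r q else r)

-- The intervals are disjoint and in order, so a position inside the interval of the pending node on
-- `q` leads through the same branches as `q`.
announce≡plant : ∀ {W} u x z t q → depth t q ≤ length q →
                 offset t q ≤ x → x < offset t q + weight W t q →
                 announce u x z t ≡ plant u z t q
announce≡plant u x z (pending w) q _ _ _ = refl
announce≡plant {W} u x z (announced y l r) (false ∷ q) (s≤s h) o≤x x<o with x <? total l
... | yes _ = cong (λ l′ → announced y l′ r) (announce≡plant u x z l q h o≤x x<o)
... | no x≮ = contradiction (<-≤-trans x<o (weight≤total W l q h)) x≮
announce≡plant {W} u x z (announced y l r) (true ∷ q) (s≤s h) o≤x x<o with x <? total l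
... | yes x< = contradiction (m+n≤o⇒m≤o (total l) o≤x) (<⇒≱ x<)
... | no  x≮ = cong (announced y l) (announce≡plant u (x ∸ total l) z r q h
  (m+n≤o⇒m≤o∸n (offset r q) (subst (_≤ x) (+-comm (total l) _) o≤x))
  (+-cancelˡ-< (total l) _ _ (subst₂ _<_ (sym (m+[n∸m]≡n (≮⇒≥ x≮))) (+-assoc (total l) _ _) x<o)))

depth-plant : ∀ u z t q → depth t q ≤ length q → depth (plant u z t q) q ≡ suc (depth t q)
depth-plant u z (pending w) []          _ = refl
depth-plant u z (pending w) (false ∷ q) _ = refl
depth-plant u z (pending w) (true  ∷ q) _ = refl
depth-plant u z (announced y l r) (false ∷ q) (s≤s h) = cong suc (depth-plant u z l q h)
depth-plant u z (announced y l r) (true  ∷ q) (s≤s h) = cong suc (depth-plant u z r q h)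

residue-just : ∀ t q → depth t q ≤ length q → ∃[ q′ ] residue t q ≡ just q′
residue-just (pending w)       q           _       = q , refl
residue-just (announced z l r) (false ∷ q) (s≤s h) = residue-just l q h
residue-just (announced z l r) (true  ∷ q) (s≤s h) = residue-just r q h

residue⇒depth : ∀ t q {q′} → residue t q ≡ just q′ → depth t q ≤ length q
residue⇒depth (pending w)       q           _ = z≤n
residue⇒depth (announced z l r) (false ∷ q) e = s≤s (residue⇒depth l q e)
residue⇒depth (announced z l r) (true  ∷ q) e = s≤s (residue⇒depth r q e)

record Located (W : ℕ) (t : Tree) (q p : List Bool) : Set where
  field
    depth≡  : depth t q ≡ depth t p
    offset≡ : offset t q ≡ offset t p
    weight≡ : weight W t q ≡ weight W t p
    depth≤  : depth t q ≤ length q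

-- Only the bits above the pending node matter. So a player who knows the transcript just as far as
-- her own announcements reach already aims at the right node.
locate : ∀ {W} t q p → depth t p ≤ length p → depth t p ≤ commonPrefix q p → Located W t q p
locate (pending w)       q       p       _       _ = record
  { depth≡ = refl ; offset≡ = refl ; weight≡ = refl ; depth≤ = z≤n }
locate (announced z l r) []          (false ∷ p) _ ()
locate (announced z l r) []          (true  ∷ p) _ ()
locate (announced z l r) (false ∷ q) (true  ∷ p) _ ()
locate (announced z l r) (true  ∷ q) (false ∷ p) _ ()
locate {W} (announced z l r) (false ∷ q) (false ∷ p) (s≤s h) (s≤s h′) = record
  { depth≡ = cong suc L.depth≡ ; offset≡ = L.offset≡ ; weight≡ = L.weight≡ ; depth≤ = s≤s L.depth≤ }
  where module L = Located (locate {W} l q p h h′)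
locate {W} (announced z l r) (true  ∷ q) (true  ∷ p) (s≤s h) (s≤s h′) = record
  { depth≡ = cong suc L.depth≡ ; offset≡ = cong (total l +_) L.offset≡ ; weight≡ = L.weight≡
  ; depth≤ = s≤s L.depth≤ }
  where module L = Located (locate {W} r q p h h′)

-- Sums over tree codes

indicator : ∀ {P : Set} → Dec P → ℕ
indicator p? = if does p? then 1 else 0

private variable
  A B B′ : Set

∑ : List A → (A → ℕ) → ℕ
∑ []       f = 0
∑ (x ∷ xs) f = f x + ∑ xs f

∑-++ : ∀ (xs ys : List A) f → ∑ (xs ++ ys) f ≡ ∑ xs f + ∑ ys f
∑-++ []       ys f = refl
∑-++ (x ∷ xs) ys f = trans (cong (f x +_) (∑-++ xs ys f)) (sym (+-assoc (f x) _ _))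

∑-map : ∀ (g : A → B) xs f → ∑ (map g xs) f ≡ ∑ xs (f ∘ g)
∑-map g []       f = refl
∑-map g (x ∷ xs) f = cong (f (g x) +_) (∑-map g xs f)

∑-mono : ∀ (xs : List A) {f g} → (∀ x → f x ≤ g x) → ∑ xs f ≤ ∑ xs g
∑-mono []       f≤g = z≤n
∑-mono (x ∷ xs) f≤g = +-mono-≤ (f≤g x) (∑-mono xs f≤g)

∑-cong : ∀ (xs : List A) {f g} → (∀ x → f x ≡ g x) → ∑ xs f ≡ ∑ xs g
∑-cong []       f≡g = refl
∑-cong (x ∷ xs) f≡g = cong₂ _+_ (f≡g x) (∑-cong xs f≡g)

∑-+ : ∀ (xs : List A) f g → ∑ xs (λ x → f x + g x) ≡ ∑ xs f + ∑ xs g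
∑-+ []       f g = refl
∑-+ (x ∷ xs) f g = trans (cong (f x + g x +_) (∑-+ xs f g)) (interchange (f x) (g x) _ _)
  where
  interchange : ∀ a b c d → a + b + (c + d) ≡ a + c + (b + d)
  interchange = solve-∀

∑-*ˡ : ∀ (xs : List A) k f → ∑ xs (λ x → k * f x) ≡ k * ∑ xs f
∑-*ˡ []       k f = sym (*-zeroʳ k)
∑-*ˡ (x ∷ xs) k f = trans (cong (k * f x +_) (∑-*ˡ xs k f)) (sym (*-distribˡ-+ k (f x) _))

∑-*ʳ : ∀ (xs : List A) k f → ∑ xs (λ x → f x * k) ≡ ∑ xs f * k
∑-*ʳ []       k f = refl
∑-*ʳ (x ∷ xs) k f = trans (cong (f x * k +_) (∑-*ʳ xs k f)) (sym (*-distribʳ-+ k (f x) _))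

∑-const : ∀ (xs : List A) k → ∑ xs (λ _ → k) ≡ length xs * k
∑-const []       k = refl
∑-const (x ∷ xs) k = cong (k +_) (∑-const xs k)

∑-swap : ∀ (xs : List A) (ys : List B) (f : A → B → ℕ) → ∑ xs (λ x → ∑ ys (f x)) ≡ ∑ ys (λ y → ∑ xs (λ x → f x y))
∑-swap []       ys f = sym (trans (∑-const ys 0) (*-zeroʳ (length ys)))
∑-swap (x ∷ xs) ys f = trans (cong (∑ ys (f x) +_) (∑-swap xs ys f)) (sym (∑-+ ys _ _))

∑-cartesianProductWith : ∀ (g : A → B → B′) xs ys f →
  ∑ (cartesianProductWith g xs ys) f ≡ ∑ xs (λ x → ∑ ys (λ y → f (g x y)))
∑-cartesianProductWith g []       ys f = refl
∑-cartesianProductWith g (x ∷ xs) ys f = trans (∑-++ (map (g x) ys) _ f)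
  (cong₂ _+_ (∑-map (g x) ys f) (∑-cartesianProductWith g xs ys f))

∑-allFin-suc : ∀ n f → ∑ (allFin (suc n)) f ≡ f zero + ∑ (allFin n) (f ∘ suc)
∑-allFin-suc n f = cong (f zero +_) (trans (cong (λ xs → ∑ xs f) (sym (List.map-tabulate id suc)))
  (∑-map suc (allFin n) f))

≤∑-allFin : ∀ {n} (i : Fin n) f → f i ≤ ∑ (allFin n) f
≤∑-allFin {suc n} zero    f = m≤m+n (f zero) _
≤∑-allFin {suc n} (suc i) f = ≤-trans (≤∑-allFin i (f ∘ suc))
  (≤-trans (m≤n+m _ (f zero)) (≤-reflexive (sym (∑-allFin-suc n f))))

∑-indicator-≡ : ∀ {n} (i : Fin n) → ∑ (allFin n) (λ j → indicator (i Fin.≟ j)) ≡ 1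
∑-indicator-≡ {suc n} zero = trans (∑-allFin-suc n (λ j → indicator (zero {n} Fin.≟ j)))
  (cong suc (trans (∑-const (allFin n) 0) (*-zeroʳ (length (allFin n)))))
∑-indicator-≡ {suc n} (suc i) = trans (∑-allFin-suc n (λ j → indicator (suc i Fin.≟ j)))
  (trans (∑-cong (allFin n) same) (∑-indicator-≡ i))
  where
  same : ∀ j → indicator (suc i Fin.≟ suc j) ≡ indicator (i Fin.≟ j)
  same j with i Fin.≟ j
  ... | yes _ = refl
  ... | no  _ = refl

length-cartesianProductWith : ∀ (g : A → B → B′) xs ys →
  length (cartesianProductWith g xs ys) ≡ length xs * length ys
length-cartesianProductWith g []       ys = refl
length-cartesianProductWith g (x ∷ xs) ys = trans (List.length-++ (map (g x) ys))
  (cong₂ _+_ (List.length-map (g x) ys) (length-cartesianProductWith g xs ys))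

length-allVecs : ∀ (xs : List A) n → length (allVecs xs n) ≡ length xs ^ n
length-allVecs xs zero    = refl
length-allVecs xs (suc n) = trans (length-cartesianProductWith _∷_ xs (allVecs xs n))
  (cong (length xs *_) (length-allVecs xs n))

-- Each entry of a uniform vector is uniform, so a bound `K` on a mean over `xs` carries over. Here
-- and below, means are multiplied by the number of outcomes.
∑-lookup : ∀ K (xs : List A) {n} (i : Fin n) g → ∑ xs g ≤ K * length xs →
           ∑ (allVecs xs n) (λ v → g (lookup v i)) ≤ K * length xs ^ n
∑-lookup K xs {suc n} zero g h = begin
  ∑ (allVecs xs (suc n)) (λ v → g (lookup v zero))  ≡⟨ ∑-cartesianProductWith _∷_ xs _ _ ⟩
  ∑ xs (λ x → ∑ (allVecs xs n) (λ _ → g x))         ≡⟨ ∑-cong xs (λ x → ∑-const (allVecs xs n) (g x)) ⟩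
  ∑ xs (λ x → length (allVecs xs n) * g x)          ≡⟨ ∑-*ˡ xs (length (allVecs xs n)) g ⟩
  length (allVecs xs n) * ∑ xs g                    ≤⟨ *-monoʳ-≤ (length (allVecs xs n)) h ⟩
  length (allVecs xs n) * (K * length xs)           ≡⟨ cong (_* (K * length xs)) (length-allVecs xs n) ⟩
  length xs ^ n * (K * length xs)                   ≡⟨ rearrange (length xs ^ n) K (length xs) ⟩
  K * (length xs * length xs ^ n)                   ∎
  where
  open ≤-Reasoning
  rearrange : ∀ p K m → p * (K * m) ≡ K * (m * p)
  rearrange = solve-∀
∑-lookup K xs {suc n} (suc i) g h = begin
  ∑ (allVecs xs (suc n)) (λ v → g (lookup v (suc i)))      ≡⟨ ∑-cartesianProductWith _∷_ xs _ _ ⟩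
  ∑ xs (λ _ → ∑ (allVecs xs n) (λ v → g (lookup v i)))     ≡⟨ ∑-const xs _ ⟩
  length xs * ∑ (allVecs xs n) (λ v → g (lookup v i))      ≤⟨ *-monoʳ-≤ (length xs) (∑-lookup K xs i g h) ⟩
  length xs * (K * length xs ^ n)                          ≡⟨ rearrange (length xs) K (length xs ^ n) ⟩
  K * (length xs * length xs ^ n)                          ∎
  where
  open ≤-Reasoning
  rearrange : ∀ m K p → m * (K * p) ≡ K * (m * p)
  rearrange = solve-∀

-- Distinct entries of a uniform vector are independent.
∑-lookup-≢ : ∀ K (xs : List A) {n} (i j : Fin n) → i ≢ j → (g : A → A → ℕ) →
             ∑ xs (λ x → ∑ xs (g x)) ≤ K * (length xs * length xs) →
             ∑ (allVecs xs n) (λ v → g (lookup v i) (lookup v j)) ≤ K * length xs ^ n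
∑-lookup-≢ K xs zero zero i≢j g h = contradiction refl i≢j
∑-lookup-≢ K xs {suc n} zero (suc j) i≢j g h = begin
  ∑ (allVecs xs (suc n)) (λ v → g (lookup v zero) (lookup v (suc j))) ≡⟨ ∑-cartesianProductWith _∷_ xs _ _ ⟩
  ∑ xs (λ x → ∑ (allVecs xs n) (λ v → g x (lookup v j)))  ≡⟨ ∑-swap xs (allVecs xs n) _ ⟩
  ∑ (allVecs xs n) (λ v → ∑ xs (λ x → g x (lookup v j)))
    ≤⟨ ∑-lookup (K * length xs) xs j (λ y → ∑ xs (λ x → g x y)) (begin
         ∑ xs (λ y → ∑ xs (λ x → g x y))   ≡⟨ ∑-swap xs xs g ⟨
         ∑ xs (λ x → ∑ xs (g x))           ≤⟨ h ⟩
         K * (length xs * length xs)       ≡⟨ *-assoc K _ _ ⟨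
         K * length xs * length xs         ∎) ⟩
  K * length xs * length xs ^ n            ≡⟨ *-assoc K _ _ ⟩
  K * (length xs * length xs ^ n)          ∎
  where open ≤-Reasoning
∑-lookup-≢ K xs {suc n} (suc i) zero i≢j g h = begin
  ∑ (allVecs xs (suc n)) (λ v → g (lookup v (suc i)) (lookup v zero)) ≡⟨ ∑-cartesianProductWith _∷_ xs _ _ ⟩
  ∑ xs (λ x → ∑ (allVecs xs n) (λ v → g (lookup v i) x))  ≡⟨ ∑-swap xs (allVecs xs n) _ ⟩
  ∑ (allVecs xs n) (λ v → ∑ xs (g (lookup v i)))
    ≤⟨ ∑-lookup (K * length xs) xs i (λ y → ∑ xs (g y)) (≤-trans h (≤-reflexive (sym (*-assoc K _ _)))) ⟩
  K * length xs * length xs ^ n            ≡⟨ *-assoc K _ _ ⟩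
  K * (length xs * length xs ^ n)          ∎
  where open ≤-Reasoning
∑-lookup-≢ K xs {suc n} (suc i) (suc j) i≢j g h = begin
  ∑ (allVecs xs (suc n)) (λ v → g (lookup v (suc i)) (lookup v (suc j))) ≡⟨ ∑-cartesianProductWith _∷_ xs _ _ ⟩
  ∑ xs (λ _ → ∑ (allVecs xs n) (λ v → g (lookup v i) (lookup v j)))  ≡⟨ ∑-const xs _ ⟩
  length xs * ∑ (allVecs xs n) (λ v → g (lookup v i) (lookup v j))
    ≤⟨ *-monoʳ-≤ (length xs) (∑-lookup-≢ K xs i j (i≢j ∘ cong suc) g h) ⟩
  length xs * (K * length xs ^ n)                          ≡⟨ rearrange (length xs) K (length xs ^ n) ⟩
  K * (length xs * length xs ^ n)                          ∎
  where
  open ≤-Reasoning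
  rearrange : ∀ m K p → m * (K * p) ≡ K * (m * p)
  rearrange = solve-∀

∑-lookup-pair : ∀ K (xs : List A) {n} (i j : Fin n) (g : A → A → ℕ) →
                ∑ xs (λ x → ∑ xs (g x)) ≤ K * (length xs * length xs) →
                ∑ (allVecs xs n) (λ v → ∑ (allVecs xs n) (λ w → g (lookup v i) (lookup w j))) ≤
                K * (length xs ^ n * length xs ^ n)
∑-lookup-pair K xs {n} i j g h = begin
  ∑ V (λ v → ∑ V (λ w → g (lookup v i) (lookup w j)))
    ≤⟨ ∑-lookup (K * length xs ^ n) xs i (λ x → ∑ V (λ w → g x (lookup w j))) (begin
         ∑ xs (λ x → ∑ V (λ w → g x (lookup w j)))   ≡⟨ ∑-swap xs V _ ⟩
         ∑ V (λ w → ∑ xs (λ x → g x (lookup w j)))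
           ≤⟨ ∑-lookup (K * length xs) xs j (λ y → ∑ xs (λ x → g x y)) (begin
                ∑ xs (λ y → ∑ xs (λ x → g x y))   ≡⟨ ∑-swap xs xs g ⟨
                ∑ xs (λ x → ∑ xs (g x))           ≤⟨ h ⟩
                K * (length xs * length xs)       ≡⟨ *-assoc K _ _ ⟨
                K * length xs * length xs         ∎) ⟩
         K * length xs * length xs ^ n             ≡⟨ rearrange K (length xs) (length xs ^ n) ⟩
         K * length xs ^ n * length xs             ∎) ⟩
  K * length xs ^ n * length xs ^ n                ≡⟨ *-assoc K _ _ ⟩
  K * (length xs ^ n * length xs ^ n)              ∎
  where
  open ≤-Reasoning
  V = allVecs xs n
  rearrange : ∀ K m p → K * m * p ≡ K * p * m
  rearrange = solve-∀

∑∑-swap : ∀ (vs : List A) {n} (f : A → Fin n → Fin n → ℕ) k → (∀ a b → ∑ vs (λ v → f v a b) ≤ k) →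
          ∑ vs (λ v → ∑ (allFin n) (λ a → ∑ (allFin n) (f v a))) ≤ n * (n * k)
∑∑-swap vs {n} f k h = begin
  ∑ vs (λ v → ∑ (allFin n) (λ a → ∑ (allFin n) (f v a)))   ≡⟨ ∑-swap vs (allFin n) _ ⟩
  ∑ (allFin n) (λ a → ∑ vs (λ v → ∑ (allFin n) (f v a)))
    ≡⟨ ∑-cong (allFin n) (λ a → ∑-swap vs (allFin n) _) ⟩
  ∑ (allFin n) (λ a → ∑ (allFin n) (λ b → ∑ vs (λ v → f v a b)))
    ≤⟨ ∑-mono (allFin n) (λ a → ∑-mono (allFin n) (h a)) ⟩
  ∑ (allFin n) (λ a → ∑ (allFin n) (λ b → k))
    ≡⟨ trans (∑-const (allFin n) _) (cong₂ _*_ (List.length-tabulate {n = n} id) (trans (∑-const (allFin n) k)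
         (cong (_* k) (List.length-tabulate {n = n} id)))) ⟩
  n * (n * k) ∎
  where open ≤-Reasoning

-- The generating function of label agreements

module Generating (d s : ℕ) where

  mutual
    -- A sum over all paths with side paths that leave them for disjoint stretches. `fork` lets a
    -- side path begin; `parallel` gives each arc of a stretch the factor `1 + s` if the two labels
    -- agree and 1 otherwise, and then either drops the side path (`single`) or keeps it (`pair`).
    single : ∀ {N} → TreeCode d s N → ℕ
    single {zero}  leaf      = 1
    single {suc N} (node cs) = ∑ (allFin d) λ a → ∑ (allFin d) λ b →
      fork (a Fin.≟ b) (lookup cs a) (lookup cs b)

    pair : ∀ {N} → TreeCode d s N → TreeCode d s N → ℕ
    pair {zero}  leaf      leaf       = 1
    pair {suc N} (node cs) (node cs′) = ∑ (allFin d) λ a → ∑ (allFin d) λ b →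
      parallel (lookup cs a) (lookup cs′ b)

    parallel : ∀ {N} → Fin s × TreeCode d s N → Fin s × TreeCode d s N → ℕ
    parallel {N} (l , C) (l′ , C′) = (1 + s * indicator (l Fin.≟ l′)) * (single {N} C + pair {N} C C′)

    fork : ∀ {N} {P : Set} → Dec P → Fin s × TreeCode d s N → Fin s × TreeCode d s N → ℕ
    fork {N} (yes _) (l , C) y = single {N} C
    fork {N} (no  _) x       y = parallel {N} x y

  arcs : ∀ N → List (Fin s × TreeCode d s N)
  arcs N = cartesianProduct (allFin s) (allCodes d s N)

  -- The cost of one level: `d * d` choices of two branches, a factor 2 for the mean of
  -- `1 + s * indicator (l ≟ l′)`, and a factor 2 for dropping or keeping the side path.
  base : ℕ
  base = 4 * (d * d)

  length-arcs : ∀ N → length (arcs N) ≡ s * length (allCodes d s N)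
  length-arcs N = trans (length-cartesianProductWith _,_ (allFin s) (allCodes d s N))
    (cong (_* length (allCodes d s N)) (List.length-tabulate {n = s} id))

  length-allCodes-suc : ∀ N → length (allCodes d s (suc N)) ≡ length (arcs N) ^ d
  length-allCodes-suc N = trans (List.length-map node (allVecs (arcs N) d)) (length-allVecs (arcs N) d)

  module _ (N : ℕ) where
    private
      codes = allCodes d s N
      τ = length codes
      K = base ^ N

    ∑-parallel : ∑ codes single ≤ K * τ → ∑ codes (λ C → ∑ codes (pair C)) ≤ K * (τ * τ) →
                 ∑ (arcs N) (λ x → ∑ (arcs N) (parallel x)) ≤ 4 * K * (length (arcs N) * length (arcs N))
    ∑-parallel h₁ h₂ = begin
      ∑ (arcs N) (λ x → ∑ (arcs N) (parallel x))    ≤⟨ ∑-mono (arcs N) inner ⟩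
      ∑ (arcs N) (λ x → (s + s) * rest (proj₂ x))   ≡⟨ ∑-cartesianProductWith _,_ (allFin s) codes _ ⟩
      ∑ (allFin s) (λ _ → ∑ codes (λ C → (s + s) * rest C)) ≡⟨ ∑-const (allFin s) _ ⟩
      length (allFin s) * ∑ codes (λ C → (s + s) * rest C)
        ≡⟨ cong₂ _*_ (List.length-tabulate {n = s} id) (∑-*ˡ codes (s + s) rest) ⟩
      s * ((s + s) * ∑ codes rest)
        ≡⟨ cong (λ n → s * ((s + s) * n)) (trans (∑-cong codes (λ C → trans (∑-+ codes _ _)
             (cong (_+ ∑ codes (pair C)) (∑-const codes _)))) (∑-+ codes _ _)) ⟩
      s * ((s + s) * (∑ codes (λ C → τ * single C) + ∑ codes (λ C → ∑ codes (pair C))))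
        ≡⟨ cong (λ n → s * ((s + s) * (n + ∑ codes (λ C → ∑ codes (pair C))))) (∑-*ˡ codes τ single) ⟩
      s * ((s + s) * (τ * ∑ codes single + ∑ codes (λ C → ∑ codes (pair C))))
        ≤⟨ *-monoʳ-≤ s (*-monoʳ-≤ (s + s) (+-mono-≤ (*-monoʳ-≤ τ h₁) h₂)) ⟩
      s * ((s + s) * (τ * (K * τ) + K * (τ * τ)))   ≡⟨ collect s τ K ⟩
      4 * K * ((s * τ) * (s * τ))                   ≡⟨ cong (λ n → 4 * K * (n * n)) (length-arcs N) ⟨
      4 * K * (length (arcs N) * length (arcs N))   ∎
      where
      open ≤-Reasoning
      rest : TreeCode d s N → ℕ
      rest C = ∑ codes (λ C′ → single C + pair C C′)
      collect : ∀ s τ K → s * ((s + s) * (τ * (K * τ) + K * (τ * τ))) ≡ 4 * K * ((s * τ) * (s * τ))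
      collect = solve-∀
      inner : ∀ x → ∑ (arcs N) (parallel x) ≤ (s + s) * rest (proj₂ x)
      -- For given `l` exactly one label agrees, so the `s` factors add up to `s + s`.
      inner (l , C) = ≤-reflexive (begin-equality
        ∑ (arcs N) (parallel (l , C))      ≡⟨ ∑-cartesianProductWith _,_ (allFin s) codes _ ⟩
        ∑ (allFin s) (λ l′ → ∑ codes (λ C′ → factor l′ * (single C + pair C C′)))
          ≡⟨ ∑-cong (allFin s) (λ l′ → ∑-*ˡ codes (factor l′) _) ⟩
        ∑ (allFin s) (λ l′ → factor l′ * rest C)   ≡⟨ ∑-*ʳ (allFin s) (rest C) factor ⟩
        ∑ (allFin s) factor * rest C
          ≡⟨ cong (_* rest C) (trans (∑-+ (allFin s) (λ _ → 1) _) (cong₂ _+_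
               (trans (∑-const (allFin s) 1) (trans (*-identityʳ _) (List.length-tabulate {n = s} id)))
               (trans (∑-*ˡ (allFin s) s _) (trans (cong (s *_) (∑-indicator-≡ l)) (*-identityʳ s))))) ⟩
        (s + s) * rest C ∎)
        where
        factor = λ l′ → 1 + s * indicator (l Fin.≟ l′)

  mutual
    -- Different branches of a node carry independent labels and subtrees, so `∑-parallel` bounds
    -- the mean of a fork. For equal branches the path goes on alone, and the factor 4 is slack.
    ∑-single : ∀ N → ∑ (allCodes d s N) single ≤ base ^ N * length (allCodes d s N)
    ∑-single zero    = ≤-refl
    ∑-single (suc N) = begin
      ∑ (allCodes d s (suc N)) single   ≡⟨ ∑-map node (allVecs (arcs N) d) single ⟩
      ∑ V (λ cs → ∑ (allFin d) λ a → ∑ (allFin d) λ b → fork (a Fin.≟ b) (lookup cs a) (lookup cs b))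
        ≤⟨ ∑∑-swap V (λ cs a b → fork (a Fin.≟ b) (lookup cs a) (lookup cs b)) _ (λ a b → bound a b (a Fin.≟ b)) ⟩
      d * (d * (4 * base ^ N * length (arcs N) ^ d))   ≡⟨ collect d (base ^ N) _ ⟩
      base ^ suc N * length (arcs N) ^ d   ≡⟨ cong (base ^ suc N *_) (length-allCodes-suc N) ⟨
      base ^ suc N * length (allCodes d s (suc N)) ∎
      where
      open ≤-Reasoning
      V = allVecs (arcs N) d
      collect : ∀ d K v → d * (d * (4 * K * v)) ≡ 4 * (d * d) * K * v
      collect = solve-∀
      bound : ∀ a b (a≟b : Dec (a ≡ b)) → ∑ V (λ cs → fork a≟b (lookup cs a) (lookup cs b)) ≤
              4 * base ^ N * length (arcs N) ^ d
      bound a b (no a≢b) = ∑-lookup-≢ (4 * base ^ N) (arcs N) a b a≢b parallel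
        (∑-parallel N (∑-single N) (∑-pair N))
      bound a b (yes _) = ∑-lookup (4 * base ^ N) (arcs N) a (single ∘ proj₂) (begin
        ∑ (arcs N) (single ∘ proj₂)     ≡⟨ ∑-cartesianProductWith _,_ (allFin s) (allCodes d s N) _ ⟩
        ∑ (allFin s) (λ _ → ∑ (allCodes d s N) single)   ≡⟨ ∑-const (allFin s) _ ⟩
        length (allFin s) * ∑ (allCodes d s N) single
          ≡⟨ cong (_* ∑ (allCodes d s N) single) (List.length-tabulate {n = s} id) ⟩
        s * ∑ (allCodes d s N) single                    ≤⟨ *-monoʳ-≤ s (∑-single N) ⟩
        s * (base ^ N * length (allCodes d s N))         ≡⟨ rearrange s (base ^ N) _ ⟩
        base ^ N * (s * length (allCodes d s N))         ≡⟨ cong (base ^ N *_) (length-arcs N) ⟨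
        base ^ N * length (arcs N)                       ≤⟨ *-monoˡ-≤ (length (arcs N)) (m≤n*m (base ^ N) 4) ⟩
        4 * base ^ N * length (arcs N)                   ∎)
        where
        rearrange : ∀ s K m → s * (K * m) ≡ K * (s * m)
        rearrange = solve-∀

    -- The two codes are drawn independently, so this holds for equal branches `a` and `b` as well.
    ∑-pair : ∀ N → let codes = allCodes d s N in
             ∑ codes (λ C → ∑ codes (pair C)) ≤ base ^ N * (length codes * length codes)
    ∑-pair zero    = ≤-refl
    ∑-pair (suc N) = begin
      ∑ codes (λ C → ∑ codes (pair C))   ≡⟨ ∑-map node V _ ⟩
      ∑ V (λ cs → ∑ codes (pair (node cs)))   ≡⟨ ∑-cong V (λ cs → ∑-map node V _) ⟩
      ∑ V (λ cs → ∑ V (λ cs′ → ∑ (allFin d) λ a → ∑ (allFin d) λ b → parallel (lookup cs a) (lookup cs′ b)))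
        ≡⟨ ∑-cong V (λ cs → trans (∑-swap V (allFin d) _) (∑-cong (allFin d) λ a → ∑-swap V (allFin d) _)) ⟩
      ∑ V (λ cs → ∑ (allFin d) λ a → ∑ (allFin d) λ b → ∑ V λ cs′ → parallel (lookup cs a) (lookup cs′ b))
        ≤⟨ ∑∑-swap V {d} (λ cs a b → ∑ V λ cs′ → parallel (lookup cs a) (lookup cs′ b)) _
             (λ a b → ∑-lookup-pair (4 * base ^ N) (arcs N) a b parallel
             (∑-parallel N (∑-single N) (∑-pair N))) ⟩
      d * (d * (4 * base ^ N * (length (arcs N) ^ d * length (arcs N) ^ d)))   ≡⟨ collect d (base ^ N) _ ⟩
      base ^ suc N * (length (arcs N) ^ d * length (arcs N) ^ d)
        ≡⟨ cong (λ n → base ^ suc N * (n * n)) (length-allCodes-suc N) ⟨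
      base ^ suc N * (length codes * length codes) ∎
      where
      open ≤-Reasoning
      V = allVecs (arcs N) d
      codes = allCodes d s (suc N)
      collect : ∀ d K v → d * (d * (4 * K * v)) ≡ 4 * (d * d) * K * v
      collect = solve-∀

-- The potential of a player

m<suc[m/n]*n : ∀ m n .{{_ : NonZero n}} → m < suc (m / n) * n
m<suc[m/n]*n m n = begin-strict
  m                    ≡⟨ m≡m%n+[m/n]*n m n ⟩
  m % n + m / n * n    <⟨ +-monoˡ-< _ (m%n<n m n) ⟩
  suc (m / n) * n      ∎
  where open ≤-Reasoning

headOr0 : List Bool → Bool
headOr0 []      = false
headOr0 (b ∷ _) = b

reply : Bool → Fin 3
reply false = suc zero
reply true  = suc (suc zero)

module Player (D : ℕ) .{{_ : NonZero D}} where

  -- The summand `D` keeps the volume large enough that rounding the slot size up to an integer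
  -- costs a factor of at most 2.
  volume : Tree → ℕ
  volume t = D + total t

  -- The slot size, rounded up so that `D` slots cover more than the whole volume.
  unit : Tree → ℕ
  unit t = suc (volume t / D)

  -- A message names a slot and one of three commands: double inside the slot, or announce the node
  -- at its upper boundary with bit `false` or `true`.
  act : Tree → Fin D × Fin 3 → Tree
  act t (b , zero)           = double (toℕ b * unit t) (toℕ b * unit t + unit t) 0 t
  act t (b , suc zero)       = announce (unit t) (toℕ b * unit t + unit t) false t
  act t (b , suc (suc zero)) = announce (unit t) (toℕ b * unit t + unit t) true t

  update : Tree → Fin (D * 3) → Tree
  update t a = act t (remQuot 3 a)

  volume<D*unit : ∀ t → volume t < D * unit t
  volume<D*unit t = subst (volume t <_) (*-comm (unit t) D) (m<suc[m/n]*n (volume t) D)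

  D*unit≤2volume : ∀ t → D * unit t ≤ volume t + volume t
  D*unit≤2volume t = begin
    D * suc (volume t / D)     ≡⟨ *-suc D _ ⟩
    D + D * (volume t / D)     ≡⟨ cong (D +_) (*-comm D _) ⟩
    D + volume t / D * D       ≤⟨ +-mono-≤ (m≤m+n D (total t)) (m/n*n≤m (volume t) D) ⟩
    volume t + volume t        ∎
    where open ≤-Reasoning

  slot : Tree → List Bool → Fin D
  slot t q = fromℕ< (m<n*o⇒m/o<n {o = unit t} (begin-strict
    offset t q    ≤⟨ offset≤total t q ⟩
    total t       ≤⟨ m≤n+m (total t) D ⟩
    volume t      <⟨ volume<D*unit t ⟩
    D * unit t    ∎))
    where open ≤-Reasoning

  fits? : ∀ t q → Dec (offset t q + weight 0 t q ≤ toℕ (slot t q) * unit t + unit t)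
  fits? t q = _ ≤? _

  choose : Tree → List Bool → Fin D × Fin 3
  choose t q with residue t q | fits? t q
  -- All of `q` is announced, so there is nothing to aim at; some doubling is sent, which never
  -- lowers a weight.
  ... | nothing | _     = slot t q , zero
  ... | just q′ | yes _ = slot t q , zero
  ... | just q′ | no  _ = slot t q , reply (headOr0 q′)

  symbol : Tree → List Bool → Fin (D * 3)
  symbol t q = let (b , f) = choose t q in combine b f

  update-symbol : ∀ t q → update t (symbol t q) ≡ act t (choose t q)
  update-symbol t q = cong (act t) (Fin.remQuot-combine (proj₁ (choose t q)) (proj₂ (choose t q)))

  toℕ-slot : ∀ t q → toℕ (slot t q) ≡ offset t q / unit t
  toℕ-slot t q = Fin.toℕ-fromℕ< _

  slot*unit≤offset : ∀ t q → toℕ (slot t q) * unit t ≤ offset t q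
  slot*unit≤offset t q = subst (λ b → b * unit t ≤ offset t q) (sym (toℕ-slot t q))
    (m/n*n≤m (offset t q) (unit t))

  offset<slot*unit+unit : ∀ t q → offset t q < toℕ (slot t q) * unit t + unit t
  offset<slot*unit+unit t q = begin-strict
    offset t q                             <⟨ m<suc[m/n]*n (offset t q) (unit t) ⟩
    suc (offset t q / unit t) * unit t     ≡⟨ +-comm (unit t) _ ⟩
    offset t q / unit t * unit t + unit t
      ≡⟨ cong (λ b → b * unit t + unit t) (sym (toℕ-slot t q)) ⟩
    toℕ (slot t q) * unit t + unit t       ∎
    where open ≤-Reasoning

  act-reply : ∀ t b z → act t (b , reply z) ≡ announce (unit t) (toℕ b * unit t + unit t) z t
  act-reply t b false = refl
  act-reply t b true  = refl

  act≡plant : ∀ t q {q′} → residue t q ≡ just q′ →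
              ¬ offset t q + weight 0 t q ≤ toℕ (slot t q) * unit t + unit t →
              ∀ z → act t (slot t q , reply z) ≡ plant (unit t) z t q
  act≡plant t q e ¬fits z = trans (act-reply t (slot t q) z)
    (announce≡plant (unit t) _ z t q (residue⇒depth t q e)
      (<⇒≤ (offset<slot*unit+unit t q)) (≰⇒> ¬fits))

  D*volume-double : ∀ t lo → D * volume (double lo (lo + unit t) 0 t) ≤ (D + 4) * volume t
  D*volume-double t lo = begin
    D * (D + total t′)              ≤⟨ *-monoʳ-≤ D (+-monoʳ-≤ D (≤-trans (m≤m+n _ _) (total-double lo u 0 t))) ⟩
    D * (D + (total t + f (total t)))     ≤⟨ *-monoʳ-≤ D (+-monoʳ-≤ D (+-monoʳ-≤ (total t) (m⊓n≤n _ u))) ⟩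
    D * (D + (total t + u))         ≡⟨ expand D (total t) u ⟩
    D * volume t + D * u            ≤⟨ +-monoʳ-≤ (D * volume t) (D*unit≤2volume t) ⟩
    D * volume t + (volume t + volume t)  ≤⟨ m≤m+n _ (volume t + volume t) ⟩
    D * volume t + (volume t + volume t) + (volume t + volume t) ≡⟨ collect D (volume t) ⟩
    (D + 4) * volume t              ∎
    where
    open ≤-Reasoning
    u = unit t
    t′ = double lo (lo + u) 0 t
    f = λ x → (x ∸ lo) ⊓ u
    expand : ∀ D x u → D * (D + (x + u)) ≡ D * (D + x) + D * u
    expand = solve-∀
    collect : ∀ D v → D * v + (v + v) + (v + v) ≡ (D + 4) * v
    collect = solve-∀

  D*volume-announce : ∀ t x z → D * volume (announce (unit t) x z t) ≤ (D + 4) * volume t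
  D*volume-announce t x z = begin
    D * (D + total t′)              ≤⟨ *-monoʳ-≤ D (+-monoʳ-≤ D (total-announce u x z t)) ⟩
    D * (D + (total t + (u + u)))   ≡⟨ expand D (total t) u ⟩
    D * volume t + (D * u + D * u)  ≤⟨ +-monoʳ-≤ (D * volume t) (+-mono-≤ (D*unit≤2volume t) (D*unit≤2volume t)) ⟩
    D * volume t + ((volume t + volume t) + (volume t + volume t)) ≡⟨ collect D (volume t) ⟩
    (D + 4) * volume t              ∎
    where
    open ≤-Reasoning
    u = unit t
    t′ = announce u x z t
    expand : ∀ D x u → D * (D + (x + (u + u))) ≡ D * (D + x) + (D * u + D * u)
    expand = solve-∀
    collect : ∀ D v → D * v + ((v + v) + (v + v)) ≡ (D + 4) * v
    collect = solve-∀

  D*volume-act : ∀ t a → D * volume (act t a) ≤ (D + 4) * volume t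
  D*volume-act t (b , zero)           = D*volume-double t _
  D*volume-act t (b , suc zero)       = D*volume-announce t _ false
  D*volume-act t (b , suc (suc zero)) = D*volume-announce t _ true

  -- The old volume is less than `D` units and the children add two, so each new child holds at
  -- least the fraction 1/(D + 2) of the new volume.
  unit≤volume-announce : ∀ t x z → volume (announce (unit t) x z t) ≤ (D + 2) * unit t
  unit≤volume-announce t x z = begin
    D + total (announce u x z t)   ≤⟨ +-monoʳ-≤ D (total-announce u x z t) ⟩
    D + (total t + (u + u))        ≡⟨ sym (+-assoc D _ _) ⟩
    volume t + (u + u)             ≤⟨ +-monoˡ-≤ (u + u) (<⇒≤ (volume<D*unit t)) ⟩
    D * u + (u + u)                ≡⟨ collect D u ⟩
    (D + 2) * u                    ∎
    where
    open ≤-Reasoning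
    u = unit t
    collect : ∀ D u → D * u + (u + u) ≡ (D + 2) * u
    collect = solve-∀

  -- The node that a player with path `q` aims at is the pending node on `p`.
  Hit : List Bool → Tree → List Bool → Set
  Hit p t q = depth t p ≤ length p × depth t p ≤ commonPrefix q p

  hit? : ∀ p t q → Dec (Hit p t q)
  hit? p t q = _ ≤? _ ×-dec _ ≤? _

  gain : List Bool → Tree → List Bool → ℕ
  gain p t q = indicator (hit? p t q)

  -- The two outcomes of a round for the goal, with `g` equal to 1 for a hit. Either the goal stays
  -- and its weight grows by `2 ^ g`, or it is announced and the next goal has at least 1/(D + 2) of
  -- the volume, whatever the old weight was.
  data Effect (p : List Bool) (g : ℕ) (t t′ : Tree) : Set where
    kept : depth t′ p ≡ depth t p →
           (depth t p ≤ length p → 2 ^ g * weight 0 t p ≤ weight 0 t′ p) →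
           (length p < depth t p → g ≡ 0) → Effect p g t t′
    grew : depth t′ p ≡ suc (depth t p) → g ≤ 1 →
           volume t′ ≤ (D + 2) * weight (volume t′) t′ p → Effect p g t t′

  grew-announce : ∀ p t x z {g} → let t′ = announce (unit t) x z t in g ≤ 1 →
                  depth t′ p ≡ suc (depth t p) → Effect p g t t′
  grew-announce p t x z g≤1 d with announce-cases (volume (announce (unit t) x z t)) (unit t) x z t p
  ... | inj₁ (d′ , _) = contradiction (trans (sym d) d′) 1+n≢n
  ... | inj₂ (_ , le) = grew d g≤1 (begin
    v                        ≤⟨ ⊓-glb (unit≤volume-announce t x z)
                                  (m≤n*m v (D + 2) {{>-nonZero (m≤n⇒m≤o+n D (s≤s z≤n))}}) ⟩
    (D + 2) * unit t ⊓ ((D + 2) * v) ≡⟨ sym (*-distribˡ-⊓ (D + 2) (unit t) v) ⟩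
    (D + 2) * (unit t ⊓ v)   ≤⟨ *-monoʳ-≤ (D + 2) le ⟩
    (D + 2) * weight v t′ p  ∎)
    where
    open ≤-Reasoning
    t′ = announce (unit t) x z t
    v = volume t′

  effect-announce : ∀ p t x z → Effect p 0 t (announce (unit t) x z t)
  effect-announce p t x z with announce-cases 0 (unit t) x z t p
  ... | inj₁ (d , w) = kept d (λ _ → ≤-reflexive (trans (+-identityʳ _) (sym w))) (λ _ → refl)
  ... | inj₂ (d , _) = grew-announce p t x z z≤n d

  effect-miss : ∀ p t a → Effect p 0 t (act t a)
  effect-miss p t (b , zero) = kept (depth-double _ _ 0 t p)
    (λ _ → ≤-trans (≤-reflexive (+-identityʳ _)) (weight-double 0 _ _ 0 t p)) (λ _ → refl)
  effect-miss p t (b , suc zero)       = effect-announce p t _ false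
  effect-miss p t (b , suc (suc zero)) = effect-announce p t _ true

  effect-hit : ∀ p t q → Hit p t q → Effect p 1 t (act t (choose t q))
  effect-hit p t q (≤len , ≤lcp) with residue t q in eq | fits? t q
  ... | nothing | _ = contradiction (trans (sym eq) (proj₂ (residue-just t q depth≤))) λ ()
    where open Located (locate {0} t q p ≤len ≤lcp)
  ... | just _ | yes fits = kept (depth-double _ _ 0 t p)
      (λ _ → ≤-reflexive (trans (cong (w +_) (+-identityʳ w)) (sym (weight-double-hit 0 _ _ 0 t p ≤len
        (subst (toℕ (slot t q) * unit t ≤_) offset≡ (slot*unit≤offset t q))
        (subst₂ (λ o w → o + w ≤ _) offset≡ weight≡ fits)))))
      (λ len< → contradiction ≤len (<⇒≱ len<))
    where
    open Located (locate {0} t q p ≤len ≤lcp)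
    w = weight 0 t p
  ... | just q′ | no ¬fits = subst (Effect p 1 t) (sym (act-reply t (slot t q) (headOr0 q′)))
      (grew-announce p t _ (headOr0 q′) ≤-refl (trans (cong (λ t′ → depth t′ p)
        (announce≡plant (unit t) _ (headOr0 q′) t p ≤len
          (subst (_≤ _) offset≡ (<⇒≤ (offset<slot*unit+unit t q)))
          (subst₂ (λ o w → _ < o + w) offset≡ weight≡ (≰⇒> ¬fits))))
        (depth-plant (unit t) (headOr0 q′) t p ≤len)))
    where open Located (locate {0} t q p ≤len ≤lcp)

  effect : ∀ p t q (h? : Dec (Hit p t q)) → Effect p (indicator h?) t (act t (choose t q))
  effect p t q (yes h) = effect-hit p t q h
  effect p t q (no _)  = effect-miss p t (choose t q)

  growth : ℕ
  growth = 2 * (D + 2)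

  growth≥2 : 2 ≤ growth
  growth≥2 = *-monoʳ-≤ 2 (m≤n⇒m≤o+n D (s≤s z≤n))

  -- Each hit doubles the weight of the goal, while the volume grows by a
  -- factor of at most 1 + 4 / D per round.

  Invariant : List Bool → ℕ → ℕ → Tree → Set
  Invariant p i G t = D ^ i * 2 ^ G * volume t ≤
    weight (volume t) t p * (growth ^ suc (depth t p) * (D + 4) ^ i)

  weight≤volume : ∀ t p → weight (volume t) t p ≤ volume t
  weight≤volume t p with depth t p ≤? length p
  ... | yes h = ≤-trans (m+n≤o⇒n≤o (offset t p) (weight≤total _ t p h)) (m≤n+m _ D)
  ... | no ¬h = ≤-reflexive (weight-complete t p (≰⇒> ¬h))

  invariant⇒bound : ∀ p i G t → Invariant p i G t →
                    D ^ i * 2 ^ G ≤ growth ^ suc (depth t p) * (D + 4) ^ i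
  invariant⇒bound p i G t inv =
    *-cancelˡ-≤ (volume t) {{>-nonZero (≤-trans (>-nonZero⁻¹ D) (m≤m+n D (total t)))}} (begin
    volume t * (D ^ i * 2 ^ G)  ≡⟨ *-comm (volume t) _ ⟩
    D ^ i * 2 ^ G * volume t    ≤⟨ inv ⟩
    weight (volume t) t p * _   ≤⟨ *-monoˡ-≤ _ (weight≤volume t p) ⟩
    volume t * _                ∎)
    where open ≤-Reasoning

  invariant-step : ∀ p i g G t a → Effect p g t (act t a) →
                   Invariant p i G t → Invariant p (suc i) (g + G) (act t a)
  invariant-step p i g G t a e inv = go e
    where
    open ≤-Reasoning
    t′ = act t a
    v = volume t
    v′ = volume t′
    X = D ^ i
    Y = growth ^ suc (depth t p)
    Z = (D + 4) ^ i
    go : Effect p g t t′ → Invariant p (suc i) (g + G) t′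
    -- One more factor `growth = 2 * (D + 2)` is available: 2 pays for the hit, `D + 2` for the
    -- ratio of volume to weight at the new goal. The old ratio is given up through
    -- `invariant⇒bound`.
    go (grew d g≤1 ≤w) = begin
      D * X * 2 ^ (g + G) * v′         ≤⟨ *-mono-≤ (*-monoʳ-≤ (D * X) (^-monoʳ-≤ 2 (+-monoˡ-≤ G g≤1))) ≤w ⟩
      D * X * (2 * 2 ^ G) * ((D + 2) * w′) ≡⟨ split D X (2 ^ G) w′ ⟩
      w′ * (growth * (D * (X * 2 ^ G)))
        ≤⟨ *-monoʳ-≤ w′ (*-monoʳ-≤ growth (*-mono-≤ (m≤m+n D 4) (invariant⇒bound p i G t inv))) ⟩
      w′ * (growth * ((D + 4) * (Y * Z))) ≡⟨ cong (w′ *_) (merge growth (D + 4) Y Z) ⟩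
      w′ * (growth * Y * ((D + 4) * Z))
        ≡⟨ cong (λ n → w′ * (growth ^ suc n * ((D + 4) * Z))) (sym d) ⟩
      w′ * (growth ^ suc (depth t′ p) * ((D + 4) * Z)) ∎
      where
      w′ = weight v′ t′ p
      split : ∀ D X g w → D * X * (2 * g) * ((D + 2) * w) ≡ w * (2 * (D + 2) * (D * (X * g)))
      split = solve-∀
      merge : ∀ g k Y Z → g * (k * (Y * Z)) ≡ g * Y * (k * Z)
      merge = solve-∀
    go (kept d ≤w g≡0) with depth t p ≤? length p
    ... | yes h = begin
      D * X * 2 ^ (g + G) * v′      ≡⟨ cong (λ n → D * X * n * v′) (^-distribˡ-+-* 2 g G) ⟩
      D * X * (2 ^ g * 2 ^ G) * v′  ≡⟨ split D X (2 ^ g) (2 ^ G) v′ ⟩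
      X * 2 ^ G * 2 ^ g * (D * v′)  ≤⟨ *-monoʳ-≤ (X * 2 ^ G * 2 ^ g) (D*volume-act t a) ⟩
      X * 2 ^ G * 2 ^ g * ((D + 4) * v) ≡⟨ swap (X * 2 ^ G) (2 ^ g) (D + 4) v ⟩
      X * 2 ^ G * v * (2 ^ g * (D + 4)) ≤⟨ *-monoˡ-≤ _ inv ⟩
      weight v t p * (Y * Z) * (2 ^ g * (D + 4)) ≡⟨ merge (weight v t p) Y Z (2 ^ g) (D + 4) ⟩
      2 ^ g * weight v t p * (Y * ((D + 4) * Z))
        ≡⟨ cong (λ w → 2 ^ g * w * (Y * ((D + 4) * Z))) (weight-incomplete t p h) ⟩
      2 ^ g * weight 0 t p * (Y * ((D + 4) * Z)) ≤⟨ *-monoˡ-≤ _ (≤w h) ⟩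
      weight 0 t′ p * (Y * ((D + 4) * Z))
        ≡⟨ cong₂ (λ w n → w * (growth ^ suc n * ((D + 4) * Z)))
             (weight-incomplete t′ p (subst (_≤ length p) (sym d) h)) (sym d) ⟩
      weight v′ t′ p * (growth ^ suc (depth t′ p) * ((D + 4) * Z)) ∎
      where
      split : ∀ D X g h v → D * X * (g * h) * v ≡ X * h * g * (D * v)
      split = solve-∀
      swap : ∀ a b c d → a * b * (c * d) ≡ a * d * (b * c)
      swap = solve-∀
      merge : ∀ w Y Z g k → w * (Y * Z) * (g * k) ≡ g * w * (Y * (k * Z))
      merge = solve-∀
    -- Once `p` is complete its weight is the volume by convention, and no more hits occur.
    ... | no ¬h = begin
      D * X * 2 ^ (g + G) * v′ ≡⟨ cong (λ n → D * X * 2 ^ (n + G) * v′) (g≡0 (≰⇒> ¬h)) ⟩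
      D * X * 2 ^ G * v′       ≡⟨ split D X (2 ^ G) v′ ⟩
      v′ * (D * (X * 2 ^ G))   ≤⟨ *-monoʳ-≤ v′ (*-mono-≤ (m≤m+n D 4) (invariant⇒bound p i G t inv)) ⟩
      v′ * ((D + 4) * (Y * Z)) ≡⟨ cong (v′ *_) (merge (D + 4) Y Z) ⟩
      v′ * (Y * ((D + 4) * Z))
        ≡⟨ cong₂ (λ w n → w * (growth ^ suc n * ((D + 4) * Z)))
             (sym (weight-complete t′ p (subst (length p <_) (sym d) (≰⇒> ¬h)))) (sym d) ⟩
      weight v′ t′ p * (growth ^ suc (depth t′ p) * ((D + 4) * Z)) ∎
      where
      split : ∀ D X g v → D * X * g * v ≡ v * (D * (X * g))
      split = solve-∀
      merge : ∀ k Y Z → k * (Y * Z) ≡ Y * (k * Z)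
      merge = solve-∀

  start : Tree
  start = pending 1

  invariant-start : ∀ p → Invariant p 0 0 start
  invariant-start p = begin
    1 * 1 * (D + 1)  ≡⟨ *-identityˡ (D + 1) ⟩
    D + 1            ≤⟨ m≤m+n (D + 1) (D + 3) ⟩
    D + 1 + (D + 3)  ≡⟨ eq D ⟩
    1 * (growth ^ 1 * 1) ∎
    where
    open ≤-Reasoning
    eq : ∀ D → D + 1 + (D + 3) ≡ 1 * (2 * (D + 2) * 1 * 1)
    eq = solve-∀

  module Run (q : ℕ → List Bool) (tree : ℕ → Tree) (tree-zero : tree 0 ≡ start)
             (tree-suc : ∀ i → tree (suc i) ≡ update (tree i) (symbol (tree i) (q i)))
             (p : List Bool) where

    hits : ℕ → ℕ
    hits zero    = 0
    hits (suc i) = gain p (tree i) (q i) + hits i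

    hits-mono : ∀ {i j} → i ≤ j → hits i ≤ hits j
    hits-mono i≤j = go (≤⇒≤′ i≤j)
      where
      go : ∀ {i j} → i ≤′ j → hits i ≤ hits j
      go ≤′-refl     = ≤-refl
      go (≤′-step p) = ≤-trans (go p) (m≤n+m _ _)

    invariant : ∀ i → Invariant p i (hits i) (tree i)
    invariant zero = subst (Invariant p 0 0) (sym tree-zero) (invariant-start p)
    invariant (suc i) = subst (Invariant p (suc i) (hits (suc i)))
      (sym (trans (tree-suc i) (update-symbol (tree i) (q i))))
      (invariant-step p i _ (hits i) (tree i) (choose (tree i) (q i))
        (effect p (tree i) (q i) (hit? p (tree i) (q i))) (invariant i))

    hits-bound : ∀ i → D ^ i * 2 ^ hits i ≤ growth ^ (2 + length p) * (D + 4) ^ i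
    hits-bound i = ≤-trans (invariant⇒bound p i (hits i) (tree i) (invariant i))
      (*-monoˡ-≤ _ (^-monoʳ-≤ growth {{>-nonZero (<⇒≤ growth≥2)}} (s≤s (depth≤1+length (tree i) p))))

-- Inference from truthful announcements

private variable
  XA XB : Set
  T : ℕ

swap : Protocol XA XB T → Protocol XB XA T
swap end         = end
swap (alice b π) = bob b (λ z → swap (π z))
swap (bob b π)   = alice b (λ z → swap (π z))

transcript-swap : ∀ (π : Protocol XA XB T) x y → transcript (swap π) y x ≡ transcript π x y
transcript-swap end         x y = refl
transcript-swap (alice b π) x y = cong (b x ∷_) (transcript-swap (π (b x)) x y)
transcript-swap (bob b π)   x y = cong (b y ∷_) (transcript-swap (π (b y)) x y)

-- What Alice can infer about the transcript from her input and the tree of Bob's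
-- announcements.  Bob does the same with swap π.

follow : Protocol XA XB T → XA → Tree → List Bool
follow end         x s                   = []
follow (alice b π) x s                   = b x ∷ follow (π (b x)) x (child (b x) s)
follow (bob b π)   x (pending w)         = []
follow (bob b π)   x s@(announced z _ _) = z ∷ follow (π z) x (child z s)

-- Only the sender's bits at her own nodes on the true transcript are constrained. What she
-- announces elsewhere, misled by decoding errors, does no harm.
Truthful : Protocol XA XB T → XA → XB → Tree → Set
Truthful π           x y (pending w)         = ⊤
Truthful end         x y (announced z l r)   = ⊤
Truthful (alice b π) x y t@(announced z _ _) = z ≡ b x × Truthful (π (b x)) x y (child (b x) t)
Truthful (bob b π)   x y t@(announced _ _ _) = Truthful (π (b y)) x y (child (b y) t)

truthful-double : ∀ (π : Protocol XA XB T) x y lo hi c t →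
                  Truthful π x y t → Truthful π x y (double lo hi c t)
truthful-double π x y lo hi c (pending w) _ with lo ≤? c | c + w ≤? hi
... | yes _ | yes _ = tt
... | yes _ | no  _ = tt
... | no  _ | _     = tt
truthful-double end x y lo hi c (announced z l r) _ = tt
truthful-double {XA} {XB} {suc T} π₀ x y lo hi c t@(announced z l r) h = go π₀ h
  where
  below : ∀ (π : Bool → Protocol XA XB T) v → Truthful (π v) x y (child v t) →
          Truthful (π v) x y (child v (double lo hi c t))
  below π false = truthful-double (π false) x y lo hi c l
  below π true  = truthful-double (π true) x y lo hi _ r
  go : ∀ (π : Protocol XA XB (suc T)) → Truthful π x y t → Truthful π x y (double lo hi c t)
  go (alice b π) (e , h) = e , below π (b x) h
  go (bob b π)   h       = below π (b y) h

child-truthful : ∀ (π : Protocol XA XB T) x y u b {z} →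
                 Truthful π x y (child b (announced z (pending u) (pending u)))
child-truthful π x y u false = tt
child-truthful π x y u true  = tt

-- `follow` never stops at a node of the sender, so there the residue begins with her true bit. It
-- can stop at a node of the other user or at the end, where the default bit of `headOr0` is not
-- constrained.
truthful-plant : ∀ (π : Protocol XA XB T) x y s u t {q} →
                 residue t (follow π x s) ≡ just q → Truthful π x y t →
                 Truthful π x y (plant u (headOr0 q) t (follow π x s))
truthful-plant end         x y s u (pending w) refl _ = tt
truthful-plant (alice b π) x y s u (pending w) refl _ = refl , child-truthful (π (b x)) x y u (b x)
truthful-plant (bob b π)   x y s u (pending w) _    _ = child-truthful (π (b y)) x y u (b y)
truthful-plant {XA} {XB} {suc T} π₀ x y s u t@(announced z l r) = go π₀ s
  where
  below : ∀ (π : Bool → Protocol XA XB T) s v v′ {q} →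
          let p = follow (π v) x (child v s) in residue t (v ∷ p) ≡ just q →
          Truthful (π v′) x y (child v′ t) →
          Truthful (π v′) x y (child v′ (plant u (headOr0 q) t (v ∷ p)))
  below π s false false eq h = truthful-plant (π false) x y (child false s) u l eq h
  below π s false true  eq h = h
  below π s true  false eq h = h
  below π s true  true  eq h = truthful-plant (π true) x y (child true s) u r eq h
  go : ∀ (π : Protocol XA XB (suc T)) s {q} → residue t (follow π x s) ≡ just q →
       Truthful π x y t → Truthful π x y (plant u (headOr0 q) t (follow π x s))
  go (alice b π) s                   eq (e , h) = e , below π s (b x) (b x) eq h
  go (bob b π)   s@(announced v _ _) eq h       = below π s v (b y) eq h

infix 4 _⊑_

-- Extension by further announcements. Weights are ignored, because inference reads only the bits.
data _⊑_ : Tree → Tree → Set where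
  pending   : ∀ {w t} → pending w ⊑ t
  announced : ∀ {z l l′ r r′} → l ⊑ l′ → r ⊑ r′ → announced z l r ⊑ announced z l′ r′

⊑-refl : ∀ {t} → t ⊑ t
⊑-refl {pending w}       = pending
⊑-refl {announced z l r} = announced ⊑-refl ⊑-refl

⊑-trans : ∀ {s t u} → s ⊑ t → t ⊑ u → s ⊑ u
⊑-trans pending         _                 = pending
⊑-trans (announced a b) (announced a′ b′) = announced (⊑-trans a a′) (⊑-trans b b′)

⊑-double : ∀ lo hi c t → t ⊑ double lo hi c t
⊑-double lo hi c (pending w)       = pending
⊑-double lo hi c (announced z l r) = announced (⊑-double lo hi c l) (⊑-double lo hi _ r)

⊑-announce : ∀ u x z t → t ⊑ announce u x z t
⊑-announce u x z (pending w) = pending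
⊑-announce u x z (announced y l r) with x <? total l
... | yes _ = announced (⊑-announce u x z l) ⊑-refl
... | no  _ = announced ⊑-refl (⊑-announce u _ z r)

⊑⇒depth≤ : ∀ {t t′} p → t ⊑ t′ → depth t p ≤ depth t′ p
⊑⇒depth≤ p           pending         = z≤n
⊑⇒depth≤ []          (announced _ _) = ≤-refl
⊑⇒depth≤ (false ∷ p) (announced a _) = s≤s (⊑⇒depth≤ p a)
⊑⇒depth≤ (true  ∷ p) (announced _ a) = s≤s (⊑⇒depth≤ p a)

⊑-child : ∀ {t t′} b → t ⊑ t′ → child b t ⊑ child b t′
⊑-child b     pending         = pending
⊑-child false (announced a _) = a
⊑-child true  (announced _ a) = a

depth-child : ∀ z l r b p → let t = announced z l r in depth t (b ∷ p) ≡ suc (depth (child b t) p)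
depth-child z l r false p = refl
depth-child z l r true  p = refl

commonPrefix-∷ : ∀ b q p → commonPrefix (b ∷ q) (b ∷ p) ≡ suc (commonPrefix q p)
commonPrefix-∷ false q p = refl
commonPrefix-∷ true  q p = refl

-- Within `t` the tree `s` has the same bits, which are correct where they matter, so inference
-- stays on the transcript; beyond `t` the tree `s` may be wrong. The minimum with `T` is needed
-- because the end of the transcript is a node that can be announced too.
follow-agrees : ∀ (π : Protocol XA XB T) x y t s → t ⊑ s → Truthful (swap π) y x t →
                let p = toList (transcript π x y) in
                T ⊓ depth t p ≤ commonPrefix (follow π x s) p
follow-agrees end x y t s _ _ = z≤n
follow-agrees {T = suc T} π@(alice _ _) x y (pending w) s _ _ = z≤n
follow-agrees {T = suc T} π@(bob _ _)   x y (pending w) s _ _ = z≤n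
follow-agrees (alice b π) x y t@(announced z l r) s t⊑s h = subst₂ _≤_
  (cong (suc _ ⊓_) (sym (depth-child z l r (b x) _)))
  (sym (commonPrefix-∷ (b x) (follow (π (b x)) x (child (b x) s)) _))
  (s≤s (follow-agrees (π (b x)) x y (child (b x) t) (child (b x) s) (⊑-child (b x) t⊑s) h))
follow-agrees (bob b π) x y t@(announced z l r) s@(announced z l′ r′) t⊑s@(announced _ _) (refl , h) = subst₂ _≤_
  (cong (suc _ ⊓_) (sym (depth-child z l r (b y) _)))
  (sym (commonPrefix-∷ (b y) (follow (π (b y)) x (child (b y) s)) _))
  (s≤s (follow-agrees (π (b y)) x y (child (b y) t) (child (b y) s) (⊑-child (b y) t⊑s) h))

pad : ∀ T → List Bool → Vec Bool T
pad zero    q       = []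
pad (suc T) []      = false ∷ pad T []
pad (suc T) (b ∷ q) = b ∷ pad T q

pad-agrees : ∀ {T} q (p : Vec Bool T) → T ≤ commonPrefix q (toList p) → pad T q ≡ p
pad-agrees q           []          _       = refl
pad-agrees (false ∷ q) (false ∷ p) (s≤s h) = cong (false ∷_) (pad-agrees q p h)
pad-agrees (true  ∷ q) (true  ∷ p) (s≤s h) = cong (true ∷_) (pad-agrees q p h)

module Honest (D : ℕ) .{{_ : NonZero D}} where
  open Player D

  run : ∀ {k} → Tree → Node (D * 3) k → Tree
  run t []      = t
  run t (a ∷ u) = run (update t a) u

  ⊑-act : ∀ t a → t ⊑ act t a
  ⊑-act t (b , zero)           = ⊑-double _ _ 0 t
  ⊑-act t (b , suc zero)       = ⊑-announce _ _ false t
  ⊑-act t (b , suc (suc zero)) = ⊑-announce _ _ true t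

  ⊑-run : ∀ {k} t (u : Node (D * 3) k) → t ⊑ run t u
  ⊑-run t []      = ⊑-refl
  ⊑-run t (a ∷ u) = ⊑-trans (⊑-act t (remQuot 3 a)) (⊑-run (update t a) u)

  truthful-choose : ∀ (π : Protocol XA XB T) x y s t → Truthful π x y t →
                    Truthful π x y (act t (choose t (follow π x s)))
  truthful-choose π x y s t h with residue t (follow π x s) in eq | fits? t (follow π x s)
  ... | nothing | _     = truthful-double π x y _ _ 0 t h
  ... | just _  | yes _ = truthful-double π x y _ _ 0 t h
  ... | just q  | no ¬f = subst (Truthful π x y) (sym (act≡plant t _ eq ¬f (headOr0 q)))
    (truthful-plant π x y s _ t eq h)

-- Bad intervals on a path

last : ∀ {P : ℕ → Set} → (∀ h → Dec (P h)) → ∀ N → (∀ h → N < h → ¬ P h) →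
       (∀ h → ¬ P h) ⊎ ∃[ h ] P h × (∀ h′ → h < h′ → ¬ P h′)
last P? N above with P? N
... | yes p = inj₂ (N , p , above)
last P? zero above | no ¬p = inj₁ λ { zero → ¬p ; (suc h) → above (suc h) (s≤s z≤n) }
last {P} P? (suc N) above | no ¬p = last P? N λ h N<h → go h (m≤n⇒m<n∨m≡n N<h)
  where
  go : ∀ h → suc N < h ⊎ suc N ≡ h → ¬ P h
  go h (inj₁ N<h)  = above h N<h
  go h (inj₂ refl) = ¬p

≤-dec : ∀ {m n} {P : m ≤ n → Set} → (∀ m≤n → Dec (P m≤n)) → Dec (Σ (m ≤ n) P)
≤-dec {m} {n} {P} P? with m ≤? n
... | no m≰n  = no λ (m≤n , _) → m≰n m≤n
... | yes m≤n = Dec.map′ (m≤n ,_) (λ (m≤n′ , p) → subst P (≤-irrelevant m≤n′ m≤n) p) (P? m≤n)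

module Cover (N n s : ℕ) (Interval : ℕ → ℕ → Set) where

  Covered : ℕ → ℕ → Set
  Covered y h = ∃[ m ] m ≤ y × y < h × Interval m h

  -- Of the intervals through the first uncovered point y, take one that reaches
  -- farthest.  Then any two intervals chosen two steps apart are disjoint, so
  -- that they form two disjoint families, one free to continue from x and the
  -- other from y; they swap roles at each step.

  two-families : (A count : ℕ → ℕ) →
    (∀ {x y} → x ≤ y → A y ≤ A x) → (∀ x → 1 ≤ A x) →
    (∀ {m h} → Interval m h → h ≤ N) →
    (∀ {m h} → Interval m h → ∃[ g ] h ≤ m + n * g × s ^ g * A h ≤ A m) →
    (∀ y h → Dec (Covered y h)) →
    (∀ {x y} → x ≤ y → count x ≤ count y) →
    (∀ {x y} → x ≤ y → count y ≤ count x + (y ∸ x)) →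
    (∀ y → (∀ h → ¬ Covered y h) → count (suc y) ≤ count y) →
    ∀ fuel x y → N ≤ y + fuel → (∀ m h → y < h → Interval m h → x ≤ m) →
    ∃[ g ] ∃[ g′ ] s ^ g ≤ A x × s ^ g′ ≤ A y × count N ≤ count y + n * (g + g′)
  two-families A count anti pos bounded jump covered? mono lip skip = go
    where
    open ≤-Reasoning
    go : ∀ fuel x y → N ≤ y + fuel → (∀ m h → y < h → Interval m h → x ≤ m) →
         ∃[ g ] ∃[ g′ ] s ^ g ≤ A x × s ^ g′ ≤ A y × count N ≤ count y + n * (g + g′)
    go zero x y N≤y _ = 0 , 0 , pos x , pos y ,
      ≤-trans (mono (≤-trans N≤y (≤-reflexive (+-identityʳ y)))) (m≤m+n (count y) _)
    go (suc fuel) x y N≤ right with last (covered? y) N (λ { h N<h (m , _ , _ , I) → <⇒≱ N<h (bounded I) })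
    ... | inj₁ none =
      let (g , g′ , ≤x , ≤y , le) = go fuel x (suc y) (≤-trans N≤ (≤-reflexive (+-suc y fuel)))
                                       (λ m h y<h → right m h (<-trans (n<1+n y) y<h))
      in g , g′ , ≤x , ≤-trans ≤y (anti (n≤1+n y)) , ≤-trans le (+-monoˡ-≤ _ (skip y none))
    ... | inj₂ (h , (m , m≤y , y<h , I) , farthest) =
      let (g , g′ , ≤y , ≤h , le) = go fuel y h
            (≤-trans N≤ (≤-trans (≤-reflexive (+-suc y fuel)) (+-monoˡ-≤ fuel y<h)))
            -- An interval that reaches beyond `h` and begins before `y` would cover `y`, against
            -- the choice of `h`.
            (λ m′ h′ h<h′ I′ → ≮⇒≥ λ m′<y → farthest h′ h<h′ (m′ , <⇒≤ m′<y , <-trans y<h h<h′ , I′))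
          (k , h≤ , ≤m) = jump I
      in k + g′ , g , (begin
           s ^ (k + g′)      ≡⟨ ^-distribˡ-+-* s k g′ ⟩
           s ^ k * s ^ g′    ≤⟨ *-monoʳ-≤ (s ^ k) ≤h ⟩
           s ^ k * A h       ≤⟨ ≤m ⟩
           A m               ≤⟨ anti (right m h y<h I) ⟩
           A x               ∎) , ≤y , (begin
           count N                              ≤⟨ le ⟩
           count h + n * (g + g′)               ≤⟨ +-monoˡ-≤ _ (lip (<⇒≤ y<h)) ⟩
           count y + (h ∸ y) + n * (g + g′)
             ≤⟨ +-monoˡ-≤ _ (+-monoʳ-≤ (count y) (m≤n+o⇒m∸n≤o h y (≤-trans h≤ (+-monoˡ-≤ (n * k) m≤y)))) ⟩
           count y + n * k + n * (g + g′)       ≡⟨ collect (count y) n k g g′ ⟩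
           count y + n * (k + g′ + g)           ∎)
      where
      collect : ∀ c n k g g′ → c + n * k + n * (g + g′) ≡ c + n * (k + g′ + g)
      collect = solve-∀

-- Counting bad arcs in prefixes of a path

prefixCount : ∀ {N} {P : Fin N → Set} → (∀ i → Dec (P i)) → ℕ → ℕ
prefixCount {zero}  P? j       = 0
prefixCount {suc N} P? zero    = 0
prefixCount {suc N} P? (suc j) = indicator (P? zero) + prefixCount (P? ∘ suc) j

indicator≤1 : ∀ {P : Set} (p? : Dec P) → indicator p? ≤ 1
indicator≤1 (yes _) = ≤-refl
indicator≤1 (no  _) = z≤n

prefixCount-mono : ∀ {N} {P : Fin N → Set} (P? : ∀ i → Dec (P i)) {x y} → x ≤ y →
                   prefixCount P? x ≤ prefixCount P? y
prefixCount-mono {zero}  P? _         = z≤n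
prefixCount-mono {suc N} P? z≤n       = z≤n
prefixCount-mono {suc N} P? (s≤s x≤y) = +-monoʳ-≤ (indicator (P? zero)) (prefixCount-mono (P? ∘ suc) x≤y)

prefixCount-lipschitz : ∀ {N} {P : Fin N → Set} (P? : ∀ i → Dec (P i)) {x y} → x ≤ y →
                        prefixCount P? y ≤ prefixCount P? x + (y ∸ x)
prefixCount-lipschitz {zero}  P? _ = z≤n
prefixCount-lipschitz {suc N} P? {zero} {zero}  z≤n = z≤n
prefixCount-lipschitz {suc N} P? {zero} {suc y} z≤n =
  +-mono-≤ (indicator≤1 (P? zero)) (≤-trans (prefixCount-lipschitz (P? ∘ suc) {0} {y} z≤n) (lemma N))
  where
  lemma : ∀ N {P : Fin N → Set} {P? : ∀ i → Dec (P i)} → prefixCount P? 0 + y ≤ y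
  lemma zero    = ≤-refl
  lemma (suc N) = ≤-refl
prefixCount-lipschitz {suc N} P? (s≤s {x} {y} x≤y) = begin
  indicator (P? zero) + prefixCount (P? ∘ suc) y            ≤⟨ +-monoʳ-≤ _ (prefixCount-lipschitz (P? ∘ suc) x≤y) ⟩
  indicator (P? zero) + (prefixCount (P? ∘ suc) x + (y ∸ x)) ≡⟨ +-assoc (indicator (P? zero)) _ _ ⟨
  indicator (P? zero) + prefixCount (P? ∘ suc) x + (y ∸ x)   ∎
  where open ≤-Reasoning

prefixCount-skip : ∀ {N} {P : Fin N → Set} (P? : ∀ i → Dec (P i)) y → (∀ i → toℕ i ≡ y → ¬ P i) →
                   prefixCount P? (suc y) ≤ prefixCount P? y
prefixCount-skip {zero}  P? y ¬P = z≤n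
prefixCount-skip {suc N} P? (suc y) ¬P = +-monoʳ-≤ (indicator (P? zero))
  (prefixCount-skip (P? ∘ suc) y (λ i e → ¬P (suc i) (cong suc e)))
prefixCount-skip {suc N} P? zero ¬P with P? zero
... | yes p = contradiction p (¬P zero refl)
... | no  _ = lemma N
  where
  lemma : ∀ N {P : Fin N → Set} {P? : ∀ i → Dec (P i)} → prefixCount P? 0 ≤ 0
  lemma zero    = ≤-refl
  lemma (suc N) = ≤-refl

prefixCount-all : ∀ {N} {P : Fin N → Set} (P? : ∀ i → Dec (P i)) {x y} → x ≤ y → y ≤ N →
                  (∀ i → x ≤ toℕ i → toℕ i < y → P i) →
                  prefixCount P? x + y ≤ prefixCount P? y + x
prefixCount-all {zero}  P? z≤n z≤n _ = z≤n
prefixCount-all {suc N} P? {zero} {zero}  _ _ _ = z≤n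
prefixCount-all {suc N} P? {zero} {suc y} _ (s≤s y≤N) all with P? zero
... | no ¬p = contradiction (all zero z≤n (s≤s z≤n)) ¬p
... | yes _ = s≤s (≤-trans (m≤n+m y _) (prefixCount-all (P? ∘ suc) {0} z≤n y≤N (λ i _ i<y → all (suc i) z≤n (s≤s i<y))))
prefixCount-all {suc N} P? {suc x} {suc y} (s≤s x≤y) (s≤s y≤N) all = begin
  p + prefixCount (P? ∘ suc) x + suc y       ≡⟨ shuffle p _ y ⟩
  suc (p + (prefixCount (P? ∘ suc) x + y))
    ≤⟨ s≤s (+-monoʳ-≤ p (prefixCount-all (P? ∘ suc) x≤y y≤N (λ i x≤i i<y → all (suc i) (s≤s x≤i) (s≤s i<y)))) ⟩
  suc (p + (prefixCount (P? ∘ suc) y + x))   ≡⟨ shuffle p _ x ⟨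
  p + prefixCount (P? ∘ suc) y + suc x       ∎
  where
  open ≤-Reasoning
  p = indicator (P? zero)
  shuffle : ∀ p c y → p + c + suc y ≡ suc (p + (c + y))
  shuffle = solve-∀

count-tabulate : ∀ {A : Set} {P : A → Set} (P? : ∀ a → Dec (P a)) {N} (f : Fin N → A) →
                 Vec.count P? (Vec.tabulate f) ≡ prefixCount (P? ∘ f) N
count-tabulate P? {zero}  f = refl
count-tabulate P? {suc N} f with does (P? (f zero))
... | true  = cong suc (count-tabulate P? (f ∘ suc))
... | false = count-tabulate P? (f ∘ suc)

badLength≡prefixCount : ∀ {d s N} α (C : TreeCode d s N) Q →
                        badLength α C Q ≡ prefixCount (onBadPath? α C Q) N
badLength≡prefixCount α C Q = count-tabulate (onBadPath? α C Q) id

Δ-≡ : ∀ {s k} {a b : Fin s} (x y : Vec (Fin s) k) → a ≡ b → Δ (a ∷ x) (b ∷ y) ≡ Δ x y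
Δ-≡ {a = a} {b} x y a≡b with a Fin.≟ b
... | yes _  = refl
... | no a≢b = contradiction a≡b a≢b

-- From bad intervals to agreements of labels

module Agreement (d s : ℕ) where
  open Generating d s

  -- The generating function of the subtree at depth `x` of `Q`. Disjoint intervals along `Q`
  -- multiply their agreement factors into it from below.
  along : ∀ {N} → TreeCode d s N → Node d N → ℕ → ℕ
  along C         Q       zero    = single C
  along leaf      []      (suc x) = 1
  along (node cs) (a ∷ Q) (suc x) = along (proj₂ (lookup cs a)) Q x

  fork≤single : ∀ {N} (cs : Vec (Fin s × TreeCode d s N) d) a b →
                fork (a Fin.≟ b) (lookup cs a) (lookup cs b) ≤ single (node cs)
  fork≤single cs a b = ≤-trans (≤∑-allFin b (λ b → fork (a Fin.≟ b) (lookup cs a) (lookup cs b)))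
    (≤∑-allFin a (λ a → ∑ (allFin d) λ b → fork (a Fin.≟ b) (lookup cs a) (lookup cs b)))

  along-suc≤ : ∀ {N} (C : TreeCode d s N) Q x → along C Q (suc x) ≤ along C Q x
  along-suc≤ leaf      []      zero    = ≤-refl
  along-suc≤ leaf      []      (suc x) = ≤-refl
  along-suc≤ (node cs) (a ∷ Q) (suc x) = along-suc≤ (proj₂ (lookup cs a)) Q x
  along-suc≤ (node cs) (a ∷ Q) zero    with a Fin.≟ a | fork≤single cs a a
  ... | yes _  | le = le
  ... | no a≢a | _  = contradiction refl a≢a

  along-antitone : ∀ {N} (C : TreeCode d s N) Q {x y} → x ≤ y → along C Q y ≤ along C Q x
  along-antitone C Q {x} x≤y = go (≤⇒≤′ x≤y)
    where
    go : ∀ {y} → x ≤′ y → along C Q y ≤ along C Q x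
    go ≤′-refl     = ≤-refl
    go (≤′-step p) = ≤-trans (along-suc≤ C Q _) (go p)

  1≤along : ∀ {N} (C : TreeCode d s N) Q x → 1 ≤ along C Q x
  1≤along leaf      []      zero    = ≤-refl
  1≤along leaf      []      (suc x) = ≤-refl
  1≤along (node cs) (a ∷ Q) zero    = ≤-trans (1≤along (proj₂ (lookup cs a)) Q 0) (along-suc≤ (node cs) (a ∷ Q) 0)
  1≤along (node cs) (a ∷ Q) (suc x) = 1≤along (proj₂ (lookup cs a)) Q x

  mutual
    -- Keep only the summands that follow both paths and drop the side path at depth `h`. Each of
    -- the `g` agreements contributes a factor `1 + s * 1`, which is at least `s`.
    pair-agree : ∀ {N h} (h≤N : h ≤ N) (C C′ : TreeCode d s N) Q v →
      ∃[ g ] g + Δ (W h≤N C (truncate h≤N Q)) (W h≤N C′ v) ≡ h ×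
             s ^ g * along C Q h ≤ single C + pair C C′
    pair-agree z≤n C C′ Q [] = 0 , refl , ≤-trans (≤-reflexive (+-identityʳ _)) (m≤m+n (single C) _)
    pair-agree (s≤s h≤N) (node cs) (node cs′) (a ∷ Q) (b ∷ v) =
      let (g , e , le) = parallel-agree h≤N (lookup cs a) (lookup cs′ b) Q v in
      g , e , ≤-trans le (≤-trans (≤∑-allFin b (λ b → parallel (lookup cs a) (lookup cs′ b)))
        (≤-trans (≤∑-allFin a (λ a → ∑ (allFin d) λ b → parallel (lookup cs a) (lookup cs′ b)))
          (m≤n+m (pair (node cs) (node cs′)) (single (node cs)))))

    parallel-agree : ∀ {N h} (h≤N : h ≤ N) (x x′ : Fin s × TreeCode d s N) Q v →
      ∃[ g ] g + Δ (proj₁ x ∷ W h≤N (proj₂ x) (truncate h≤N Q)) (proj₁ x′ ∷ W h≤N (proj₂ x′) v) ≡ suc h ×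
             s ^ g * along (proj₂ x) Q h ≤ parallel x x′
    parallel-agree {h = h} h≤N (l , C) (l′ , C′) Q v with pair-agree h≤N C C′ Q v | l Fin.≟ l′
    ... | g , e , le | yes l≡l′ = suc g , cong suc e , (begin
      s * s ^ g * along C Q h               ≡⟨ *-assoc s (s ^ g) (along C Q h) ⟩
      s * (s ^ g * along C Q h)             ≤⟨ *-mono-≤ (≤-trans (≤-reflexive (sym (*-identityʳ s))) (n≤1+n (s * 1)))
                                               le ⟩
      (1 + s * 1) * (single C + pair C C′)  ∎)
      where open ≤-Reasoning
    ... | g , e , le | no _ = g , trans (+-suc g _) (cong suc e) , ≤-trans le (m≤m+n (single C + pair C C′) _)

  -- The side path starts with the `fork` at the least common ancestor; above it the two words
  -- coincide.
  branch-agree : ∀ {N h} (h≤N : h ≤ N) (C : TreeCode d s N) Q v →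
    let u = truncate h≤N Q in
    ∃[ g ] lcaDepth u v + (g + Δ (W h≤N C u) (W h≤N C v)) ≡ h ×
           s ^ g * along C Q h ≤ along C Q (lcaDepth u v)
  branch-agree z≤n C Q [] = 0 , refl , ≤-reflexive (+-identityʳ _)
  branch-agree (s≤s h≤N) (node cs) (a ∷ Q) (b ∷ v) with a Fin.≟ b | fork≤single cs a b
  ... | yes refl | _ =
    let (l , C) = lookup cs a
        (g , e , le) = branch-agree h≤N C Q v in
    g , cong suc (trans (cong (λ δ → lcaDepth (truncate h≤N Q) v + (g + δ))
          (Δ-≡ {a = l} (W h≤N C (truncate h≤N Q)) (W h≤N C v) refl)) e) , le
  ... | no _ | fork≤ =
    let (g , e , le) = parallel-agree h≤N (lookup cs a) (lookup cs b) Q v in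
    g , e , ≤-trans le fork≤

  module _ (n : ℕ) (α : ℚ) (bad⇒ : ∀ {N h} (C : TreeCode d s N) (h≤N : h ≤ N) u v → Bad α C h≤N u v →
              n * Δ (W h≤N C u) (W h≤N C v) + (h ∸ lcaDepth u v) < n * (h ∸ lcaDepth u v)) where

    -- By `bad⇒` a bad interval of length ℓ has distance below (1 - 1/n)ℓ, so more than ℓ/n of its
    -- labels agree. Within each of the two disjoint families the agreements multiply up to a
    -- summand of `single C`.
    badLength≤agreement : ∀ {N} (C : TreeCode d s N) Q →
      ∃[ g ] ∃[ g′ ] s ^ g ≤ single C × s ^ g′ ≤ single C × badLength α C Q ≤ n * (g + g′)
    badLength≤agreement {N} C Q =
      let (g , g′ , ≤0 , ≤0′ , le) = two-families (along C Q) count (along-antitone C Q) (1≤along C Q)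
            (λ (h≤N , _) → h≤N) jump covered? (prefixCount-mono bad?) (prefixCount-lipschitz bad?) skip
            N 0 0 ≤-refl (λ _ _ _ _ → z≤n)
      in g , g′ , ≤0 , ≤0′ , ≤-trans (≤-reflexive (badLength≡prefixCount α C Q))
           (≤-trans le (+-monoˡ-≤ _ (count0 N bad?)))
      where
      count0 : ∀ N {P : Fin N → Set} (P? : ∀ i → Dec (P i)) → prefixCount P? 0 ≤ 0
      count0 zero    _ = z≤n
      count0 (suc N) _ = z≤n

      Interval : ℕ → ℕ → Set
      Interval m h = Σ[ h≤N ∈ h ≤ N ] Σ[ v ∈ Node d h ]
        let u = truncate h≤N Q in lcaDepth u v ≡ m × Bad α C h≤N u v

      open Cover N n s Interval
      bad? = onBadPath? α C Q
      count = prefixCount bad?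

      jump : ∀ {m h} → Interval m h → ∃[ g ] h ≤ m + n * g × s ^ g * along C Q h ≤ along C Q m
      jump {h = h} (h≤N , v , refl , bad) = g , (begin
        h                    ≡⟨ e ⟨
        m + (g + δ)          ≤⟨ +-monoʳ-≤ m (<⇒≤ (+-cancelˡ-< (n * δ) _ _ (begin-strict
          n * δ + (g + δ)       ≡⟨ cong (n * δ +_) ℓ≡ ⟨
          n * δ + (h ∸ m)       <⟨ bad⇒ C h≤N (truncate h≤N Q) v bad ⟩
          n * (h ∸ m)           ≡⟨ cong (n *_) (trans ℓ≡ (+-comm g δ)) ⟩
          n * (δ + g)           ≡⟨ *-distribˡ-+ n δ g ⟩
          n * δ + n * g         ∎))) ⟩
        m + n * g            ∎) , proj₂ (proj₂ (branch-agree h≤N C Q v))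
        where
        open ≤-Reasoning
        m = lcaDepth (truncate h≤N Q) v
        g = proj₁ (branch-agree h≤N C Q v)
        e = proj₁ (proj₂ (branch-agree h≤N C Q v))
        δ = Δ (W h≤N C (truncate h≤N Q)) (W h≤N C v)
        ℓ≡ : h ∸ m ≡ g + δ
        ℓ≡ = trans (cong (_∸ m) (sym e)) (m+n∸m≡n m (g + δ))

      covered? : ∀ y h → Dec (Covered y h)
      covered? y h = Dec.map′ (λ (h≤N , v , m≤y , y<h , bad) → _ , m≤y , y<h , h≤N , v , refl , bad)
        (λ { (_ , m≤y , y<h , h≤N , v , refl , bad) → h≤N , v , m≤y , y<h , bad })
        (≤-dec λ h≤N → anyNode? h λ v → (_ ≤? y) ×-dec (y <? h) ×-dec (_ ℚ.<? _))

      skip : ∀ y → (∀ h → ¬ Covered y h) → count (suc y) ≤ count y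
      skip y none = prefixCount-skip bad? y λ { i refl (h , v , m≤i , i<h , bad) →
        none (toℕ h) (_ , m≤i , i<h , Fin.toℕ≤pred[n] h , v , refl , bad) }

-- Rationals

infixl 7 _÷_

_÷_ : ℕ → ∀ n .{{_ : NonZero n}} → ℚ
m ÷ n = ℤ.+ m ℚ./ n

toℚᵘ-÷ : ∀ m n → toℚᵘ (m ÷ suc n) ℚᵘ.≃ mkℚᵘ (ℤ.+ m) n
toℚᵘ-÷ m n = ℚ.toℚᵘ-fromℚᵘ (mkℚᵘ (ℤ.+ m) n)

÷-mono-≤ : ∀ a b m n .{{_ : NonZero m}} .{{_ : NonZero n}} → a * n ≤ b * m → a ÷ m ℚ.≤ b ÷ n
÷-mono-≤ a b m@(suc m-1) n@(suc n-1) h = ℚ.toℚᵘ-cancel-≤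
  (ℚᵘ.≤-respˡ-≃ (ℚᵘ.≃-sym (toℚᵘ-÷ a m-1)) (ℚᵘ.≤-respʳ-≃ (ℚᵘ.≃-sym (toℚᵘ-÷ b n-1))
    (ℚᵘ.*≤* (subst₂ ℤ._≤_ (ℤ.pos-* a n) (ℤ.pos-* b m) (+≤+ h)))))

÷-mono-< : ∀ a b m n .{{_ : NonZero m}} .{{_ : NonZero n}} → a * n < b * m → a ÷ m ℚ.< b ÷ n
÷-mono-< a b m@(suc m-1) n@(suc n-1) h = ℚ.toℚᵘ-cancel-<
  (ℚᵘ.<-respˡ-≃ (ℚᵘ.≃-sym (toℚᵘ-÷ a m-1)) (ℚᵘ.<-respʳ-≃ (ℚᵘ.≃-sym (toℚᵘ-÷ b n-1))
    (ℚᵘ.*<* (subst₂ ℤ._<_ (ℤ.pos-* a n) (ℤ.pos-* b m) (+<+ h)))))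

÷-cancel-≤ : ∀ a b m n .{{_ : NonZero m}} .{{_ : NonZero n}} → a ÷ m ℚ.≤ b ÷ n → a * n ≤ b * m
÷-cancel-≤ a b m@(suc m-1) n@(suc n-1) h = ℤ.drop‿+≤+ (subst₂ ℤ._≤_ (sym (ℤ.pos-* a n)) (sym (ℤ.pos-* b m))
  (ℚᵘ.drop-*≤* (ℚᵘ.≤-respˡ-≃ (toℚᵘ-÷ a m-1) (ℚᵘ.≤-respʳ-≃ (toℚᵘ-÷ b n-1) (ℚ.toℚᵘ-mono-≤ h)))))

÷-cancel-< : ∀ a b m n .{{_ : NonZero m}} .{{_ : NonZero n}} → a ÷ m ℚ.< b ÷ n → a * n < b * m
÷-cancel-< a b m@(suc m-1) n@(suc n-1) h = ℤ.drop‿+<+ (subst₂ ℤ._<_ (sym (ℤ.pos-* a n)) (sym (ℤ.pos-* b m))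
  (ℚᵘ.drop-*<* (ℚᵘ.<-respˡ-≃ (toℚᵘ-÷ a m-1) (ℚᵘ.<-respʳ-≃ (toℚᵘ-÷ b n-1) (ℚ.toℚᵘ-mono-< h)))))

÷-* : ∀ a b m n .{{_ : NonZero m}} .{{_ : NonZero n}} →
      (a ÷ m) ℚ.* (b ÷ n) ≡ _÷_ (a * b) (m * n) {{m*n≢0 m n}}
÷-* a b m@(suc m-1) n@(suc n-1) = ℚ.toℚᵘ-injective (ℚᵘ.≃-trans (ℚ.toℚᵘ-homo-* (a ÷ m) (b ÷ n))
  (ℚᵘ.≃-trans (ℚᵘ.*-cong (toℚᵘ-÷ a m-1) (toℚᵘ-÷ b n-1))
    (ℚᵘ.≃-trans (ℚᵘ.*≡* (cong (ℤ._* ℤ.+ (m * n)) (sym (ℤ.pos-* a b)))) (ℚᵘ.≃-sym (toℚᵘ-÷ (a * b) (pred (m * n)))))))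

÷-+ : ∀ a b m n .{{_ : NonZero m}} .{{_ : NonZero n}} →
      (a ÷ m) ℚ.+ (b ÷ n) ≡ _÷_ (a * n + b * m) (m * n) {{m*n≢0 m n}}
÷-+ a b m@(suc m-1) n@(suc n-1) = ℚ.toℚᵘ-injective (ℚᵘ.≃-trans (ℚ.toℚᵘ-homo-+ (a ÷ m) (b ÷ n))
  (ℚᵘ.≃-trans (ℚᵘ.+-cong (toℚᵘ-÷ a m-1) (toℚᵘ-÷ b n-1))
    (ℚᵘ.≃-trans (ℚᵘ.*≡* (cong (ℤ._* ℤ.+ (m * n)) (trans (cong₂ ℤ._+_ (sym (ℤ.pos-* a n)) (sym (ℤ.pos-* b m)))
        (sym (ℤ.pos-+ (a * n) (b * m))))))
      (ℚᵘ.≃-sym (toℚᵘ-÷ (a * n + b * m) (pred (m * n)))))))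

fromℕ-mono-≤ : ∀ {a b} → a ≤ b → fromℕ a ℚ.≤ fromℕ b
fromℕ-mono-≤ {a} {b} a≤b = ÷-mono-≤ a b 1 1 (*-monoˡ-≤ 1 a≤b)

fromℕ-+ : ∀ a b → fromℕ (a + b) ≡ fromℕ a ℚ.+ fromℕ b
fromℕ-+ a b = sym (trans (÷-+ a b 1 1) (cong fromℕ (cong₂ _+_ (*-identityʳ a) (*-identityʳ b))))

fromℕ-* : ∀ a b → fromℕ (a * b) ≡ fromℕ a ℚ.* fromℕ b
fromℕ-* a b = sym (÷-* a b 1 1)

fromℕ<÷*⇒ : ∀ {a b p} q .{{_ : NonZero q}} → fromℕ a ℚ.< (p ÷ q) ℚ.* fromℕ b → q * a < p * b
fromℕ<÷*⇒ {a} {b} {p} q h = subst₂ _<_ (trans (cong (a *_) (*-identityʳ q)) (*-comm a q)) (*-identityʳ (p * b))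
  (÷-cancel-< a (p * b) 1 (q * 1) {{_}} {{m*n≢0 q 1}} (subst (fromℕ a ℚ.<_) (÷-* p b q 1) h))

⇒fromℕ<÷* : ∀ {a b p} q .{{_ : NonZero q}} → q * a < p * b → fromℕ a ℚ.< (p ÷ q) ℚ.* fromℕ b
⇒fromℕ<÷* {a} {b} {p} q h = subst (fromℕ a ℚ.<_) (sym (÷-* p b q 1))
  (÷-mono-< a (p * b) 1 (q * 1) {{_}} {{m*n≢0 q 1}} (subst₂ _<_ (sym (trans (cong (a *_) (*-identityʳ q)) (*-comm a q)))
    (sym (*-identityʳ (p * b))) h))

-- A positive rational is at least the reciprocal of its denominator. The successor makes the
-- integer at least 2, which keeps 1 minus its reciprocal positive.
1÷suc↧≤ : ∀ ε → 0ℚ ℚ.< ε → 1 ÷ suc (↧ₙ ε) ℚ.≤ ε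
1÷suc↧≤ ε@(mkℚ (ℤ.+ suc n) d-1 _) _ = ℚ.toℚᵘ-cancel-≤ (ℚᵘ.≤-respˡ-≃ (ℚᵘ.≃-sym (toℚᵘ-÷ 1 (suc d-1)))
  (ℚᵘ.*≤* (subst₂ ℤ._≤_ (ℤ.pos-* 1 (suc d-1)) (ℤ.pos-* (suc n) (suc (suc d-1)))
    (+≤+ (*-mono-≤ {1} {suc n} (s≤s z≤n) (n≤1+n (suc d-1)))))))
1÷suc↧≤ (mkℚ (ℤ.+ zero) d-1 _) (ℚ.*<* (+<+ ()))
1÷suc↧≤ (mkℚ ℤ.-[1+ n ] d-1 _) (ℚ.*<* ())

-- This is `e ≤ (1/4 - 1/E) * 2N`, multiplied by `2 * E` and freed of subtraction.
noise-bound : ∀ {ε e} E N .{{_ : NonZero E}} → 1 ÷ E ℚ.≤ ε →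
              fromℕ e ℚ.≤ ((ℤ.+ 1) ℚ./ 4 ℚ.- ε) ℚ.* fromℕ (2 * N) → 2 * E * e + 4 * N ≤ E * N
noise-bound {ε} {e} E N 1/E≤ε h = *-cancelˡ-≤ 2 (begin
  2 * (2 * E * e + 4 * N)               ≡⟨ left E e N ⟩
  (e * (E * 1) + 1 * (2 * N) * 1) * 4
    ≤⟨ ÷-cancel-≤ (e * (E * 1) + 1 * (2 * N) * 1) (2 * N) (1 * (E * 1)) 4
      {{m*n≢0 1 (E * 1) {{_}} {{m*n≢0 E 1}}}}
      (subst₂ ℚ._≤_ eq₁ eq₂ sum≤) ⟩
  2 * N * (1 * (E * 1))                 ≡⟨ right E N ⟩
  2 * (E * N)                           ∎)
  where
  open ≤-Reasoning
  x = fromℕ (2 * N)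
  left : ∀ E e N → 2 * (2 * E * e + 4 * N) ≡ (e * (E * 1) + 1 * (2 * N) * 1) * 4
  left = solve-∀
  right : ∀ E N → 2 * N * (1 * (E * 1)) ≡ 2 * (E * N)
  right = solve-∀
  instance
    x≥0 : ℚ.NonNegative x
    x≥0 = ℚ.nonNegative (fromℕ-mono-≤ {0} {2 * N} z≤n)
    E*1≢0 : NonZero (E * 1)
    E*1≢0 = m*n≢0 E 1
  sum≤ : fromℕ e ℚ.+ (1 ÷ E) ℚ.* x ℚ.≤ (1 ÷ 4) ℚ.* x
  sum≤ = ℚ.≤-trans (ℚ.+-mono-≤ h (ℚ.*-monoʳ-≤-nonNeg x 1/E≤ε)) (ℚ.≤-reflexive
    (trans (sym (ℚ.*-distribʳ-+ x (1 ÷ 4 ℚ.- ε) ε)) (cong (ℚ._* x)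
      (trans (ℚ.+-assoc (1 ÷ 4) (ℚ.- ε) ε) (trans (cong (1 ÷ 4 ℚ.+_) (ℚ.+-inverseˡ ε)) (ℚ.+-identityʳ (1 ÷ 4)))))))
  eq₁ : fromℕ e ℚ.+ (1 ÷ E) ℚ.* x ≡ _÷_ (e * (E * 1) + 1 * (2 * N) * 1) (1 * (E * 1)) {{m*n≢0 1 (E * 1)}}
  eq₁ = trans (cong (fromℕ e ℚ.+_) (÷-* 1 (2 * N) E 1)) (÷-+ e (1 * (2 * N)) 1 (E * 1))
  eq₂ : (1 ÷ 4) ℚ.* x ≡ 2 * N ÷ 4
  eq₂ = trans (÷-* 1 (2 * N) 4 1) (cong (_÷ 4) (*-identityˡ (2 * N)))

-- Polynomials against exponentials

n<2^n : ∀ n → n < 2 ^ n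
n<2^n zero    = s≤s z≤n
n<2^n (suc n) = begin-strict
  suc n            <⟨ s≤s (n<2^n n) ⟩
  suc (2 ^ n)      ≤⟨ +-monoˡ-≤ (2 ^ n) (>-nonZero⁻¹ (2 ^ n) {{m^n≢0 2 n}}) ⟩
  2 ^ n + 2 ^ n    ≡⟨ cong (λ m → 2 ^ n + m) (sym (+-identityʳ (2 ^ n))) ⟩
  2 ^ suc n        ∎
  where open ≤-Reasoning

^-distribʳ-* : ∀ k m n → (m * n) ^ k ≡ m ^ k * n ^ k
^-distribʳ-* zero    m n = refl
^-distribʳ-* (suc k) m n = trans (cong (m * n *_) (^-distribʳ-* k m n)) (interchange m n (m ^ k) (n ^ k))
  where
  interchange : ∀ m n x y → m * n * (x * y) ≡ m * x * (n * y)
  interchange = solve-∀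

-- Induction on the exponent by halving `n`: one factor is absorbed by one half of the exponential,
-- the remaining `m` factors by the other half.
power<exponential : ∀ m C → ∃[ n₀ ] ∀ n → n₀ ≤ n → C * suc n ^ m < 2 ^ n
power<exponential zero C = C , λ n C≤n → begin-strict
  C * 1   ≡⟨ *-identityʳ C ⟩
  C       ≤⟨ C≤n ⟩
  n       <⟨ n<2^n n ⟩
  2 ^ n   ∎
  where open ≤-Reasoning
power<exponential (suc m) C with power<exponential m (C * 2 ^ suc m)
... | k , bound = k + k , λ n k+k≤n →
  let h = ⌊ n /2⌋
      h′ = ⌈ n /2⌉
      k≤h = subst (_≤ h) (sym (n≡⌊n+n/2⌋ k)) (⌊n/2⌋-mono k+k≤n)
      instance _ = m^n≢0 2 h′
  in begin-strict
  C * suc n ^ suc m                       ≡⟨ cong (λ j → C * suc j ^ suc m) (⌊n/2⌋+⌈n/2⌉≡n n) ⟨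
  C * suc (h + h′) ^ suc m                ≤⟨ *-monoʳ-≤ C (^-monoˡ-≤ (suc m) (+-monoʳ-≤ (suc h)
                                              (⌈n/2⌉≤1+⌊n/2⌋ n))) ⟩
  C * (suc h + suc h) ^ suc m             ≡⟨ cong (λ j → C * (suc h + j) ^ suc m) (sym (+-identityʳ (suc h))) ⟩
  C * (2 * suc h) ^ suc m                 ≡⟨ cong (C *_) (^-distribʳ-* (suc m) 2 (suc h)) ⟩
  C * (2 ^ suc m * (suc h * suc h ^ m))   ≡⟨ rearrange C (2 ^ suc m) (suc h) (suc h ^ m) ⟩
  C * 2 ^ suc m * suc h ^ m * suc h       ≤⟨ *-monoʳ-≤ (C * 2 ^ suc m * suc h ^ m)
                                              (≤-trans (n<2^n h) (^-monoʳ-≤ 2 (⌊n/2⌋≤⌈n/2⌉ n))) ⟩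
  C * 2 ^ suc m * suc h ^ m * 2 ^ h′      <⟨ *-monoˡ-< (2 ^ h′) (bound h k≤h) ⟩
  2 ^ h * 2 ^ h′                          ≡⟨ ^-distribˡ-+-* 2 h h′ ⟨
  2 ^ (h + h′)                            ≡⟨ cong (2 ^_) (⌊n/2⌋+⌈n/2⌉≡n n) ⟩
  2 ^ n                                   ∎
  where
  open ≤-Reasoning
  rearrange : ∀ C p x y → C * (p * (x * y)) ≡ C * p * y * x
  rearrange = solve-∀
  ⌈n/2⌉≤1+⌊n/2⌋ : ∀ n → ⌈ n /2⌉ ≤ suc ⌊ n /2⌋
  ⌈n/2⌉≤1+⌊n/2⌋ zero          = z≤n
  ⌈n/2⌉≤1+⌊n/2⌋ (suc zero)    = ≤-refl
  ⌈n/2⌉≤1+⌊n/2⌋ (suc (suc n)) = s≤s (⌈n/2⌉≤1+⌊n/2⌋ n)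

≤fromℕ : ∀ c → ∃[ k ] c ℚ.≤ fromℕ k
≤fromℕ c@(mkℚ (ℤ.+ n) d-1 _) = n , ℚ.toℚᵘ-cancel-≤ (ℚᵘ.≤-respʳ-≃ (ℚᵘ.≃-sym (toℚᵘ-÷ n 0))
  (ℚᵘ.*≤* (subst₂ ℤ._≤_ (ℤ.pos-* n 1) (ℤ.pos-* n (suc d-1)) (+≤+ (*-monoʳ-≤ n (s≤s z≤n))))))
≤fromℕ c@(mkℚ ℤ.-[1+ n ] d-1 _) = 0 , ℚ.<⇒≤ (ℚ.negative⁻¹ c)

eval≤power : ∀ P → ∃[ C ] ∀ n → eval P (fromℕ n) ℚ.≤ fromℕ (C * suc n ^ length P)
eval≤power []      = 0 , λ n → ℚ.≤-refl
eval≤power (c ∷ P) with ≤fromℕ c | eval≤power P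
... | k , c≤k | C , bound = k + C , λ n →
  let instance _ = ℚ.nonNegative (fromℕ-mono-≤ {0} {n} z≤n)
               _ = m^n≢0 (suc n) (length P)
      m = suc n ^ length P
  in ℚ.≤-trans (ℚ.+-mono-≤ c≤k (ℚ.*-monoˡ-≤-nonNeg (fromℕ n) (bound n)))
    (ℚ.≤-trans (ℚ.≤-reflexive (sym (trans (fromℕ-+ k (n * (C * m))) (cong (fromℕ k ℚ.+_) (fromℕ-* n (C * m))))))
      (fromℕ-mono-≤ (begin
        k + n * (C * m)                  ≤⟨ +-mono-≤ (m≤m*n k (suc n * m) {{m*n≢0 (suc n) m}})
                                              (*-monoˡ-≤ (C * m) (n≤1+n n)) ⟩
        k * (suc n * m) + suc n * (C * m) ≡⟨ collect k C (suc n) m ⟩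
        (k + C) * (suc n * m)             ∎)))
  where
  open ≤-Reasoning
  collect : ∀ k C x m → k * (x * m) + x * (C * m) ≡ (k + C) * (x * m)
  collect = solve-∀

2^-nonZero : ∀ n → NonZero (2 ^ n)
2^-nonZero n = m^n≢0 2 n

negligible-1/2^n : Negligible (λ n → _÷_ 1 (2 ^ n) {{2^-nonZero n}})
negligible-1/2^n P with eval≤power P
... | C , ≤power with power<exponential (length P) C
... | n₀ , power< = n₀ , λ n n₀≤n _ → let M = C * suc n ^ length P in
  ℚ.≤-<-trans
    (ℚ.*-monoˡ-≤-nonNeg (_÷_ 1 (2 ^ n) {{2^-nonZero n}})
      {{ℚ.nonNegative (÷-mono-≤ 0 1 1 (2 ^ n) {{_}} {{2^-nonZero n}} z≤n)}} (≤power n))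
    (subst (ℚ._< 1ℚ) (sym (÷-* 1 M (2 ^ n) 1 {{2^-nonZero n}}))
      (÷-mono-< (1 * M) 1 (2 ^ n * 1) 1 {{m*n≢0 (2 ^ n) 1 {{2^-nonZero n}}}}
        (subst₂ _<_ (sym (trans (*-identityʳ (1 * M)) (*-identityˡ M)))
          (sym (trans (*-identityˡ (2 ^ n * 1)) (*-identityʳ (2 ^ n)))) (power< n n₀≤n))))

-- Windows of decoding errors

-- After i rounds, p i is the progress, G i the number of hits and m i the round
-- up to which both players decode correctly.  Going back from round i, either
-- p (m i) = p i and the round is a hit, or a window reaches back to m i.  In
-- the second case it crosses a step of progress, so that the one round that it
-- leaves unaccounted for can be charged to p.

module Accounting (n K N : ℕ) (p G Ψ m : ℕ → ℕ)
  (p-mono : ∀ {i j} → i ≤ j → p i ≤ p j) (G-mono : ∀ {i j} → i ≤ j → G i ≤ G j)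
  (Ψ-mono : ∀ {i j} → i ≤ j → Ψ i ≤ Ψ j)
  (m≤ : ∀ i → m i ≤ i)
  (window : ∀ i → i ≤ N → n * i + Ψ (m i) ≤ n * m i + Ψ i)
  (hit : ∀ i → i < N → p (m i) ≡ p i → p i < K → suc (G i) ≤ G (suc i)) where

  open ≤-Reasoning

  back : ∀ i → i ≤ N → n * m i ≤ Ψ (m i) + n * (p (m i) + G (m i)) → n * i ≤ Ψ i + n * (p (m i) + G (m i))
  back i i≤N ih = +-cancelʳ-≤ (Ψ (m i)) _ _ (begin
    n * i + Ψ (m i)                                ≤⟨ window i i≤N ⟩
    n * m i + Ψ i                                  ≤⟨ +-monoˡ-≤ (Ψ i) ih ⟩
    Ψ (m i) + n * (p (m i) + G (m i)) + Ψ i        ≡⟨ rotate (Ψ (m i)) _ (Ψ i) ⟩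
    Ψ i + n * (p (m i) + G (m i)) + Ψ (m i)        ∎)
    where
    rotate : ∀ a b c → a + b + c ≡ c + b + a
    rotate = solve-∀

  bound : ∀ i → i ≤ N → p i < K → n * i ≤ Ψ i + n * (p i + G i)
  bound = <-rec _ go
    where
    go : ∀ i → (∀ {j} → j < i → j ≤ N → p j < K → n * j ≤ Ψ j + n * (p j + G j)) →
         i ≤ N → p i < K → n * i ≤ Ψ i + n * (p i + G i)
    go zero    _  _    _   = ≤-trans (≤-reflexive (*-zeroʳ n)) z≤n
    go (suc i) ih i<N  p<K with p (m i) ≟ p i
    ... | yes same = begin
      n * suc i                     ≡⟨ *-suc n i ⟩
      n + n * i                     ≤⟨ +-monoʳ-≤ n (ih ≤-refl (<⇒≤ i<N) pᵢ<K) ⟩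
      n + (Ψ i + n * (p i + G i))   ≡⟨ shuffle n (Ψ i) (p i) (G i) ⟩
      Ψ i + n * (p i + suc (G i))
        ≤⟨ +-mono-≤ (Ψ-mono (n≤1+n i)) (*-monoʳ-≤ n (+-mono-≤ (p-mono (n≤1+n i)) (hit i i<N same pᵢ<K))) ⟩
      Ψ (suc i) + n * (p (suc i) + G (suc i)) ∎
      where
      pᵢ<K = ≤-<-trans (p-mono (n≤1+n i)) p<K
      shuffle : ∀ n a b c → n + (a + n * (b + c)) ≡ a + n * (b + suc c)
      shuffle = solve-∀
    ... | no  diff = begin
      n * suc i                               ≡⟨ *-suc n i ⟩
      n + n * i                               ≤⟨ +-monoʳ-≤ n (back i (<⇒≤ i<N)
          (ih (s≤s (m≤ i)) (≤-trans (m≤ i) (<⇒≤ i<N)) (≤-<-trans (p-mono (≤-trans (m≤ i) (n≤1+n i))) p<K))) ⟩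
      n + (Ψ i + n * (p (m i) + G (m i)))     ≡⟨ shuffle n (Ψ i) (p (m i)) (G (m i)) ⟩
      Ψ i + n * (suc (p (m i)) + G (m i))
        ≤⟨ +-mono-≤ (Ψ-mono (n≤1+n i)) (*-monoʳ-≤ n (+-mono-≤
             (≤-trans (≤∧≢⇒< (p-mono (m≤ i)) diff) (p-mono (n≤1+n i))) (G-mono (≤-trans (m≤ i) (n≤1+n i))))) ⟩
      Ψ (suc i) + n * (p (suc i) + G (suc i)) ∎
      where
      shuffle : ∀ n a b c → n + (a + n * (b + c)) ≡ a + n * (suc b + c)
      shuffle = solve-∀

  final : (∀ i → p i ≤ K) → ¬ (p (m N) ≡ p N × p N ≡ K) → n * N ≤ Ψ N + n * (K + G N)
  final p≤K fails with p N ≟ K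
  ... | no p≢K = ≤-trans (bound N ≤-refl (≤∧≢⇒< (p≤K N) p≢K)) (+-monoʳ-≤ (Ψ N) (*-monoʳ-≤ n (+-monoˡ-≤ (G N) (p≤K N))))
  -- All progress is made, but some of it only after round `m N`. There `bound` still applies, and
  -- one window covers the rest.
  ... | yes p≡K = ≤-trans (back N ≤-refl (bound (m N) (m≤ N) (<-≤-trans pₘ<p (p≤K N))))
      (+-monoʳ-≤ (Ψ N) (*-monoʳ-≤ n (+-mono-≤ (p≤K (m N)) (G-mono (m≤ N)))))
    where pₘ<p = ≤∧≢⇒< (p-mono (m≤ N)) (λ e → fails (e , p≡K))

-- Errors of nearest-node decoding

argmin : ∀ {n} (f : Fin (suc n) → ℕ) → ∃[ i ] ∀ j → f i ≤ f j
argmin {zero}  f = zero , λ { zero → ≤-refl }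
argmin {suc n} f with argmin (f ∘ suc)
... | i , min with f zero ≤? f (suc i)
... | yes z≤i = zero , λ { zero → ≤-refl ; (suc j) → ≤-trans z≤i (min j) }
... | no  z≰i = suc i , λ { zero → <⇒≤ (≰⇒> z≰i) ; (suc j) → min j }

argminNode : ∀ {d} k .{{_ : NonZero d}} (f : Node d k → ℕ) → ∃[ u ] ∀ v → f u ≤ f v
argminNode         zero    f = [] , λ { [] → ≤-refl }
argminNode {suc d} (suc k) f =
  let best a = argminNode k (f ∘ (a ∷_))
      (a , min) = argmin (λ a → f (a ∷ proj₁ (best a)))
  in a ∷ proj₁ (best a) , λ { (b ∷ v) → ≤-trans (min b) (proj₂ (best b) v) }

errors : ∀ {s N} → Vec (Fin s) N → Vec (Fin s) N → ℕ → ℕ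
errors []      []      j       = 0
errors (a ∷ x) (b ∷ y) zero    = 0
errors (a ∷ x) (b ∷ y) (suc j) = indicator (¬? (a Fin.≟ b)) + errors x y j

Δ-∷ : ∀ {s k} (a b : Fin s) (x y : Vec (Fin s) k) → Δ (a ∷ x) (b ∷ y) ≡ indicator (¬? (a Fin.≟ b)) + Δ x y
Δ-∷ a b x y with a Fin.≟ b
... | yes _ = refl
... | no  _ = refl

errors-truncate : ∀ {s k N} (k≤N : k ≤ N) (x y : Vec (Fin s) N) → errors x y k ≡ Δ (truncate k≤N x) (truncate k≤N y)
errors-truncate z≤n       []      []      = refl
errors-truncate z≤n       (a ∷ x) (b ∷ y) = refl
errors-truncate (s≤s k≤N) (a ∷ x) (b ∷ y) = trans (cong (_ +_) (errors-truncate k≤N x y))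
  (sym (Δ-∷ a b (truncate k≤N x) (truncate k≤N y)))

errors-all : ∀ {s N} (x y : Vec (Fin s) N) → errors x y N ≡ Δ x y
errors-all []      []      = refl
errors-all (a ∷ x) (b ∷ y) = trans (cong (_ +_) (errors-all x y)) (sym (Δ-∷ a b x y))

errors-mono : ∀ {s N} (x y : Vec (Fin s) N) {i j} → i ≤ j → errors x y i ≤ errors x y j
errors-mono []      []      _         = z≤n
errors-mono (a ∷ x) (b ∷ y) z≤n       = z≤n
errors-mono (a ∷ x) (b ∷ y) (s≤s i≤j) = +-monoʳ-≤ _ (errors-mono x y i≤j)

errors-≤-truncate : ∀ {s k N} (k≤N : k ≤ N) (x y : Vec (Fin s) N) {j} → j ≤ k →
                    errors (truncate k≤N x) (truncate k≤N y) j ≡ errors x y j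
errors-≤-truncate z≤n       []      []      z≤n       = refl
errors-≤-truncate z≤n       (a ∷ x) (b ∷ y) z≤n       = refl
errors-≤-truncate (s≤s k≤N) (a ∷ x) (b ∷ y) z≤n       = refl
errors-≤-truncate (s≤s k≤N) (a ∷ x) (b ∷ y) (s≤s j≤k) = cong (_ +_) (errors-≤-truncate k≤N x y j≤k)

Δ-triangle : ∀ {s k} (x y r : Vec (Fin s) k) → Δ x y ≤ Δ x r + Δ y r
Δ-triangle []      []      []      = z≤n
Δ-triangle (a ∷ x) (b ∷ y) (c ∷ r) rewrite Δ-∷ a b x y | Δ-∷ a c x r | Δ-∷ b c y r =
  ≤-trans (+-mono-≤ δ (Δ-triangle x y r)) (≤-reflexive (interchange (indicator (¬? (a Fin.≟ c))) _ _ _))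
  where
  interchange : ∀ a b c d → a + b + (c + d) ≡ a + c + (b + d)
  interchange = solve-∀
  δ : indicator (¬? (a Fin.≟ b)) ≤ indicator (¬? (a Fin.≟ c)) + indicator (¬? (b Fin.≟ c))
  δ with a Fin.≟ b | a Fin.≟ c | b Fin.≟ c
  ... | yes _  | _        | _        = z≤n
  ... | no _   | no _     | _        = s≤s z≤n
  ... | no _   | yes _    | no _     = s≤s z≤n
  ... | no a≢b | yes refl | yes refl = contradiction refl a≢b

lcaDepth≤ : ∀ {d k} (u v : Node d k) → lcaDepth u v ≤ k
lcaDepth≤ []      []      = z≤n
lcaDepth≤ (a ∷ u) (b ∷ v) with a Fin.≟ b
... | yes _ = s≤s (lcaDepth≤ u v)
... | no  _ = z≤n

-- Errors above the branching point affect `u` and `v` alike and cancel; below it the triangle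
-- inequality through `r` applies. So at least half of the distance is made up by errors after the
-- branching point.
decoding-errors : ∀ {d s k N} (k≤N : k ≤ N) (C : TreeCode d s N) (u v : Node d k) r →
  Δ (W k≤N C v) r ≤ Δ (W k≤N C u) r →
  Δ (W k≤N C u) (W k≤N C v) + 2 * errors (W k≤N C u) r (lcaDepth u v) ≤ 2 * Δ (W k≤N C u) r
decoding-errors z≤n       C         []      []      []      _ = z≤n
decoding-errors (s≤s k≤N) (node cs) (a ∷ u) (b ∷ v) (c ∷ r) near with a Fin.≟ b
... | yes refl = begin
  Δ (l ∷ x) (l ∷ y) + 2 * (δ + errors x r m)   ≡⟨ cong (_+ 2 * (δ + errors x r m)) (Δ-≡ {a = l} x y refl) ⟩
  Δ x y + 2 * (δ + errors x r m)               ≡⟨ shuffle (Δ x y) δ (errors x r m) ⟩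
  2 * δ + (Δ x y + 2 * errors x r m)
    ≤⟨ +-monoʳ-≤ (2 * δ) (decoding-errors k≤N C u v r
         (+-cancelˡ-≤ δ _ _ (subst₂ _≤_ (Δ-∷ l c y r) (Δ-∷ l c x r) near))) ⟩
  2 * δ + 2 * Δ x r                            ≡⟨ *-distribˡ-+ 2 δ (Δ x r) ⟨
  2 * (δ + Δ x r)                              ≡⟨ cong (2 *_) (Δ-∷ l c x r) ⟨
  2 * Δ (l ∷ x) (c ∷ r)                        ∎
  where
  open ≤-Reasoning
  l = proj₁ (lookup cs a)
  C = proj₂ (lookup cs a)
  x = W k≤N C u
  y = W k≤N C v
  m = lcaDepth u v
  δ = indicator (¬? (l Fin.≟ c))
  shuffle : ∀ a b c → a + 2 * (b + c) ≡ 2 * b + (a + 2 * c)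
  shuffle = solve-∀
... | no _ = begin
  Δ x y + 0        ≡⟨ +-identityʳ _ ⟩
  Δ x y            ≤⟨ Δ-triangle x y (c ∷ r) ⟩
  Δ x (c ∷ r) + Δ y (c ∷ r)   ≤⟨ +-monoʳ-≤ (Δ x (c ∷ r)) (≤-trans near (≤-reflexive (sym (+-identityʳ _)))) ⟩
  2 * Δ x (c ∷ r)  ∎
  where
  open ≤-Reasoning
  x = W (s≤s k≤N) (node cs) (a ∷ u)
  y = W (s≤s k≤N) (node cs) (b ∷ v)

W-truncate : ∀ {d s k N} (k≤N : k ≤ N) (C : TreeCode d s N) Q → truncate k≤N (W ≤-refl C Q) ≡ W k≤N C (truncate k≤N Q)
W-truncate z≤n       C         Q       = refl
W-truncate (s≤s k≤N) (node cs) (a ∷ Q) = cong (_ ∷_) (W-truncate k≤N _ Q)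

onBadPath : ∀ {d s N} (α : ℚ) (C : TreeCode d s N) Q {h} (h≤N : h ≤ N) v → Bad α C h≤N (truncate h≤N Q) v →
            ∀ i → lcaDepth (truncate h≤N Q) v ≤ toℕ i → toℕ i < h → OnBadPath α C Q i
onBadPath {d} {s} {N} α C Q {h} h≤N = subst Goal (Fin.toℕ-fromℕ< (s≤s h≤N)) (λ p v bad i m≤i i<h → h′ , v ,
    subst (λ p → lcaDepth (truncate p Q) v ≤ toℕ i × toℕ i < toℕ h′ × Bad α C p (truncate p Q) v)
      (≤-irrelevant p (Fin.toℕ≤pred[n] h′)) (m≤i , i<h , bad)) h≤N
  where
  h′ = fromℕ< (s≤s h≤N)
  Goal : ℕ → Set
  Goal h = (p : h ≤ N) (v : Node d h) → Bad α C p (truncate p Q) v →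
           ∀ i → lcaDepth (truncate p Q) v ≤ toℕ i → toℕ i < h → OnBadPath α C Q i

module _ (n : ℕ) (α : ℚ)
  (¬bad⇒ : ∀ {d s N h} (C : TreeCode d s N) (h≤N : h ≤ N) u v → ¬ Bad α C h≤N u v →
           n * (h ∸ lcaDepth u v) ≤ n * Δ (W h≤N C u) (W h≤N C v) + (h ∸ lcaDepth u v)) where

  -- With ℓ = i - m this says that nℓ is at most ℓ plus 2n times the errors plus n times the bad
  -- arcs of the window. If the pair is bad, all ℓ arcs are bad; otherwise its distance is at least
  -- (1 - 1/n)ℓ, and `decoding-errors` applies.
  decoding-window : ∀ {d s N} (C : TreeCode d s N) Q r {i} (i≤N : i ≤ N) (v : Node d i) →
    Δ (W i≤N C v) (truncate i≤N r) ≤ Δ (W i≤N C (truncate i≤N Q)) (truncate i≤N r) →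
    let m = lcaDepth (truncate i≤N Q) v
        e = errors (W ≤-refl C Q) r
        b = prefixCount (onBadPath? α C Q)
    in n * i + (m + 2 * n * e m + n * b m) ≤ n * m + (i + 2 * n * e i + n * b i)
  decoding-window C Q r {i} i≤N v near = go (_ ℚ.<? _)
    where
    open ≤-Reasoning
    u = truncate i≤N Q
    m = lcaDepth u v
    m≤i = lcaDepth≤ u v
    ℓ = i ∸ m
    sent = W ≤-refl C Q
    e = errors sent r
    b = prefixCount (onBadPath? α C Q)
    δ = Δ (W i≤N C u) (W i≤N C v)
    δ≤ : δ + 2 * e m ≤ 2 * e i
    δ≤ = subst₂ (λ a b → δ + 2 * a ≤ 2 * b)
      (trans (cong (λ x → errors x (truncate i≤N r) m) (sym (W-truncate i≤N C Q)))
             (errors-≤-truncate i≤N sent r m≤i))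
      (trans (cong (λ x → Δ x (truncate i≤N r)) (sym (W-truncate i≤N C Q)))
             (sym (errors-truncate i≤N sent r)))
      (decoding-errors i≤N C u v (truncate i≤N r) near)
    regroup : ∀ n i a b → n * i + (a + n * b) ≡ n * (b + i) + a
    regroup = solve-∀
    shuffle : ∀ n m ℓ e b → n * (m + ℓ) + (m + 2 * n * e + n * b) ≡ n * ℓ + (n * m + m + n * (2 * e) + n * b)
    shuffle = solve-∀
    shuffle′ : ∀ n δ ℓ m e b →
      n * δ + ℓ + (n * m + m + n * (2 * e) + n * b) ≡ n * (δ + 2 * e) + (n * m + (m + ℓ) + n * b)
    shuffle′ = solve-∀
    shuffle″ : ∀ n e m i b → n * (2 * e) + (n * m + i + n * b) ≡ n * m + (i + 2 * n * e + n * b)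
    shuffle″ = solve-∀

    go : Dec (Bad α C i≤N u v) → n * i + (m + 2 * n * e m + n * b m) ≤ n * m + (i + 2 * n * e i + n * b i)
    go (yes bad) = begin
      n * i + (m + 2 * n * e m + n * b m)    ≡⟨ regroup n i (m + 2 * n * e m) (b m) ⟩
      n * (b m + i) + (m + 2 * n * e m)
        ≤⟨ +-mono-≤ (*-monoʳ-≤ n (prefixCount-all (onBadPath? α C Q) m≤i i≤N (onBadPath α C Q i≤N v bad)))
             (+-mono-≤ m≤i (*-monoʳ-≤ (2 * n) (errors-mono sent r m≤i))) ⟩
      n * (b i + m) + (i + 2 * n * e i)      ≡⟨ regroup n m (i + 2 * n * e i) (b i) ⟨
      n * m + (i + 2 * n * e i + n * b i)    ∎
    go (no ¬bad) = begin
      n * i + (m + 2 * n * e m + n * b m)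
        ≡⟨ cong (λ j → n * j + (m + 2 * n * e m + n * b m)) (m+[n∸m]≡n m≤i) ⟨
      n * (m + ℓ) + (m + 2 * n * e m + n * b m)   ≡⟨ shuffle n m ℓ (e m) (b m) ⟩
      n * ℓ + (n * m + m + n * (2 * e m) + n * b m)
        ≤⟨ +-monoˡ-≤ _ (¬bad⇒ C i≤N u v ¬bad) ⟩
      n * δ + ℓ + (n * m + m + n * (2 * e m) + n * b m)   ≡⟨ shuffle′ n δ ℓ m (e m) (b m) ⟩
      n * (δ + 2 * e m) + (n * m + (m + ℓ) + n * b m)
        ≤⟨ +-mono-≤ (*-monoʳ-≤ n δ≤) (+-monoʳ-≤ (n * m + (m + ℓ))
             (*-monoʳ-≤ n (prefixCount-mono (onBadPath? α C Q) m≤i))) ⟩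
      n * (2 * e i) + (n * m + (m + ℓ) + n * b i)
        ≡⟨ cong (λ j → n * (2 * e i) + (n * m + j + n * b i)) (m+[n∸m]≡n m≤i) ⟩
      n * (2 * e i) + (n * m + i + n * b i)         ≡⟨ shuffle″ n (e i) m i (b i) ⟩
      n * m + (i + 2 * n * e i + n * b i)    ∎

-- The simulation

truthful-swap-swap : ∀ {XA XB T} (π : Protocol XA XB T) x y t →
                     Truthful π x y t → Truthful (swap (swap π)) x y t
truthful-swap-swap end         x y (pending w)         h       = h
truthful-swap-swap end         x y (announced z l r)   h       = h
truthful-swap-swap (alice b π) x y (pending w)         h       = h
truthful-swap-swap (alice b π) x y t@(announced z l r) (e , h) = e , truthful-swap-swap (π (b x)) x y (child (b x) t) h
truthful-swap-swap (bob b π)   x y (pending w)         h       = h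
truthful-swap-swap (bob b π)   x y t@(announced z l r) h       = truthful-swap-swap (π (b y)) x y (child (b y) t) h

indicator-yes : ∀ {P : Set} (p? : Dec P) → P → indicator p? ≡ 1
indicator-yes (yes _) p = refl
indicator-yes (no ¬p) p = contradiction p ¬p

+-≡-≤ : ∀ {a b c d} → a ≤ c → b ≤ d → a + b ≡ c + d → a ≡ c × b ≡ d
+-≡-≤ {a} {b} {c} {d} a≤c b≤d e =
  ≤-antisym a≤c (+-cancelʳ-≤ d c a (≤-trans (≤-reflexive (sym e)) (+-monoʳ-≤ a b≤d))) ,
  ≤-antisym b≤d (+-cancelˡ-≤ c d b (≤-trans (≤-reflexive (sym e)) (+-monoˡ-≤ b a≤c)))

module Simulation (D : ℕ) .{{_ : NonZero D}} (s : ℕ) where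
  open Player D
  open Honest D

  instance
    D*3≢0 : NonZero (D * 3)
    D*3≢0 = m*n≢0 D 3

  -- A user reconstructs her own tree by replaying her choices; `f j` is the path inferred for round
  -- `j`.
  ownTree : ∀ k → (Fin k → List Bool) → Tree
  ownTree zero    f = start
  ownTree (suc k) f = let t = ownTree k (f ∘ inject₁) in update t (symbol t (f (Fin.fromℕ k)))

  module _ {XA XB : Set} {T : ℕ} (π : Protocol XA XB T) (x : XA) where

    inferred : ∀ {k} → View (D * 3) k → Fin (suc k) → List Bool
    inferred view j = follow π x (run start (view j))

    strategy : ∀ k → View (D * 3) k → Fin (D * 3)
    strategy k view = symbol (ownTree k (inferred view ∘ inject₁)) (inferred view (Fin.fromℕ k))

    output : ∀ {k} → View (D * 3) k → Vec Bool T
    output view = pad T (inferred view (Fin.fromℕ _))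

    -- One user's run expressed through her beliefs: `believed i` stands for the other user's tree
    -- as decoded after `i` symbols.
    module Side (believed : ℕ → Tree) where

      path : ℕ → List Bool
      path i = follow π x (believed i)

      tree : ℕ → Tree
      tree zero    = start
      tree (suc i) = update (tree i) (symbol (tree i) (path i))

      tree-truthful : ∀ y i → Truthful π x y (tree i)
      tree-truthful y zero    = tt
      tree-truthful y (suc i) = subst (Truthful π x y) (sym (update-symbol (tree i) (path i)))
        (truthful-choose π x y (believed i) (tree i) (tree-truthful y i))

      tree-⊑ : ∀ {i j} → i ≤ j → tree i ⊑ tree j
      tree-⊑ i≤j = go (≤⇒≤′ i≤j)
        where
        go : ∀ {i j} → i ≤′ j → tree i ⊑ tree j
        go ≤′-refl     = ⊑-refl
        go (≤′-step {j} p) = ⊑-trans (go p) (⊑-act (tree j) (Fin.remQuot 3 (symbol (tree j) (path j))))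

      ownTree≡tree : ∀ k (f : Fin k → List Bool) → (∀ j → f j ≡ path (toℕ j)) → ownTree k f ≡ tree k
      ownTree≡tree zero    f f≡ = refl
      ownTree≡tree (suc k) f f≡ = cong₂ (λ t q → update t (symbol t q))
        (ownTree≡tree k (f ∘ inject₁) (λ j → trans (f≡ (inject₁ j)) (cong path (Fin.toℕ-inject₁ j))))
        (trans (f≡ (Fin.fromℕ k)) (cong path (Fin.toℕ-fromℕ k)))

      strategy≡symbol : ∀ k (view : View (D * 3) k) → (∀ j → run start (view j) ≡ believed (toℕ j)) →
                        strategy k view ≡ symbol (tree k) (path k)
      strategy≡symbol k view v≡ = cong₂ symbol
        (ownTree≡tree k _ (λ j → trans (f≡ (inject₁ j)) (cong path (Fin.toℕ-inject₁ j))))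
        (trans (f≡ (Fin.fromℕ k)) (cong path (Fin.toℕ-fromℕ k)))
        where
        f≡ : ∀ j → inferred view j ≡ path (toℕ j)
        f≡ j = cong (follow π x) (v≡ j)

  runPrefix : ∀ {N} → ℕ → Tree → Node (D * 3) N → Tree
  runPrefix zero    t u       = t
  runPrefix (suc j) t []      = t
  runPrefix (suc j) t (a ∷ u) = runPrefix j (update t a) u

  runPrefix-tabulate : ∀ {j} N (t : ℕ → Tree) (a : ℕ → Fin (D * 3)) → (∀ i → t (suc i) ≡ update (t i) (a i)) →
                       j ≤ N → runPrefix j (t 0) (tabulate {n = N} (a ∘ toℕ)) ≡ t j
  runPrefix-tabulate N       t a t≡ z≤n       = refl
  runPrefix-tabulate (suc N) t a t≡ (s≤s {j} j≤N) = trans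
    (cong (λ t → runPrefix j t (tabulate {n = N} (a ∘ suc ∘ toℕ))) (sym (t≡ 0)))
    (runPrefix-tabulate N (t ∘ suc) (a ∘ suc) (t≡ ∘ suc) j≤N)

  -- The decoded node shares its first steps with the true one, and later steps, right or wrong,
  -- only add announcements.
  runPrefix-lca-⊑ : ∀ {k N} (k≤N : k ≤ N) t u (v : Node (D * 3) k) →
                    runPrefix (lcaDepth (truncate k≤N u) v) t u ⊑ run t v
  runPrefix-lca-⊑ z≤n       t u       []      = ⊑-refl
  runPrefix-lca-⊑ (s≤s k≤N) t (a ∷ u) (b ∷ v) with a Fin.≟ b
  ... | yes refl = runPrefix-lca-⊑ k≤N (update t a) u v
  ... | no  _    = ⊑-run t (b ∷ v)

  simulation : ∀ {XA XB T} → Protocol XA XB T → ∀ N → TreeCodeProtocol XA XB (D * 3) s N T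
  simulation π N = record
    { decode  = λ {k} k≤N C r → proj₁ (argminNode k λ v → Δ (W k≤N C v) r)
    ; nearest = λ {k} k≤N C r → proj₂ (argminNode k λ v → Δ (W k≤N C v) r)
    ; stepA   = strategy π
    ; stepB   = strategy (swap π)
    ; outA    = λ x → output π x
    ; outB    = λ x → output (swap π) x
    }

  -- Executions with given delivered strings

  module Execution {XA XB : Set} {T : ℕ} (π : Protocol XA XB T) (N : ℕ) (C : TreeCode (D * 3) s N)
    (n : ℕ) (α : ℚ)
    (¬bad⇒ : ∀ {d s N h} (C : TreeCode d s N) (h≤N : h ≤ N) u v → ¬ Bad α C h≤N u v →
             n * (h ∸ lcaDepth u v) ≤ n * Δ (W h≤N C u) (W h≤N C v) + (h ∸ lcaDepth u v)) where

    open TreeCodeProtocol (simulation π N)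

    belief : Vec (Fin s) N → ℕ → Tree
    belief r i with i ≤? N
    ... | yes i≤N = run start (decode i≤N C (truncate i≤N r))
    ... | no  _   = start

    belief-≤ : ∀ r {i} (i≤N : i ≤ N) → belief r i ≡ run start (decode i≤N C (truncate i≤N r))
    belief-≤ r {i} i≤N with i ≤? N
    ... | yes p   = cong (λ p → run start (decode p C (truncate p r))) (≤-irrelevant p i≤N)
    ... | no  i≰N = contradiction i≤N i≰N

    module Link (Q : Node (D * 3) N) (r : Vec (Fin s) N) where

      agreed : ℕ → ℕ
      agreed i with i ≤? N
      ... | yes i≤N = lcaDepth (truncate i≤N Q) (decode i≤N C (truncate i≤N r))
      ... | no  _   = 0

      agreed-≤ : ∀ {i} (i≤N : i ≤ N) → agreed i ≡ lcaDepth (truncate i≤N Q) (decode i≤N C (truncate i≤N r))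
      agreed-≤ {i} i≤N with i ≤? N
      ... | yes p   = cong (λ p → lcaDepth (truncate p Q) (decode p C (truncate p r))) (≤-irrelevant p i≤N)
      ... | no  i≰N = contradiction i≤N i≰N

      agreed≤ : ∀ i → agreed i ≤ i
      agreed≤ i with i ≤? N
      ... | yes i≤N = lcaDepth≤ (truncate i≤N Q) (decode i≤N C (truncate i≤N r))
      ... | no  _   = z≤n

      sent : Vec (Fin s) N
      sent = W ≤-refl C Q

      damage : ℕ → ℕ
      damage i = 2 * n * errors sent r i + n * prefixCount (onBadPath? α C Q) i

      damage-mono : ∀ {i j} → i ≤ j → damage i ≤ damage j
      damage-mono i≤j = +-mono-≤ (*-monoʳ-≤ (2 * n) (errors-mono sent r i≤j))
                                 (*-monoʳ-≤ n (prefixCount-mono (onBadPath? α C Q) i≤j))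

      window : ∀ i → i ≤ N → n * i + (agreed i + damage (agreed i)) ≤ n * agreed i + (i + damage i)
      window i i≤N = subst (λ m → n * i + (m + damage m) ≤ n * m + (i + damage i)) (sym (agreed-≤ i≤N))
        (subst₂ (λ a b → n * i + a ≤ n * m + b) (+-assoc m (2 * n * errors sent r m) _)
          (+-assoc i (2 * n * errors sent r i) _)
          (decoding-window n α ¬bad⇒ C Q r i≤N v
            (nearest i≤N C (truncate i≤N r) (truncate i≤N Q))))
        where
        v = decode i≤N C (truncate i≤N r)
        m = lcaDepth (truncate i≤N Q) v

      belief-⊒ : ∀ {i} → i ≤ N → runPrefix (agreed i) start Q ⊑ belief r i
      belief-⊒ i≤N = subst₂ (λ m s → runPrefix m start Q ⊑ s) (sym (agreed-≤ i≤N)) (sym (belief-≤ r i≤N))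
        (runPrefix-lca-⊑ i≤N start Q (decode i≤N C (truncate i≤N r)))

    module Exchange (xA : XA) (xB : XB) (rA rB : Vec (Fin s) N) where

      module A = Side π xA (belief rA)
      module B = Side (swap π) xB (belief rB)

      QA QB : Node (D * 3) N
      QA = walk stepA C xA rA
      QB = walk stepB C xB rB

      module toA = Link QB rA
      module toB = Link QA rB

      view-belief : ∀ r {k} (k≤N : k ≤ N) j → run start (view k≤N C r j) ≡ belief r (toℕ j)
      view-belief r k≤N j = sym (belief-≤ r (≤-trans (Fin.toℕ≤pred[n] j) k≤N))

      runPrefix-QA : ∀ {j} → j ≤ N → runPrefix j start QA ≡ A.tree j
      runPrefix-QA {j} j≤N = trans (cong (runPrefix j start) (Vec.tabulate-cong λ i →
          A.strategy≡symbol (toℕ i) (view (Fin.toℕ≤n i) C rA) (view-belief rA (Fin.toℕ≤n i))))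
        (runPrefix-tabulate N A.tree (λ i → symbol (A.tree i) (A.path i)) (λ _ → refl) j≤N)

      runPrefix-QB : ∀ {j} → j ≤ N → runPrefix j start QB ≡ B.tree j
      runPrefix-QB {j} j≤N = trans (cong (runPrefix j start) (Vec.tabulate-cong λ i →
          B.strategy≡symbol (toℕ i) (view (Fin.toℕ≤n i) C rB) (view-belief rB (Fin.toℕ≤n i))))
        (runPrefix-tabulate N B.tree (λ i → symbol (B.tree i) (B.path i)) (λ _ → refl) j≤N)

      target : List Bool
      target = toList (transcript π xA xB)

      A-knows : ∀ {i} → i ≤ N → T ⊓ depth (B.tree (toA.agreed i)) target ≤ commonPrefix (A.path i) target
      A-knows {i} i≤N = follow-agrees π xA xB (B.tree (toA.agreed i)) (belief rA i)
        (subst (_⊑ belief rA i) (runPrefix-QB (≤-trans (toA.agreed≤ i) i≤N)) (toA.belief-⊒ i≤N))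
        (B.tree-truthful xA (toA.agreed i))

      B-knows : ∀ {i} → i ≤ N → T ⊓ depth (A.tree (toB.agreed i)) target ≤ commonPrefix (B.path i) target
      B-knows {i} i≤N = subst (λ p → T ⊓ depth (A.tree (toB.agreed i)) p ≤ commonPrefix (B.path i) p)
        (cong toList (transcript-swap π xA xB))
        (follow-agrees (swap π) xB xA (A.tree (toB.agreed i)) (belief rB i)
          (subst (_⊑ belief rB i) (runPrefix-QA (≤-trans (toB.agreed≤ i) i≤N)) (toB.belief-⊒ i≤N))
          (truthful-swap-swap π xA xB (A.tree (toB.agreed i)) (A.tree-truthful xB (toB.agreed i))))

      module RunA = Run A.path A.tree refl (λ _ → refl) target
      module RunB = Run B.path B.tree refl (λ _ → refl) target

      a b progress hits Ψ m : ℕ → ℕ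
      a i = depth (A.tree i) target
      b i = depth (B.tree i) target
      progress i = a i + b i
      hits i = RunA.hits i + RunB.hits i
      -- The summand `i` pays for the fraction 1/n by which a path that is not bad may fall short of
      -- full distance. It occurs once, since each window needs only one of the two directions.
      Ψ i = i + (toA.damage i + toB.damage i)
      m i = toA.agreed i ⊓ toB.agreed i

      a-mono : ∀ {i j} → i ≤ j → a i ≤ a j
      a-mono i≤j = ⊑⇒depth≤ target (A.tree-⊑ i≤j)

      b-mono : ∀ {i j} → i ≤ j → b i ≤ b j
      b-mono i≤j = ⊑⇒depth≤ target (B.tree-⊑ i≤j)

      m≤ : ∀ i → m i ≤ i
      m≤ i = ≤-trans (m⊓n≤m _ _) (toA.agreed≤ i)

      length-target : length target ≡ T
      length-target = Vec.length-toList (transcript π xA xB)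

      a≤1+T : ∀ i → a i ≤ suc T
      a≤1+T i = ≤-trans (depth≤1+length (A.tree i) target) (≤-reflexive (cong suc length-target))

      b≤1+T : ∀ i → b i ≤ suc T
      b≤1+T i = ≤-trans (depth≤1+length (B.tree i) target) (≤-reflexive (cong suc length-target))

      -- Both depths are monotone and both `agreed` rounds lie between `m i` and `i`.
      stable : ∀ i → progress (m i) ≡ progress i → a (toB.agreed i) ≡ a i × b (toA.agreed i) ≡ b i
      stable i same =
        ≤-antisym (a-mono (toB.agreed≤ i)) (≤-trans (≤-reflexive (sym a≡)) (a-mono (m⊓n≤n (toA.agreed i) _))) ,
        ≤-antisym (b-mono (toA.agreed≤ i)) (≤-trans (≤-reflexive (sym b≡)) (b-mono (m⊓n≤m (toA.agreed i) _)))
        where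
        a≡ = proj₁ (+-≡-≤ (a-mono (m≤ i)) (b-mono (m≤ i)) same)
        b≡ = proj₂ (+-≡-≤ (a-mono (m≤ i)) (b-mono (m≤ i)) same)

      window : ∀ i → i ≤ N → n * i + Ψ (m i) ≤ n * m i + Ψ i
      window i i≤N = [ (λ e → subst Goal (sym e) viaA) , (λ e → subst Goal (sym e) viaB) ]′
                       (⊓-sel (toA.agreed i) (toB.agreed i))
        where
        open ≤-Reasoning
        Goal : ℕ → Set
        Goal j = n * i + Ψ j ≤ n * j + Ψ i
        leftmost : ∀ x j f g → x + (j + (f + g)) ≡ x + (j + f) + g
        leftmost = solve-∀
        rightmost : ∀ x j f g → x + (j + (f + g)) ≡ x + (j + g) + f
        rightmost = solve-∀
        viaA : Goal (toA.agreed i)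
        viaA = begin
          n * i + (j + (toA.damage j + toB.damage j))   ≡⟨ leftmost (n * i) j (toA.damage j) (toB.damage j) ⟩
          n * i + (j + toA.damage j) + toB.damage j
            ≤⟨ +-mono-≤ (toA.window i i≤N) (toB.damage-mono (toA.agreed≤ i)) ⟩
          n * j + (i + toA.damage i) + toB.damage i     ≡⟨ leftmost (n * j) i (toA.damage i) (toB.damage i) ⟨
          n * j + (i + (toA.damage i + toB.damage i))   ∎
          where j = toA.agreed i
        viaB : Goal (toB.agreed i)
        viaB = begin
          n * i + (j + (toA.damage j + toB.damage j))   ≡⟨ rightmost (n * i) j (toA.damage j) (toB.damage j) ⟩
          n * i + (j + toB.damage j) + toA.damage j
            ≤⟨ +-mono-≤ (toB.window i i≤N) (toA.damage-mono (toB.agreed≤ i)) ⟩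
          n * j + (i + toB.damage i) + toA.damage i     ≡⟨ rightmost (n * j) i (toA.damage i) (toB.damage i) ⟨
          n * j + (i + (toA.damage i + toB.damage i))   ∎
          where j = toB.agreed i

      ≤T : ∀ {x y} → x ≤ y → x + y < suc T + suc T → x ≤ T
      ≤T x≤y x+y<K = ≮⇒≥ λ T<x → <⇒≱ x+y<K (+-mono-≤ T<x (≤-trans T<x x≤y))

      -- The user who is behind makes the hit: the other user's announcements reach at least as far
      -- along the transcript, and by `stable` they are decoded correctly that far. Since progress
      -- is incomplete, she still has a goal.
      hit : ∀ i → i < N → progress (m i) ≡ progress i → progress i < suc T + suc T → suc (hits i) ≤ hits (suc i)
      hit i i<N same p<K = [ viaA , viaB ]′ (≤-total (a i) (b i))
        where
        viaA : a i ≤ b i → suc (hits i) ≤ hits (suc i)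
        viaA a≤b = +-mono-≤ (+-monoˡ-≤ (RunA.hits i) (≤-reflexive (sym (indicator-yes (hit? target (A.tree i) (A.path i))
            (subst (a i ≤_) (sym length-target) a≤T ,
             ≤-trans (⊓-glb a≤T (≤-trans a≤b (≤-reflexive (sym (proj₂ (stable i same)))))) (A-knows (<⇒≤ i<N)))))))
          (RunB.hits-mono (n≤1+n i))
          where a≤T = ≤T a≤b p<K
        viaB : b i ≤ a i → suc (hits i) ≤ hits (suc i)
        viaB b≤a = ≤-trans (≤-reflexive (sym (+-suc (RunA.hits i) (RunB.hits i)))) (+-mono-≤ (RunA.hits-mono (n≤1+n i))
          (+-monoˡ-≤ (RunB.hits i) (≤-reflexive (sym (indicator-yes (hit? target (B.tree i) (B.path i))
            (subst (b i ≤_) (sym length-target) b≤T ,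
             ≤-trans (⊓-glb b≤T (≤-trans b≤a (≤-reflexive (sym (proj₁ (stable i same)))))) (B-knows (<⇒≤ i<N))))))))
          where b≤T = ≤T b≤a (subst (_< suc T + suc T) (+-comm (a i) (b i)) p<K)

      open Accounting n (suc T + suc T) N progress hits Ψ m
        (λ i≤j → +-mono-≤ (a-mono i≤j) (b-mono i≤j)) (λ i≤j → +-mono-≤ (RunA.hits-mono i≤j) (RunB.hits-mono i≤j))
        (λ i≤j → +-mono-≤ i≤j (+-mono-≤ (toA.damage-mono i≤j) (toB.damage-mono i≤j)))
        m≤ window hit public using (final)

      output-correct : progress (m N) ≡ progress N × progress N ≡ suc T + suc T →
        outA xA (view ≤-refl C rA) ≡ transcript π xA xB × outB xB (view ≤-refl C rB) ≡ transcript π xA xB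
      output-correct (same , complete) =
        trans (cong (pad T ∘ follow π xA) (final-belief rA)) (pad-agrees (A.path N) (transcript π xA xB)
          (≤-trans (⊓-glb ≤-refl (T≤ (trans (proj₂ (stable N same)) (proj₂ full)))) (A-knows ≤-refl))) ,
        trans (cong (pad T ∘ follow (swap π) xB) (final-belief rB)) (pad-agrees (B.path N) (transcript π xA xB)
          (≤-trans (⊓-glb ≤-refl (T≤ (trans (proj₁ (stable N same)) (proj₁ full)))) (B-knows ≤-refl)))
        where
        full = +-≡-≤ (a≤1+T N) (b≤1+T N) complete
        T≤ : ∀ {x} → x ≡ suc T → T ≤ x
        T≤ e = ≤-trans (n≤1+n T) (≤-reflexive (sym e))
        final-belief : ∀ r → run start (view ≤-refl C r (Fin.fromℕ N)) ≡ belief r N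
        final-belief r = trans (view-belief r ≤-refl (Fin.fromℕ N)) (cong (belief r) (Fin.toℕ-fromℕ N))

      correct-unless : ¬ (n * N ≤ Ψ N + n * ((suc T + suc T) + hits N)) →
        outA xA (view ≤-refl C rA) ≡ transcript π xA xB × outB xB (view ≤-refl C rB) ≡ transcript π xA xB
      correct-unless ¬bound = output-correct (decidable-stable
        (progress (m N) ≟ progress N ×-dec progress N ≟ suc T + suc T)
        (λ fails → ¬bound (final (λ i → +-mono-≤ (a≤1+T i) (b≤1+T i)) fails)))

      hits-boundA : D ^ N * 2 ^ RunA.hits N ≤ growth ^ (2 + T) * (D + 4) ^ N
      hits-boundA = subst (λ l → D ^ N * 2 ^ RunA.hits N ≤ growth ^ (2 + l) * (D + 4) ^ N) length-target
        (RunA.hits-bound N)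

      hits-boundB : D ^ N * 2 ^ RunB.hits N ≤ growth ^ (2 + T) * (D + 4) ^ N
      hits-boundB = subst (λ l → D ^ N * 2 ^ RunB.hits N ≤ growth ^ (2 + l) * (D + 4) ^ N) length-target
        (RunB.hits-bound N)

-- Parameters

-- With y = a/x, the induction step adds y and the cross term 2jy·y; the hypothesis bounds the
-- latter by y, whence the factor 2.
bernoulli : ∀ x a j → 2 * (j * a) ≤ x → (x + a) ^ j * x ≤ x ^ j * (x + 2 * (j * a))
bernoulli x a zero    _ = ≤-reflexive (cong (1 *_) (sym (+-identityʳ x)))
bernoulli x a (suc j) h = begin
  (x + a) * (x + a) ^ j * x               ≡⟨ *-assoc (x + a) _ x ⟩
  (x + a) * ((x + a) ^ j * x)
    ≤⟨ *-monoʳ-≤ (x + a) (bernoulli x a j (≤-trans (*-monoʳ-≤ 2 (m≤n+m (j * a) a)) h)) ⟩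
  (x + a) * (x ^ j * (x + 2 * (j * a)))   ≡⟨ expand x a (x ^ j) (j * a) ⟩
  x ^ j * (x * (x + a + 2 * (j * a)) + 2 * (j * a) * a)
    ≤⟨ *-monoʳ-≤ (x ^ j) (+-monoʳ-≤ _ (*-monoˡ-≤ a (≤-trans (*-monoʳ-≤ 2 (m≤n+m (j * a) a)) h))) ⟩
  x ^ j * (x * (x + a + 2 * (j * a)) + x * a)   ≡⟨ collect x a (x ^ j) (j * a) ⟩
  x * x ^ j * (x + 2 * (a + j * a))       ∎
  where
  open ≤-Reasoning
  expand : ∀ x a p b → (x + a) * (p * (x + 2 * b)) ≡ p * (x * (x + a + 2 * b) + 2 * b * a)
  expand = solve-∀
  collect : ∀ x a p b → p * (x * (x + a + 2 * b) + x * a) ≡ x * p * (x + 2 * (a + b))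
  collect = solve-∀

2^-cancel-≤ : ∀ {m n} → 2 ^ m ≤ 2 ^ n → m ≤ n
2^-cancel-≤ h = ≮⇒≥ λ n<m → <⇒≱ (^-monoʳ-< 2 (s≤s (s≤s z≤n)) n<m) h

-- Markov's inequality.
length-filter-≤ : ∀ {A : Set} {P : A → Set} (P? : Decidable P) k f xs → (∀ x → P x → k ≤ f x) →
                  length (List.filter P? xs) * k ≤ ∑ xs f
length-filter-≤ P? k f []       h = z≤n
length-filter-≤ P? k f (x ∷ xs) h with P? x
... | yes p = +-mono-≤ (h x p) (length-filter-≤ P? k f xs h)
... | no  _ = ≤-trans (length-filter-≤ P? k f xs h) (m≤n+m _ (f x))

-- `α` is 1 - 1/E, so badness takes the integral forms used above with `n = E`. `ε′ = 1/(2E)` leaves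
-- fewer than N/(2E) bad arcs in each direction.
module Parameters (E k D : ℕ) .{{_ : NonZero E}} .{{_ : NonZero D}} (E≡ : E ≡ suc k) (D≡ : D ≡ 16 * E)
  (α ε′ : ℚ) (α≡ : α ≡ k ÷ E) (ε′≡ : ε′ ≡ _÷_ 1 (2 * E) {{m*n≢0 2 E}}) where

  instance
    2*E≢0 : NonZero (2 * E)
    2*E≢0 = m*n≢0 2 E

  k*n+n≡E*n : ∀ n → k * n + n ≡ E * n
  k*n+n≡E*n n = trans (+-comm (k * n) n) (cong (_* n) (sym E≡))

  bad⇒ : ∀ {d s N h} (C : TreeCode d s N) (h≤N : h ≤ N) u v → Bad α C h≤N u v →
         E * Δ (W h≤N C u) (W h≤N C v) + (h ∸ lcaDepth u v) < E * (h ∸ lcaDepth u v)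
  bad⇒ {h = h} C h≤N u v bad = <-≤-trans
    (+-monoˡ-< ℓ (fromℕ<÷*⇒ {Δ (W h≤N C u) (W h≤N C v)} {ℓ} {k} E
      (subst (λ α → _ ℚ.< α ℚ.* fromℕ ℓ) α≡ bad)))
    (≤-reflexive (k*n+n≡E*n ℓ))
    where ℓ = h ∸ lcaDepth u v

  ¬bad⇒ : ∀ {d s N h} (C : TreeCode d s N) (h≤N : h ≤ N) u v → ¬ Bad α C h≤N u v →
          E * (h ∸ lcaDepth u v) ≤ E * Δ (W h≤N C u) (W h≤N C v) + (h ∸ lcaDepth u v)
  ¬bad⇒ {h = h} C h≤N u v ¬bad = ≤-trans (≤-reflexive (sym (k*n+n≡E*n ℓ)))
    (+-monoˡ-≤ ℓ (≮⇒≥ λ lt → ¬bad (subst (λ α → _ ℚ.< α ℚ.* fromℕ ℓ) (sym α≡)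
      (⇒fromℕ<÷* {Δ (W h≤N C u) (W h≤N C v)} {ℓ} {k} E lt))))
    where ℓ = h ∸ lcaDepth u v

  d : ℕ
  d = D * 3

  open Player D using (growth)

  -- D = 16 E makes (1 + 4/D)^(2 E) ≤ 2, so that the volume grows by a factor of
  -- at most 2^M during the N = 2 E M rounds.

  module Rounds (g : ℕ) (growth≤2^g : growth ≤ 2 ^ g) (T N : ℕ) (N≡ : N ≡ 2 * E * ((2 + 3 * g) * T)) where

    M : ℕ
    M = (2 + 3 * g) * T

    hits≤ : ∀ G → D ^ N * 2 ^ G ≤ growth ^ (2 + T) * (D + 4) ^ N → G ≤ g * (2 + T) + M
    hits≤ G h = 2^-cancel-≤ (*-cancelˡ-≤ (D ^ N) {{m^n≢0 D N}} (begin
      D ^ N * 2 ^ G                                ≤⟨ h ⟩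
      growth ^ (2 + T) * (D + 4) ^ N
        ≡⟨ cong (growth ^ (2 + T) *_) (trans (^-*-assoc (D + 4) (2 * E) M) (cong ((D + 4) ^_) (sym N≡))) ⟨
      growth ^ (2 + T) * ((D + 4) ^ (2 * E)) ^ M   ≤⟨ *-mono-≤ (^-monoˡ-≤ (2 + T) growth≤2^g) (^-monoˡ-≤ M slow) ⟩
      (2 ^ g) ^ (2 + T) * (2 * D ^ (2 * E)) ^ M    ≡⟨ cong₂ _*_ (^-*-assoc 2 g (2 + T)) (^-distribʳ-* M 2 _) ⟩
      2 ^ (g * (2 + T)) * (2 ^ M * (D ^ (2 * E)) ^ M)
        ≡⟨ cong (λ x → 2 ^ (g * (2 + T)) * (2 ^ M * x)) (trans (^-*-assoc D (2 * E) M) (cong (D ^_) (sym N≡))) ⟩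
      2 ^ (g * (2 + T)) * (2 ^ M * D ^ N)          ≡⟨ rotate (2 ^ (g * (2 + T))) (2 ^ M) (D ^ N) ⟩
      D ^ N * (2 ^ (g * (2 + T)) * 2 ^ M)          ≡⟨ cong (D ^ N *_) (^-distribˡ-+-* 2 (g * (2 + T)) M) ⟨
      D ^ N * 2 ^ (g * (2 + T) + M)                ∎))
      where
      open ≤-Reasoning
      rotate : ∀ a b c → a * (b * c) ≡ c * (a * b)
      rotate = solve-∀
      sixteen : ∀ E → 2 * (2 * E * 4) ≡ 16 * E
      sixteen = solve-∀
      eq : 2 * (2 * E * 4) ≡ D
      eq = trans (sixteen E) (sym D≡)
      twice : ∀ x p → p * (x + x) ≡ x * (2 * p)
      twice = solve-∀
      slow : (D + 4) ^ (2 * E) ≤ 2 * D ^ (2 * E)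
      slow = *-cancelˡ-≤ D (begin
        D * (D + 4) ^ (2 * E)                          ≡⟨ *-comm D _ ⟩
        (D + 4) ^ (2 * E) * D                          ≤⟨ bernoulli D 4 (2 * E) (≤-reflexive eq) ⟩
        D ^ (2 * E) * (D + 2 * (2 * E * 4))            ≡⟨ cong (λ x → D ^ (2 * E) * (D + x)) eq ⟩
        D ^ (2 * E) * (D + D)                          ≡⟨ twice D (D ^ (2 * E)) ⟩
        D * (2 * D ^ (2 * E))                          ∎)

    T≤N : T ≤ N
    T≤N = ≤-trans (m≤n*m T (2 + 3 * g)) (≤-trans (m≤n*m M (2 * E)) (≤-reflexive (sym N≡)))

    N>0⇒T>0 : 0 < N → 0 < T
    N>0⇒T>0 N>0 = n≢0⇒n>0 λ { refl → <⇒≢ N>0 (sym (trans N≡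
      (trans (cong (2 * E *_) (*-zeroʳ (2 + 3 * g))) (*-zeroʳ (2 * E))))) }

  -- After doubling, the noise bound leaves a gap of `8 * N`. Of this, `2 * N` goes to the summand
  -- `N`, less than `2 * N` to bad arcs and at most `4 * N` to progress and hits. The factor
  -- `2 + 3 * g` in `M` comes from 1 + T ≤ 2T and 2 + T ≤ 3T.
  budget : ∀ E g T N → N ≡ 2 * E * ((2 + 3 * g) * T) → 1 ≤ T → ∀ a b A B X Y → let M = (2 + 3 * g) * T in
    E * N ≤ N + ((2 * E * b + E * B) + (2 * E * a + E * A)) + E * ((suc T + suc T) + (X + Y)) →
    2 * E * (a + b) + 4 * N ≤ E * N → 2 * E * A < N → 2 * E * B < N →
    ¬ (X ≤ g * (2 + T) + M × Y ≤ g * (2 + T) + M)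
  budget E g T _ refl 1≤T a b A B X Y total noise A< B< (X≤ , Y≤) = <-irrefl refl (begin-strict
    2 * (E * N + (2 * E * (a + b) + 4 * N))      ≤⟨ *-monoʳ-≤ 2 (+-mono-≤ total noise) ⟩
    2 * (N + ((2 * E * b + E * B) + (2 * E * a + E * A)) + E * ((suc T + suc T) + (X + Y)) + E * N)
      ≡⟨ split E N a b A B (suc T + suc T) X Y ⟩
    2 * (E * N + 2 * E * (a + b) + N) + (2 * E * A + 2 * E * B) + 2 * E * ((suc T + suc T) + (X + Y))
      <⟨ +-mono-<-≤ (+-monoʳ-< (2 * (E * N + 2 * E * (a + b) + N)) (+-mono-< A< B<))
           (*-monoʳ-≤ (2 * E) (+-mono-≤ (+-mono-≤ (s≤s (m≤n+m T 0)) ≤-refl) (+-mono-≤ X≤ Y≤))) ⟩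
    2 * (E * N + 2 * E * (a + b) + N) + (N + N) + 2 * E * ((suc T + suc T) + ((g * (2 + T) + M) + (g * (2 + T) + M)))
      ≤⟨ +-monoʳ-≤ (2 * (E * N + 2 * E * (a + b) + N) + (N + N)) (*-monoʳ-≤ (2 * E) (+-mono-≤ (+-mono-≤ 1+T≤ 1+T≤)
           (+-mono-≤ (+-monoˡ-≤ M (*-monoʳ-≤ g 2+T≤)) (+-monoˡ-≤ M (*-monoʳ-≤ g 2+T≤))))) ⟩
    2 * (E * N + 2 * E * (a + b) + N) + (N + N) + 2 * E * (((T + T) + (T + T)) + ((g * (3 * T) + M) + (g * (3 * T) + M)))
      ≡⟨ close E g T a b ⟩
    2 * (E * N + (2 * E * (a + b) + 4 * N))      ∎)
    where
    open ≤-Reasoning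
    M = (2 + 3 * g) * T
    N = 2 * E * M
    1+T≤ : suc T ≤ T + T
    1+T≤ = +-monoˡ-≤ T 1≤T
    three : ∀ T → T + T + T ≡ 3 * T
    three = solve-∀
    2+T≤ : 2 + T ≤ 3 * T
    2+T≤ = ≤-trans (+-monoˡ-≤ T (+-mono-≤ 1≤T 1≤T)) (≤-reflexive (three T))
    split : ∀ E N a b A B K X Y →
      2 * (N + ((2 * E * b + E * B) + (2 * E * a + E * A)) + E * (K + (X + Y)) + E * N) ≡
      2 * (E * N + 2 * E * (a + b) + N) + (2 * E * A + 2 * E * B) + 2 * E * (K + (X + Y))
    split = solve-∀
    close : ∀ E g T a b → let M = (2 + 3 * g) * T ; N = 2 * E * M in
      2 * (E * N + 2 * E * (a + b) + N) + (N + N) + 2 * E * (((T + T) + (T + T)) + ((g * (3 * T) + M) + (g * (3 * T) + M))) ≡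
      2 * (E * N + (2 * E * (a + b) + 4 * N))
    close = solve-∀

  potent⇒ : ∀ {d s N} (C : TreeCode d s N) → Potent ε′ α C → ∀ Q →
            2 * E * prefixCount (onBadPath? α C Q) N < N
  potent⇒ {N = N} C pot Q = subst₂ (λ b n → 2 * E * b < n) (badLength≡prefixCount α C Q) (*-identityˡ N)
    (fromℕ<÷*⇒ {badLength α C Q} {N} {1} (2 * E)
      (subst (λ ε → fromℕ (badLength α C Q) ℚ.< ε ℚ.* fromℕ N) ε′≡ (pot Q)))

  ¬potent⇒ : ∀ {d s N} (C : TreeCode d s N) → ¬ Potent ε′ α C → ∃[ Q ] N ≤ 2 * E * badLength α C Q
  ¬potent⇒ {d} {N = N} C ¬pot = go (anyNode? N λ Q → N ≤? 2 * E * badLength α C Q)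
    where
    go : Dec (∃[ Q ] N ≤ 2 * E * badLength α C Q) → ∃[ Q ] N ≤ 2 * E * badLength α C Q
    go (yes found) = found
    go (no none)   = ⊥-elim (¬pot λ Q → subst (λ ε → fromℕ (badLength α C Q) ℚ.< ε ℚ.* fromℕ N) (sym ε′≡)
      (⇒fromℕ<÷* {badLength α C Q} {N} {1} (2 * E)
        (<-≤-trans (≰⇒> λ h → none (Q , h)) (≤-reflexive (sym (*-identityˡ N))))))

  simulates : ∀ g → growth ≤ 2 ^ g → ∀ {XA XB s T} N → N ≡ 2 * E * ((2 + 3 * g) * T) → (π : Protocol XA XB T) →
              ∀ {ε} → 1 ÷ E ℚ.≤ ε → (C : TreeCode d s N) →
              Potent ε′ α C → ∀ xA xB r → Simulates (Simulation.simulation D s π N) π ε C xA xB r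
  simulates g growth≤2^g {XA} {XB} {s} {T} N N≡ π {ε} 1/E≤ε C pot xA xB (rA , rB) few =
    X.correct-unless λ bound → budget E g T N N≡
      -- Potency is a strict inequality, so it forces `N` and hence `T` to be positive.
      (R.N>0⇒T>0 (≤-<-trans z≤n (potent⇒ C pot X.QA))) a b (bad X.QA) (bad X.QB) (X.RunA.hits N) (X.RunB.hits N)
      bound noise (potent⇒ C pot X.QA) (potent⇒ C pot X.QB) (R.hits≤ _ X.hits-boundA , R.hits≤ _ X.hits-boundB)
    where
    module R = Rounds g growth≤2^g T N N≡
    module X = Simulation.Execution.Exchange D s π N C E α ¬bad⇒ xA xB rA rB
    a b : ℕ
    bad : Node (D * 3) N → ℕ
    bad Q = prefixCount (onBadPath? α C Q) N
    a = errors X.toB.sent rB N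
    b = errors X.toA.sent rA N
    noise : 2 * E * (a + b) + 4 * N ≤ E * N
    noise = subst (λ e → 2 * E * e + 4 * N ≤ E * N)
      (sym (cong₂ _+_ (errors-all X.toB.sent rB) (errors-all X.toA.sent rA)))
      (noise-bound E N 1/E≤ε few)

  -- Potency of a random code

  s : ℕ
  s = (2 * (4 * (d * d))) ^ (2 * E * E * 2)

  open Generating d s using (single; base; ∑-single)

  instance
    base≢0 : NonZero base
    base≢0 = m*n≢0 4 (d * d) {{_}} {{m*n≢0 d d {{m*n≢0 D 3}} {{m*n≢0 D 3}}}}
    2*base≢0 : NonZero (2 * base)
    2*base≢0 = m*n≢0 2 base

  -- Some path has at least N/(2E) bad arcs, so the larger of the two families has at least N/(4E²)
  -- agreements. The exponent in `s` is 4E², so that this many factors `s` make up `(2 * base) ^ N`.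
  ¬potent⇒single : ∀ {N} (C : TreeCode d s N) → ¬ Potent ε′ α C → (2 * base) ^ N ≤ single C
  ¬potent⇒single {N} C ¬pot =
    let (Q , long) = ¬potent⇒ C ¬pot
        (x , y , x≤ , y≤ , short) = Agreement.badLength≤agreement d s E α bad⇒ C Q
    in conclude x y (badLength α C Q) long x≤ y≤ short
    where
    open ≤-Reasoning
    two : ∀ E m → 2 * E * (E * (m + m)) ≡ 2 * E * E * 2 * m
    two = solve-∀
    conclude : ∀ x y L → N ≤ 2 * E * L → s ^ x ≤ single C → s ^ y ≤ single C → L ≤ E * (x + y) →
               (2 * base) ^ N ≤ single C
    conclude x y L long x≤ y≤ short = begin
      (2 * base) ^ N                    ≤⟨ ^-monoʳ-≤ (2 * base) N≤ ⟩
      (2 * base) ^ (2 * E * E * 2 * z)  ≡⟨ ^-*-assoc (2 * base) (2 * E * E * 2) z ⟨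
      s ^ z                             ≤⟨ z≤ (⊔-sel x y) ⟩
      single C                          ∎
      where
      z = x ⊔ y
      N≤ : N ≤ 2 * E * E * 2 * z
      N≤ = begin
        N                          ≤⟨ long ⟩
        2 * E * L                  ≤⟨ *-monoʳ-≤ (2 * E) short ⟩
        2 * E * (E * (x + y))      ≤⟨ *-monoʳ-≤ (2 * E) (*-monoʳ-≤ E (+-mono-≤ (m≤m⊔n x y) (m≤n⊔m x y))) ⟩
        2 * E * (E * (z + z))      ≡⟨ two E z ⟩
        2 * E * E * 2 * z          ∎
      z≤ : z ≡ x ⊎ z ≡ y → s ^ z ≤ single C
      z≤ (inj₁ e) = subst (λ z → s ^ z ≤ single C) (sym e) x≤
      z≤ (inj₂ e) = subst (λ z → s ^ z ≤ single C) (sym e) y≤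

  s≢0 : NonZero s
  s≢0 = m^n≢0 (2 * (4 * (d * d))) (2 * E * E * 2)

  -- Markov's inequality for `single`: its mean is at most `base ^ N`, while it is at least
  -- `(2 * base) ^ N` on codes that are not potent.
  Pr-¬potent : ∀ {N T} → T ≤ N → {P : TreeCode d s N → Set} (P? : Decidable P) →
               (∀ C → P C → ¬ Potent ε′ α C) → Pr {{s≢0}} P? ℚ.≤ _÷_ 1 (2 ^ T) {{2^-nonZero T}}
  Pr-¬potent {N} {T} T≤N P? P⇒ = ÷-mono-≤ count 1 τ (2 ^ T) {{allCodes-nonEmpty d s N s≢0}} {{2^-nonZero T}} (begin
    count * 2 ^ T      ≤⟨ *-monoʳ-≤ count (^-monoʳ-≤ 2 T≤N) ⟩
    count * 2 ^ N      ≤⟨ *-cancelˡ-≤ (base ^ N) {{m^n≢0 base N}} (begin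
      base ^ N * (count * 2 ^ N)       ≡⟨ rotate (base ^ N) count (2 ^ N) ⟩
      count * (2 ^ N * base ^ N)       ≡⟨ cong (count *_) (^-distribʳ-* N 2 base) ⟨
      count * (2 * base) ^ N           ≤⟨ length-filter-≤ P? _ single (allCodes d s N)
                                           (λ C p → ¬potent⇒single C (P⇒ C p)) ⟩
      ∑ (allCodes d s N) single        ≤⟨ ∑-single N ⟩
      base ^ N * τ                     ∎) ⟩
    τ                  ≡⟨ *-identityˡ τ ⟨
    1 * τ              ∎)
    where
    open ≤-Reasoning
    count = length (List.filter P? (allCodes d s N))
    τ = length (allCodes d s N)
    rotate : ∀ a b c → a * (b * c) ≡ b * (c * a)
    rotate = solve-∀

  -- With a potent code the simulation withstands every adversary, so a failure can only come from a
  -- code that is not potent.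
  Pr-failure : ∀ {XA XB : Set} {N T} → T ≤ N → (Π : TreeCodeProtocol XA XB d s N T) → ∀ π ε →
    (∀ C → Potent ε′ α C → ∀ xA xB r → Simulates Π π ε C xA xB r) →
    ∀ xA xB adv → Pr {{s≢0}} (failure? Π π ε ε′ α xA xB adv) ℚ.≤ _÷_ 1 (2 ^ T) {{2^-nonZero T}}
  Pr-failure T≤N Π π ε correct xA xB adv = Pr-¬potent T≤N (failure? Π π ε ε′ α xA xB adv)
    λ C fails pot → fails (pot , correct C pot xA xB (adv C))

  module _ (g c : ℕ) (growth≤2^g : growth ≤ 2 ^ g) (N : ℕ → ℕ) (N≡ : ∀ T → N T ≡ 2 * E * ((2 + 3 * g) * T))
    (2*N≤c* : ∀ T → 2 * N T ≤ c * T) where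

    coding : 0ℚ ℚ.< ε′ × ε′ ℚ.< 1ℚ → 0ℚ ℚ.< α × α ℚ.< 1ℚ → ∀ {ε} → 1 ÷ E ℚ.≤ ε →
        Σ[ c ∈ ℕ ] Σ[ d ∈ ℕ ] Σ[ s ∈ ℕ ] Σ[ s≢0 ∈ NonZero s ]
        Σ[ ε′ ∈ ℚ ] Σ[ α ∈ ℚ ] Σ[ ν ∈ (ℕ → ℚ) ]
          (0ℚ ℚ.< ε′ × ε′ ℚ.< 1ℚ) × (0ℚ ℚ.< α × α ℚ.< 1ℚ) × Negligible ν ×
          ((XA XB : Set) (T : ℕ) (π : Protocol XA XB T) →
            Σ[ N ∈ ℕ ] Σ[ Π ∈ TreeCodeProtocol XA XB d s N T ]
              2 ℕ.* N ℕ.≤ c ℕ.* T ×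
              (∀ C → Potent ε′ α C → ∀ xA xB r → Simulates Π π ε C xA xB r) ×
              (∀ xA xB adv → Pr {{s≢0}} (failure? Π π ε ε′ α xA xB adv) ℚ.≤ ν T))
    coding 0<ε′<1 0<α<1 {ε} 1/E≤ε =
      c , d , s , s≢0 , ε′ , α , (λ T → _÷_ 1 (2 ^ T) {{2^-nonZero T}}) ,
      0<ε′<1 , 0<α<1 , negligible-1/2^n , λ XA XB T π →
        N T , Simulation.simulation D s π (N T) , 2*N≤c* T , correct π ,
        Pr-failure (Rounds.T≤N g growth≤2^g T (N T) (N≡ T)) (Simulation.simulation D s π (N T)) π ε (correct π)
      where
      correct : ∀ {XA XB T} (π : Protocol XA XB T) (C : TreeCode d s (N T)) → Potent ε′ α C → ∀ xA xB r →
                Simulates (Simulation.simulation D s π (N T)) π ε C xA xB r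
      correct {XA} {XB} {T} π = simulates g growth≤2^g {XA} {XB} {s} {T} (N T) (N≡ T) π {ε} 1/E≤ε

theorem4p1 :
    (ε : ℚ) → 0ℚ ℚ.< ε →
    Σ[ c ∈ ℕ ] Σ[ d ∈ ℕ ] Σ[ s ∈ ℕ ] Σ[ s≢0 ∈ NonZero s ]
    Σ[ ε′ ∈ ℚ ] Σ[ α ∈ ℚ ] Σ[ ν ∈ (ℕ → ℚ) ]
      (0ℚ ℚ.< ε′ × ε′ ℚ.< 1ℚ) × (0ℚ ℚ.< α × α ℚ.< 1ℚ) × Negligible ν ×
      ((XA XB : Set) (T : ℕ) (π : Protocol XA XB T) →
        Σ[ N ∈ ℕ ] Σ[ Π ∈ TreeCodeProtocol XA XB d s N T ]
          2 ℕ.* N ℕ.≤ c ℕ.* T ×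
          (∀ C → Potent ε′ α C → ∀ xA xB r → Simulates Π π ε C xA xB r) ×
          (∀ xA xB adv → Pr {{s≢0}} (failure? Π π ε ε′ α xA xB adv) ℚ.≤ ν T))
theorem4p1 ε 0<ε = Parameters.coding E k (16 * E) refl refl (k ÷ E) (1 ÷ (2 * E)) refl refl
  g (2 * (2 * E * (2 + 3 * g))) (<⇒≤ (n<2^n g)) (λ T → 2 * E * ((2 + 3 * g) * T)) (λ _ → refl)
  (λ T → ≤-reflexive (slowdown E (2 + 3 * g) T))
  (÷-mono-< 0 1 1 (2 * E) (s≤s z≤n) , ÷-mono-< 1 1 (2 * E) 1 (s≤s (s≤s z≤n)))
  (÷-mono-< 0 k 1 E (s≤s z≤n) , ÷-mono-< k 1 E 1 (≤-reflexive (cong suc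
    (trans (*-identityʳ k) (sym (+-identityʳ k))))))
  (1÷suc↧≤ ε 0<ε)
  where
  k = ↧ₙ ε
  E = suc k
  -- Some `g` with `growth ≤ 2 ^ g` is wanted, and by `n<2^n` the number `growth` itself will do.
  g = Player.growth (16 * E)
  slowdown : ∀ E r T → 2 * (2 * E * (r * T)) ≡ 2 * (2 * E * r) * T
  slowdown = solve-∀
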